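{- For any $q\ge5$, in $\mathrm{PG}(3,q)$, the imaginary chords of the twisted cubic $\mathcal{C}$ form an orbit under $G_q$. The subgroup of $G_q$ fixing an imaginary chord has size $2(q+1)$. For $q$ odd, the line $\ell_1$ through the points $\mathbf{P}(1,0,\rho,0)$ and $\mathbf{P}(0,1,0,\rho)$, with $\rho$ a non-square element of $\mathbb{F}_q$, is an imaginary chord. An element $\Psi$ of the subgroup of $G_q$ fixing $\ell_1$ has a matrix of the form \[ \left[ \begin{array}{cccc} \alpha d^3&\alpha \rho b d^2&\alpha \rho^2 b^2 d&\alpha \rho^3 b^3\\ 3bd^2&d^3+2\rho b^2d&\rho^2b^3+2\rho b d^2&3\rho^2b^2d\\ 3\alpha b^2d&\alpha\rho b^3+2\alpha bd^2&\alpha d^3+2\alpha\rho b^2 d&3\alpha\rho bd^2\\ b^3&b^2d&bd^2&d^3 \end{array} \right], \] with $\alpha \in \{ -1,1\}$ and $b,d \in \mathbb{F}_q$ not both $0$. For $q$ even, the line $\ell_2$ through the points $\mathbf{P}(\eta+1,1,1,0)$ and $\mathbf{P}(\eta,\eta,0,1)$, with $\eta$ an element of $\mathbb{F}_q$ of absolute trace $1$, is an imaginary chord. An element $\Psi$ of the subgroup of $G_q$ fixing $\ell_2$ has a matrix of the form \[ \left[ \begin{array}{cccc} A^3&cA^2&c^2A&c^3\\ A^2B&dA^2&c^2B&c^2d\\ AB^2&cB^2&Ad^2&cd^2\\ B^3&dB^2&d^2B&d^3 \end{array} \right], \] where $A = \alpha c+d$, $B= \eta c+(\alpha+1)d$,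 $\alpha \in \{ 0,1\}$, and $c,d \in \mathbb{F}_q$ not both $0$.
   Context: Let $\mathbf{P}(x_0,x_1,x_2,x_3)$ denote the point of $\mathrm{PG}(3,q)$ with homogeneous coordinates $x_i\in\mathbb{F}_q$. Let $\mathcal{C}=\{P(t): t\in\mathbb{F}_q\cup\{\infty\}\}$ be the twisted cubic, where $P(t)=\mathbf{P}(t^3,t^2,t,1)$ for $t\in\mathbb{F}_q$ and $P(\infty)=\mathbf{P}(1,0,0,0)$. Let $G_q$ be the group of projectivities of $\mathrm{PG}(3,q)$ fixing $\mathcal{C}$; for $q\ge5$, $G_q\cong PGL(2,q)$, and a projectivity of $G_q$ acts on points by $[x_0,x_1,x_2,x_3]\mapsto[x_0,x_1,x_2,x_3]M$ where $M$ has the general form \[ M=\left[ \begin{array}{cccc} a^3&a^2c&ac^2&c^3\\ 3a^2b&a^2d+2abc&bc^2+2acd&3c^2d\\ 3ab^2&b^2c+2abd&ad^2+2bcd&3cd^2\\ b^3&b^2d&bd^2&d^3 \end{array} \right],\quad a,b,c,d\in\mathbb{F}_q,\ ad-bc\ne0, \] defined up to a nonzero scalar factor. An imaginary chord of $\mathcal{C}$ is a line of $\mathrm{PG}(3,q)$ joining a pair of complex conjugate points of $\mathcal{C}$ (points $P(t)$ with $t\in\mathbb{F}_{q^2}\setminus\mathbb{F}_q$ and $P(t^q)$). -}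

module Defs where

open import Level using (Level; _⊔_) renaming (suc to lsuc)
open import Algebra.Bundles using (CommutativeRing; Semiring)
import Algebra.Definitions
import Algebra.Definitions.RawSemiring
import Algebra.Properties.Semiring.Sum
open import Algebra.Morphism.Structures using (module RingMorphisms)
open import Data.Nat.Base as ℕ using (ℕ)
open import Data.Fin.Base using (Fin; toℕ)
open import Data.Fin.Patterns using (0F; 1F; 2F; 3F)
open import Data.Maybe.Base using (Maybe; just; nothing)
open import Data.Product.Base using (Σ-syntax; ∃-syntax; _×_; _,_; proj₁)
open import Data.Vec.Functional using (Vector; []; _∷_)
open import Function.Base using (_∘_)
open import Function.Bundles using (Bijection; _⇔_)
open import Relation.Binary.Bundles using (Setoid)
import Relation.Binary.Construct.On as On
import Relation.Binary.PropositionalEquality as ≡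
import Relation.Binary.Reasoning.Setoid as SetoidReasoning
open import Relation.Nullary.Negation.Core using (¬_)
open import Relation.Unary using (Pred)

HasSize : ∀ {a ℓ} → Setoid a ℓ → ℕ → Set (a ⊔ ℓ)
HasSize S n = Bijection (≡.setoid (Fin n)) S

record FiniteField c ℓ (q : ℕ) : Set (lsuc (c ⊔ ℓ)) where
  field
    commutativeRing : CommutativeRing c ℓ

  open CommutativeRing commutativeRing public
  open Algebra.Definitions _≈_ using (Invertible)

  field
    1≉0        : 1# ≉ 0#
    invertible : ∀ x → x ≉ 0# → Invertible 1# _*_ x
    size       : HasSize setoid q

  -- n · x is the n-fold sum x + … + x.
  open Algebra.Definitions.RawSemiring (Semiring.rawSemiring semiring) public
    using (_^_; sum)
    renaming (_×_ to _·_)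

  NonSquare : Pred Carrier (c ⊔ ℓ)
  NonSquare x = ¬ (∃[ y ] y ^ 2 ≈ x)

-- The trace from the field of order p ^ h to its prime field.
absoluteTrace : ∀ {c ℓ q} (F : FiniteField c ℓ q) (p h : ℕ) →
                FiniteField.Carrier F → FiniteField.Carrier F
absoluteTrace F p h x = sum {h} (λ i → x ^ (p ℕ.^ toℕ i))
  where open FiniteField F

module PG3 {c ℓ q} (F : FiniteField c ℓ q) where
  open FiniteField F
  open Algebra.Properties.Semiring.Sum semiring using (sum-cong-≋; sum-replicate-zero)
  open SetoidReasoning setoid

  Vec4 : Set c
  Vec4 = Vector Carrier 4

  infix 4 _≈ᵥ_
  _≈ᵥ_ : Vec4 → Vec4 → Set ℓ
  x ≈ᵥ y = ∀ i → x i ≈ y i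

  0ᵥ : Vec4
  0ᵥ _ = 0#

  infix 4 _∈⟨_,_⟩
  _∈⟨_,_⟩ : Vec4 → Vec4 → Vec4 → Set (c ⊔ ℓ)
  x ∈⟨ u , v ⟩ = ∃[ a ] ∃[ b ] x ≈ᵥ (λ i → a * u i + b * v i)

  -- M i is the i-th row of M, and matrices act on row vectors from the right.
  Matrix : Set c
  Matrix = Vector Vec4 4

  infixl 7 _*ᵥ_
  _*ᵥ_ : Vec4 → Matrix → Vec4
  (x *ᵥ M) j = sum (λ i → x i * M i j)

  infix 4 _∼_
  _∼_ : Matrix → Matrix → Set (c ⊔ ℓ)
  M ∼ N = ∃[ k ] k ≉ 0# × (∀ i j → M i j ≈ k * N i j)

  record Point : Set (c ⊔ ℓ) where
    constructor point
    field
      coords  : Vec4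
      nonzero : ¬ (coords ≈ᵥ 0ᵥ)
  open Point public

  infix 4 _≈ₚ_
  _≈ₚ_ : Point → Point → Set (c ⊔ ℓ)
  X ≈ₚ Y = ∃[ k ] k ≉ 0# × (∀ i → coords X i ≈ k * coords Y i)

  record Projectivity : Set (c ⊔ ℓ) where
    field
      matrix   : Matrix
      inverse  : Matrix
      inverseʳ : ∀ x → x *ᵥ matrix *ᵥ inverse ≈ᵥ x
      inverseˡ : ∀ x → x *ᵥ inverse *ᵥ matrix ≈ᵥ x
  open Projectivity public

  private
    0*ᵥ : ∀ {x} M → x ≈ᵥ 0ᵥ → x *ᵥ M ≈ᵥ 0ᵥ
    0*ᵥ {x} M x≈0 j = begin
      sum (λ i → x i * M i j)
        ≈⟨ sum-cong-≋ {4} (λ i → trans (*-congʳ (x≈0 i)) (zeroˡ (M i j))) ⟩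
      sum {4} (λ _ → 0#)
        ≈⟨ sum-replicate-zero 4 ⟩
      0# ∎

  infixl 7 _∙_
  _∙_ : Point → Projectivity → Point
  X ∙ g = point (coords X *ᵥ matrix g) λ Xg≈0 →
    nonzero X λ i → trans (sym (inverseʳ g (coords X) i)) (0*ᵥ (inverse g) Xg≈0 i)

  -- Equality of projectivities is equality of matrices up to a nonzero scalar.
  projectivities : Setoid (c ⊔ ℓ) (c ⊔ ℓ)
  projectivities = record
    { Carrier = Projectivity
    ; _≈_ = λ g h → matrix g ∼ matrix h
    ; isEquivalence = record
      { refl  = 1# , 1≉0 , λ i j → sym (*-identityˡ _)
      ; sym   = λ (k , k≉0 , M≈kN) →
          let (k⁻¹ , k⁻¹k≈1 , _) = invertible k k≉0 in
          k⁻¹ ,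
          (λ k⁻¹≈0 → 1≉0 (trans (sym k⁻¹k≈1) (trans (*-congʳ k⁻¹≈0) (zeroˡ k)))) ,
          λ i j → sym (trans (*-congˡ (M≈kN i j)) (cancel k⁻¹k≈1))
      ; trans = λ (k , k≉0 , L≈kM) (m , m≉0 , M≈mN) →
          let (_ , k⁻¹k≈1 , _) = invertible k k≉0 in
          k * m ,
          (λ km≈0 → m≉0 (trans (sym (cancel k⁻¹k≈1)) (trans (*-congˡ km≈0) (zeroʳ _)))) ,
          λ i j → trans (L≈kM i j) (trans (*-congˡ (M≈mN i j)) (sym (*-assoc k m _)))
      }
    }
    where
    cancel : ∀ {k k⁻¹ x} → k⁻¹ * k ≈ 1# → k⁻¹ * (k * x) ≈ x
    cancel eq = trans (sym (*-assoc _ _ _)) (trans (*-congʳ eq) (*-identityˡ _))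

  -- g maps the point set S onto T. As g is bijective on points, this says T = S ∙ g.
  Maps_[_]Onto_ : ∀ {a b} → Projectivity → Pred Point a → Pred Point b → Set (c ⊔ ℓ ⊔ a ⊔ b)
  Maps g [ S ]Onto T = ∀ X → S X ⇔ T (X ∙ g)

  record Line : Set (c ⊔ ℓ) where
    constructor line
    field
      p₁ p₂    : Point
      distinct : ¬ (p₁ ≈ₚ p₂)
  open Line public

  pointsOf : Line → Pred Point (c ⊔ ℓ)
  pointsOf l X = coords X ∈⟨ coords (p₁ l) , coords (p₂ l) ⟩

  mapsLine : Projectivity → Line → Line → Set (c ⊔ ℓ)
  mapsLine g l m = Maps g [ pointsOf l ]Onto pointsOf m

  cubicCoords : Carrier → Vec4
  cubicCoords t = t ^ 3 ∷ t ^ 2 ∷ t ∷ 1# ∷ []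

  -- nothing is the parameter ∞.
  P : Maybe Carrier → Point
  P (just t) = point (cubicCoords t) λ z → 1≉0 (z 3F)
  P nothing  = point (1# ∷ 0# ∷ 0# ∷ 0# ∷ []) λ z → 1≉0 (z 0F)

  twistedCubic : Pred Point (c ⊔ ℓ)
  twistedCubic X = ∃[ t ] X ≈ₚ P t

  InG : Pred Projectivity (c ⊔ ℓ)
  InG g = Maps g [ twistedCubic ]Onto twistedCubic

  Fixes : Projectivity → Line → Set (c ⊔ ℓ)
  Fixes g l = mapsLine g l l

  IsOrbit : ∀ {a} → Pred Line a → Set (c ⊔ ℓ ⊔ a)
  IsOrbit S = ∃[ l₀ ] (∀ l → S l ⇔ (∃[ g ] InG g × mapsLine g l₀ l))

  stabilizer : Line → Setoid (c ⊔ ℓ) (c ⊔ ℓ)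
  stabilizer l = On.setoid {B = Σ[ g ∈ Projectivity ] InG g × Fixes g l} projectivities proj₁

  ℓ₁ : Carrier → Line
  ℓ₁ ρ = line
    (point (1# ∷ 0# ∷ ρ ∷ 0# ∷ []) λ z → 1≉0 (z 0F))
    (point (0# ∷ 1# ∷ 0# ∷ ρ ∷ []) λ z → 1≉0 (z 1F))
    λ (k , _ , e) → 1≉0 (trans (e 0F) (zeroʳ k))

  ℓ₂ : Carrier → Line
  ℓ₂ η = line
    (point (η + 1# ∷ 1# ∷ 1# ∷ 0# ∷ []) λ z → 1≉0 (z 2F))
    (point (η ∷ η ∷ 0# ∷ 1# ∷ []) λ z → 1≉0 (z 3F))
    λ (k , _ , e) → 1≉0 (trans (e 2F) (zeroʳ k))

  Ψ₁ : (ρ α b d : Carrier) → Matrix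
  Ψ₁ ρ α b d =
    (α * d ^ 3 ∷ α * ρ * b * d ^ 2 ∷ α * ρ ^ 2 * b ^ 2 * d ∷ α * ρ ^ 3 * b ^ 3 ∷ []) ∷
    (3 · b * d ^ 2 ∷ d ^ 3 + 2 · ρ * b ^ 2 * d
      ∷ ρ ^ 2 * b ^ 3 + 2 · ρ * b * d ^ 2 ∷ 3 · ρ ^ 2 * b ^ 2 * d ∷ []) ∷
    (3 · α * b ^ 2 * d ∷ α * ρ * b ^ 3 + 2 · α * b * d ^ 2
      ∷ α * d ^ 3 + 2 · α * ρ * b ^ 2 * d ∷ 3 · α * ρ * b * d ^ 2 ∷ []) ∷
    (b ^ 3 ∷ b ^ 2 * d ∷ b * d ^ 2 ∷ d ^ 3 ∷ []) ∷ []

  Ψ₂ : (η α c d : Carrier) → Matrix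
  Ψ₂ η α c d =
    (A ^ 3     ∷ c * A ^ 2 ∷ c ^ 2 * A ∷ c ^ 3     ∷ []) ∷
    (A ^ 2 * B ∷ d * A ^ 2 ∷ c ^ 2 * B ∷ c ^ 2 * d ∷ []) ∷
    (A * B ^ 2 ∷ c * B ^ 2 ∷ A * d ^ 2 ∷ c * d ^ 2 ∷ []) ∷
    (B ^ 3     ∷ d * B ^ 2 ∷ d ^ 2 * B ∷ d ^ 3     ∷ []) ∷ []
    where
    A B : Carrier
    A = α * c + d
    B = η * c + (α + 1#) * d

-- K plays the role of the field of order q ^ 2, containing F through ι.
module Chords {c ℓ c′ ℓ′ q} (F : FiniteField c ℓ q) (K : FiniteField c′ ℓ′ (q ℕ.^ 2))
              (ι : FiniteField.Carrier F → FiniteField.Carrier K) where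
  private
    module F = FiniteField F
    module K = FiniteField K
  open PG3 F using (Line; p₁; p₂; coords)
  open PG3 K using (cubicCoords; _∈⟨_,_⟩)

  IsEmbedding : Set _
  IsEmbedding = IsRingHomomorphism ι
    where
    open RingMorphisms (CommutativeRing.rawRing F.commutativeRing)
                       (CommutativeRing.rawRing K.commutativeRing)

  OnExtension : Line → K.Carrier → Set (c′ ⊔ ℓ′)
  OnExtension l t = cubicCoords t ∈⟨ ι ∘ coords (p₁ l) , ι ∘ coords (p₂ l) ⟩

  ImaginaryChord : Pred Line (c ⊔ c′ ⊔ ℓ′)
  ImaginaryChord l = ∃[ t ] ¬ (∃[ x ] ι x K.≈ t) × OnExtension l t × OnExtension l (t K.^ q)

{-# OPTIONS --safe #-}
-- For t ∈ K ∖ F, counting shows that 1, t is an F-basis of K, so t² = S t + D with S, D ∈ F. Comparing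
-- coordinates in this basis, a rational line contains P(t) iff it is the line with equations
-- x₁ = S x₂ + D x₃, x₀ = S x₁ + D x₂. So imaginary chords correspond to conjugate pairs { t, S - t },
-- and a matrix M(a,b,c,d) moves the chord of t to the chord of (a t + b) / (c t + d). As every
-- t′ ∈ K ∖ F is a t + b, affine maps already act transitively. The stabilizer consists of the
-- (a t + b) / (c t + d) equal to t or to S - t; in both cases a and b are determined by c and d,
-- so that the stabilizer is parametrised by two projective lines, which are disjoint as K is separable.
--
-- That G_q consists of the matrices M(a,b,c,d) is seen by moving the images of P(∞) and P(0) back: if
-- both are fixed, then the quadrics through the cubic become cubic equations in t with q - 1 ≥ 4 roots.
module Submission where

open import Defs
open import Algebra.Bundles using (CommutativeRing; Semiring)
import Algebra.Definitions.RawSemiring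
open import Algebra.Morphism.Structures using (module RingMorphisms)
import Algebra.Properties.AbelianGroup
import Algebra.Properties.CommutativeMonoid.Sum
import Algebra.Properties.CommutativeSemigroup
import Algebra.Properties.CommutativeSemiring.Binomial
import Algebra.Properties.CommutativeSemiring.Exp
import Algebra.Properties.Group
import Algebra.Properties.Ring
import Algebra.Properties.Semiring.Mult
import Algebra.Properties.Semiring.Mult.TCOptimised
import Algebra.Properties.Semiring.Sum
import Algebra.Solver.Ring
open import Algebra.Solver.Ring.AlmostCommutativeRing using (fromCommutativeRing; _-Raw-AlmostCommutative⟶_)
open import Data.Fin.Base as Fin using (Fin; zero; suc; toℕ; punchIn; punchOut; fromℕ; inject₁)
open import Data.Fin.Patterns using (0F; 1F; 2F; 3F)
open import Data.Fin.Permutation using (Permutation; permutation)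
import Data.Fin.Properties as Fin
open import Data.Integer.Base as ℤ using (ℤ; +_; -[1+_])
import Data.Integer.Properties as ℤ
open import Data.Maybe.Base using (Maybe; just; nothing)
open import Data.Nat.Base as ℕ using (ℕ; zero; suc; _!)
open import Data.Nat.Combinatorics using (_C_; nCk≡n!/k![n-k]!; k![n∸k]!∣n!; nCn≡1)
open import Data.Nat.DivMod using (m/n*n≡m)
open import Data.Nat.Divisibility using (_∣_; divides; ∣⇒≤; m∣m*n; ∣1⇒≡1)
open import Data.Nat.Primality using (Prime; euclidsLemma; prime⇒nonZero; prime⇒nonTrivial; prime⇒irreducible; prime[2])
import Data.Nat.Properties as ℕ
open import Data.Product.Base using (_×_; _,_; proj₁; proj₂; Σ-syntax; ∃-syntax)
open import Data.Sum.Base using (_⊎_; inj₁; inj₂; [_,_]′)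
open import Data.Vec.Functional using (Vector; []; _∷_; removeAt; replicate)
open import Function.Base using (_∘_)
open import Function.Bundles using (Bijection; _⇔_; mk⇔; Equivalence)
open import Relation.Binary.Bundles using (Setoid)
open import Relation.Binary.PropositionalEquality.Core as ≡ using (_≡_; _≢_)
import Relation.Binary.Reasoning.Setoid as SetoidReasoning
open import Relation.Nullary.Decidable.Core using (yes; no; Dec; map′; toSum)
open import Relation.Nullary.Negation.Core using (¬_; contradiction)

-- `K` is known only through its order, so counting yields some irrational t with no control over
-- its minimal polynomial, whereas `ℓ₁ ρ` and `ℓ₂ η` demand roots of X² = 1 / ρ and X² = X + η.
-- Completing the square, or dividing t by its trace, only reaches X² = δ or X² = X + δ for some δ
-- that leaves the polynomial without roots in F. A second count, now in F, moves δ to the wanted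
-- constant: the squares and their multiples by δ, or the set of all x² + x and its translate by δ,
-- exhaust F, while ρ and η avoid the first set. A scaling or a translation of the root by an
-- element of F does the rest.
--
-- The definition of an imaginary chord speaks of t ^ q, but the arguments work with S - t, which is
-- visible in coordinates. It is enough that t ^ q is a root of the same polynomial, because a
-- rational line through P(t) contains P of every such root.

-- A ring solver with integer coefficients

module IntegerSolver {c ℓ} (R : CommutativeRing c ℓ) where
  open CommutativeRing R
  open Algebra.Properties.Ring ring using (-0#≈0#; -‿distribˡ-*; -‿distribʳ-*; -‿involutive)
  open Algebra.Properties.AbelianGroup +-abelianGroup using () renaming (⁻¹-∙-comm to -‿+-comm)
  open Algebra.Properties.Semiring.Mult.TCOptimised semiring using (×-homo-+; ×1-homo-*) renaming (_×_ to _·_)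
  open SetoidReasoning setoid

  -- With the optimised multiplication 1 · 1# reduces to 1#, so that `con (ℤ.+ 1)` denotes 1# on the
  -- nose.
  ⟦_⟧ᶻ : ℤ → Carrier
  ⟦ + n ⟧ᶻ      = n · 1#
  ⟦ -[1+ n ] ⟧ᶻ = - (suc n · 1#)

  private
    ⟦⟧-neg : ∀ i → ⟦ ℤ.- i ⟧ᶻ ≈ - ⟦ i ⟧ᶻ
    ⟦⟧-neg (+ zero)  = sym -0#≈0#
    ⟦⟧-neg (+ suc n) = refl
    ⟦⟧-neg -[1+ n ]  = sym (-‿involutive _)

    suc-× : ∀ n → suc n · 1# ≈ 1# + n · 1#
    suc-× n = ×-homo-+ 1# 1 n

    ⟦⟧-⊖ : ∀ m n → ⟦ m ℤ.⊖ n ⟧ᶻ ≈ m · 1# - n · 1#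
    ⟦⟧-⊖ m zero = sym (trans (+-congˡ -0#≈0#) (+-identityʳ _))
    ⟦⟧-⊖ zero (suc n) = sym (+-identityˡ _)
    ⟦⟧-⊖ (suc m) (suc n) = begin
      ⟦ suc m ℤ.⊖ suc n ⟧ᶻ                     ≡⟨ ≡.cong ⟦_⟧ᶻ (ℤ.[1+m]⊖[1+n]≡m⊖n m n) ⟩
      ⟦ m ℤ.⊖ n ⟧ᶻ                             ≈⟨ ⟦⟧-⊖ m n ⟩
      m · 1# - n · 1#                          ≈⟨ +-congʳ (+-identityˡ _) ⟨
      0# + m · 1# - n · 1#                     ≈⟨ +-congʳ (+-congʳ (-‿inverseʳ 1#)) ⟨
      1# - 1# + m · 1# - n · 1#                ≈⟨ +-congʳ (+-assoc _ _ _) ⟩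
      1# + (- 1# + m · 1#) - n · 1#            ≈⟨ +-congʳ (+-congˡ (+-comm _ _)) ⟩
      1# + (m · 1# - 1#) - n · 1#              ≈⟨ +-congʳ (+-assoc _ _ _) ⟨
      1# + m · 1# - 1# - n · 1#                ≈⟨ +-assoc _ _ _ ⟩
      1# + m · 1# + (- 1# - n · 1#)            ≈⟨ +-cong (suc-× m) (trans (-‿cong (suc-× n)) (sym (-‿+-comm _ _))) ⟨
      suc m · 1# - suc n · 1#                  ∎

    ⟦⟧-+ : ∀ i j → ⟦ i ℤ.+ j ⟧ᶻ ≈ ⟦ i ⟧ᶻ + ⟦ j ⟧ᶻ
    ⟦⟧-+ (+ m) (+ n) = ×-homo-+ 1# m n
    ⟦⟧-+ (+ m) -[1+ n ] = ⟦⟧-⊖ m (suc n)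
    ⟦⟧-+ -[1+ m ] (+ n) = trans (⟦⟧-⊖ n (suc m)) (+-comm _ _)
    ⟦⟧-+ i@(-[1+ m ]) j@(-[1+ n ]) = begin
      ⟦ i ℤ.+ j ⟧ᶻ                   ≡⟨ ≡.cong ⟦_⟧ᶻ (ℤ.neg-distrib-+ (+ suc m) (+ suc n)) ⟨
      ⟦ ℤ.- (+ suc m ℤ.+ + suc n) ⟧ᶻ ≈⟨ ⟦⟧-neg (+ suc m ℤ.+ + suc n) ⟩
      - ((suc m ℕ.+ suc n) · 1#)     ≈⟨ -‿cong (×-homo-+ 1# (suc m) (suc n)) ⟩
      - (suc m · 1# + suc n · 1#)    ≈⟨ -‿+-comm _ _ ⟨
      ⟦ i ⟧ᶻ + ⟦ j ⟧ᶻ                ∎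

    ⟦⟧-pos* : ∀ m j → ⟦ + m ℤ.* j ⟧ᶻ ≈ m · 1# * ⟦ j ⟧ᶻ
    ⟦⟧-pos* m (+ n) = trans (reflexive (≡.cong ⟦_⟧ᶻ (≡.sym (ℤ.pos-* m n)))) (×1-homo-* m n)
    ⟦⟧-pos* m -[1+ n ] = begin
      ⟦ + m ℤ.* -[1+ n ] ⟧ᶻ          ≡⟨ ≡.cong ⟦_⟧ᶻ (ℤ.neg-distribʳ-* (+ m) (+ suc n)) ⟨
      ⟦ ℤ.- (+ m ℤ.* + suc n) ⟧ᶻ     ≈⟨ ⟦⟧-neg (+ m ℤ.* + suc n) ⟩
      - ⟦ + m ℤ.* + suc n ⟧ᶻ         ≈⟨ -‿cong (⟦⟧-pos* m (+ suc n)) ⟩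
      - (m · 1# * (suc n · 1#))      ≈⟨ -‿distribʳ-* _ _ ⟩
      m · 1# * ⟦ -[1+ n ] ⟧ᶻ         ∎

    ⟦⟧-* : ∀ i j → ⟦ i ℤ.* j ⟧ᶻ ≈ ⟦ i ⟧ᶻ * ⟦ j ⟧ᶻ
    ⟦⟧-* (+ m) j = ⟦⟧-pos* m j
    ⟦⟧-* -[1+ m ] j = begin
      ⟦ -[1+ m ] ℤ.* j ⟧ᶻ            ≡⟨ ≡.cong ⟦_⟧ᶻ (ℤ.neg-distribˡ-* (+ suc m) j) ⟨
      ⟦ ℤ.- (+ suc m ℤ.* j) ⟧ᶻ       ≈⟨ ⟦⟧-neg (+ suc m ℤ.* j) ⟩
      - ⟦ + suc m ℤ.* j ⟧ᶻ           ≈⟨ -‿cong (⟦⟧-pos* (suc m) j) ⟩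
      - (suc m · 1# * ⟦ j ⟧ᶻ)        ≈⟨ -‿distribˡ-* _ _ ⟩
      ⟦ -[1+ m ] ⟧ᶻ * ⟦ j ⟧ᶻ         ∎

    homomorphism : ℤ.+-*-rawRing -Raw-AlmostCommutative⟶ fromCommutativeRing R
    homomorphism = record
      { ⟦_⟧    = ⟦_⟧ᶻ
      ; +-homo = ⟦⟧-+
      ; *-homo = ⟦⟧-*
      ; -‿homo = ⟦⟧-neg
      ; 0-homo = refl
      ; 1-homo = refl
      }

    -- Coefficients are compared as integers, so the solver proves only identities that hold in
    -- every commutative ring; relations such as 2 = 0 have to be supplied by hand.
    equal? : ∀ i j → Maybe (⟦ i ⟧ᶻ ≈ ⟦ j ⟧ᶻ)
    equal? i j with i ℤ.≟ j
    ... | yes ≡.refl = just refl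
    ... | no _ = nothing

  open Algebra.Solver.Ring ℤ.+-*-rawRing (fromCommutativeRing R) homomorphism equal? public

-- Cubic forms, the Veronese map and the matrices of G_q over a commutative ring

module CubicMatrices {c ℓ} (R : CommutativeRing c ℓ) where
  open CommutativeRing R
  open Algebra.Definitions.RawSemiring (Semiring.rawSemiring semiring) using (sum)
  open Algebra.Properties.Semiring.Sum semiring using (sum-cong-≋; *-distribˡ-sum; *-distribʳ-sum)
  open Algebra.Properties.CommutativeMonoid.Sum +-commutativeMonoid using (∑-comm; ∑-distrib-+)
  open IntegerSolver R
  open Algebra.Properties.CommutativeSemigroup *-commutativeSemigroup using (x∙yz≈y∙xz)
  open SetoidReasoning setoid

  -- This and the next definitions agree with those of `PG3` by unfolding, so results pass between
  -- the two without conversion, both over F and over K.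
  Vec4 : Set c
  Vec4 = Vector Carrier 4

  Matrix : Set c
  Matrix = Vector Vec4 4

  infix 4 _≈ᵥ_
  _≈ᵥ_ : Vec4 → Vec4 → Set ℓ
  x ≈ᵥ y = ∀ i → x i ≈ y i

  infixl 7 _*ᵥ_
  _*ᵥ_ : Vec4 → Matrix → Vec4
  (x *ᵥ M) j = sum (λ i → x i * M i j)

  *ᵥ-congʳ : ∀ {x y} M → x ≈ᵥ y → x *ᵥ M ≈ᵥ y *ᵥ M
  *ᵥ-congʳ {x} {y} M x≈y j = sum-cong-≋ {4} {λ i → x i * M i j} {λ i → y i * M i j} (λ i → *-congʳ (x≈y i))

  *ᵥ-congˡ : ∀ x {M N : Matrix} → (∀ i j → M i j ≈ N i j) → x *ᵥ M ≈ᵥ x *ᵥ N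
  *ᵥ-congˡ x {M} {N} M≈N j = sum-cong-≋ {4} {λ i → x i * M i j} {λ i → x i * N i j} (λ i → *-congˡ (M≈N i j))

  *ᵥ-assoc : ∀ x M N → x *ᵥ M *ᵥ N ≈ᵥ x *ᵥ (λ i → M i *ᵥ N)
  *ᵥ-assoc x M N k = begin
    sum {4} (λ j → sum {4} (λ i → x i * M i j) * N j k)
      ≈⟨ sum-cong-≋ {4} (λ j → *-distribʳ-sum (N j k) (λ i → x i * M i j)) ⟩
    sum {4} (λ j → sum {4} (λ i → x i * M i j * N j k))
      ≈⟨ ∑-comm {4} {4} (λ j i → x i * M i j * N j k) ⟩
    sum {4} (λ i → sum {4} (λ j → x i * M i j * N j k))
      ≈⟨ sum-cong-≋ {4} (λ i → trans (sum-cong-≋ {4} (λ j → *-assoc (x i) (M i j) (N j k)))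
                                     (sym (*-distribˡ-sum (x i) (λ j → M i j * N j k)))) ⟩
    sum {4} (λ i → x i * sum {4} (λ j → M i j * N j k)) ∎

  *ᵥ-linear : ∀ r s x y M → (λ i → r * x i + s * y i) *ᵥ M ≈ᵥ λ i → r * (x *ᵥ M) i + s * (y *ᵥ M) i
  *ᵥ-linear r s x y M j = begin
    sum {4} (λ i → (r * x i + s * y i) * M i j)
      ≈⟨ sum-cong-≋ {4} (λ i → trans (distribʳ (M i j) (r * x i) (s * y i)) (+-cong (*-assoc r (x i) (M i j)) (*-assoc s (y i) (M i j)))) ⟩
    sum {4} (λ i → r * (x i * M i j) + s * (y i * M i j))
      ≈⟨ ∑-distrib-+ {4} (λ i → r * (x i * M i j)) (λ i → s * (y i * M i j)) ⟩
    sum {4} (λ i → r * (x i * M i j)) + sum {4} (λ i → s * (y i * M i j))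
      ≈⟨ +-cong (*-distribˡ-sum r (λ i → x i * M i j)) (*-distribˡ-sum s (λ i → y i * M i j)) ⟨
    r * sum {4} (λ i → x i * M i j) + s * sum {4} (λ i → y i * M i j) ∎

  *ᵥ-scale : ∀ k x M → (λ i → k * x i) *ᵥ M ≈ᵥ λ i → k * (x *ᵥ M) i
  *ᵥ-scale k x M j = trans (sum-cong-≋ {4} (λ i → *-assoc k (x i) (M i j))) (sym (*-distribˡ-sum k (λ i → x i * M i j)))

  *ᵥ-scaleˡ : ∀ k x M → x *ᵥ (λ i j → k * M i j) ≈ᵥ λ i → k * (x *ᵥ M) i
  *ᵥ-scaleˡ k x M j = trans (sum-cong-≋ {4} (λ i → x∙yz≈y∙xz (x i) k (M i j))) (sym (*-distribˡ-sum k (λ i → x i * M i j)))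

  -- (p , q) stands for the linear form p t + q, and triple l₁ l₂ l₃ lists the coefficients of the
  -- product of three forms, highest degree first.
  Form : Set c
  Form = Carrier × Carrier

  triple : Form → Form → Form → Vec4
  triple (p , q) (r , s) (u , v) 0F = p * r * u
  triple (p , q) (r , s) (u , v) 1F = p * r * v + p * s * u + q * r * u
  triple (p , q) (r , s) (u , v) 2F = p * s * v + q * r * v + q * s * u
  triple (p , q) (r , s) (u , v) 3F = q * s * v

  infix 4 _≈ₗ_
  _≈ₗ_ : Form → Form → Set ℓ
  (p , q) ≈ₗ (r , s) = p ≈ r × q ≈ s

  triple-cong : ∀ {k k′ l l′ m m′} → k ≈ₗ k′ → l ≈ₗ l′ → m ≈ₗ m′ → triple k l m ≈ᵥ triple k′ l′ m′
  triple-cong (p , q) (r , s) (u , v) 0F = *-cong (*-cong p r) u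
  triple-cong (p , q) (r , s) (u , v) 1F = +-cong (+-cong (*-cong (*-cong p r) v) (*-cong (*-cong p s) u)) (*-cong (*-cong q r) u)
  triple-cong (p , q) (r , s) (u , v) 2F = +-cong (+-cong (*-cong (*-cong p s) v) (*-cong (*-cong q r) v)) (*-cong (*-cong q s) u)
  triple-cong (p , q) (r , s) (u , v) 3F = *-cong (*-cong q s) v

  -- Column j holds the coefficients of (a t + b)^(3-j) (c t + d)^j; this is the matrix M of G_q.
  cubicMatrix : (a b c d : Carrier) → Matrix
  cubicMatrix a b c d i 0F = triple (a , b) (a , b) (a , b) i
  cubicMatrix a b c d i 1F = triple (a , b) (a , b) (c , d) i
  cubicMatrix a b c d i 2F = triple (a , b) (c , d) (c , d) i
  cubicMatrix a b c d i 3F = triple (c , d) (c , d) (c , d) i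

  cubicMatrix-cong : ∀ {a a′ b b′ c c′ d d′} → a ≈ a′ → b ≈ b′ → c ≈ c′ → d ≈ d′ →
                     ∀ i j → cubicMatrix a b c d i j ≈ cubicMatrix a′ b′ c′ d′ i j
  cubicMatrix-cong a b c d i 0F = triple-cong (a , b) (a , b) (a , b) i
  cubicMatrix-cong a b c d i 1F = triple-cong (a , b) (a , b) (c , d) i
  cubicMatrix-cong a b c d i 2F = triple-cong (a , b) (c , d) (c , d) i
  cubicMatrix-cong a b c d i 3F = triple-cong (c , d) (c , d) (c , d) i

  triple-scale : ∀ k p q r s u v →
    triple (k * p , k * q) (k * r , k * s) (k * u , k * v) ≈ᵥ λ i → k * k * k * triple (p , q) (r , s) (u , v) i
  triple-scale k p q r s u v 0F =
    solve 4 (λ k p r u → k :* p :* (k :* r) :* (k :* u) := k :* k :* k :* (p :* r :* u)) refl k p r u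
  triple-scale k p q r s u v 1F =
    solve 7 (λ k p q r s u v →
      k :* p :* (k :* r) :* (k :* v) :+ k :* p :* (k :* s) :* (k :* u) :+ k :* q :* (k :* r) :* (k :* u)
      := k :* k :* k :* (p :* r :* v :+ p :* s :* u :+ q :* r :* u)) refl k p q r s u v
  triple-scale k p q r s u v 2F =
    solve 7 (λ k p q r s u v →
      k :* p :* (k :* s) :* (k :* v) :+ k :* q :* (k :* r) :* (k :* v) :+ k :* q :* (k :* s) :* (k :* u)
      := k :* k :* k :* (p :* s :* v :+ q :* r :* v :+ q :* s :* u)) refl k p q r s u v
  triple-scale k p q r s u v 3F =
    solve 4 (λ k p r u → k :* p :* (k :* r) :* (k :* u) := k :* k :* k :* (p :* r :* u)) refl k q s v

  cubicMatrix-scale : ∀ k a b c d i j →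
    cubicMatrix (k * a) (k * b) (k * c) (k * d) i j ≈ k * k * k * cubicMatrix a b c d i j
  cubicMatrix-scale k a b c d i 0F = triple-scale k a b a b a b i
  cubicMatrix-scale k a b c d i 1F = triple-scale k a b a b c d i
  cubicMatrix-scale k a b c d i 2F = triple-scale k a b c d c d i
  cubicMatrix-scale k a b c d i 3F = triple-scale k c d c d c d i

  -- The homogeneous parametrisation of the cubic: a multiple of P(s / t), and of P(∞) when t = 0.
  veronese : Carrier → Carrier → Vec4
  veronese s t 0F = s * s * s
  veronese s t 1F = s * s * t
  veronese s t 2F = s * t * t
  veronese s t 3F = t * t * t

  veronese-cong : ∀ {s s′ t t′} → s ≈ s′ → t ≈ t′ → veronese s t ≈ᵥ veronese s′ t′
  veronese-cong s t 0F = *-cong (*-cong s s) s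
  veronese-cong s t 1F = *-cong (*-cong s s) t
  veronese-cong s t 2F = *-cong (*-cong s t) t
  veronese-cong s t 3F = *-cong (*-cong t t) t

  veronese-scale : ∀ k s t → veronese (k * s) (k * t) ≈ᵥ λ i → k * k * k * veronese s t i
  veronese-scale k s t 0F = solve 2 (λ k s → k :* s :* (k :* s) :* (k :* s) := k :* k :* k :* (s :* s :* s)) refl k s
  veronese-scale k s t 1F = solve 3 (λ k s t → k :* s :* (k :* s) :* (k :* t) := k :* k :* k :* (s :* s :* t)) refl k s t
  veronese-scale k s t 2F = solve 3 (λ k s t → k :* s :* (k :* t) :* (k :* t) := k :* k :* k :* (s :* t :* t)) refl k s t
  veronese-scale k s t 3F = solve 2 (λ k s → k :* s :* (k :* s) :* (k :* s) := k :* k :* k :* (s :* s :* s)) refl k t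

  private
    -- `veronese s t` lists the monomials in the order in which `triple` lists coefficients, so
    -- pairing the two evaluates the product of forms at (s , t).
    triple-eval : ∀ s t p q r w u v →
      sum {4} (λ i → veronese s t i * triple (p , q) (r , w) (u , v) i)
      ≈ (p * s + q * t) * (r * s + w * t) * (u * s + v * t)
    triple-eval = solve 8 (λ s t p q r w u v →
      s :* s :* s :* (p :* r :* u)
      :+ (s :* s :* t :* (p :* r :* v :+ p :* w :* u :+ q :* r :* u)
      :+ (s :* t :* t :* (p :* w :* v :+ q :* r :* v :+ q :* w :* u)
      :+ (t :* t :* t :* (q :* w :* v) :+ con (ℤ.+ 0))))
      := (p :* s :+ q :* t) :* (r :* s :+ w :* t) :* (u :* s :+ v :* t)) refl

  veronese-*ᵥ : ∀ s t a b c d → veronese s t *ᵥ cubicMatrix a b c d ≈ᵥ veronese (a * s + b * t) (c * s + d * t)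
  veronese-*ᵥ s t a b c d 0F = triple-eval s t a b a b a b
  veronese-*ᵥ s t a b c d 1F = triple-eval s t a b a b c d
  veronese-*ᵥ s t a b c d 2F = triple-eval s t a b c d c d
  veronese-*ᵥ s t a b c d 3F = triple-eval s t c d c d c d

  infixl 7 _∘ₗ_
  _∘ₗ_ : Form → (Carrier × Carrier) × (Carrier × Carrier) → Form
  (p , q) ∘ₗ ((a , b) , (c , d)) = (p * a + q * c) , (p * b + q * d)

  -- Substituting a t + b and c t + d into forms commutes with multiplying the forms. Rows 0 and 3
  -- of the matrix are `veronese a c` and `veronese b d`, so there the substitution is an
  -- evaluation.
  cubicMatrix-*ᵥ-triple : ∀ a b c d k l m i →
    sum {4} (λ j → cubicMatrix a b c d i j * triple k l m j)
    ≈ triple (k ∘ₗ ((a , b) , (c , d))) (l ∘ₗ ((a , b) , (c , d))) (m ∘ₗ ((a , b) , (c , d))) i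
  cubicMatrix-*ᵥ-triple a b c d (p , q) (r , s) (u , v) 0F = triple-eval a c p q r s u v
  cubicMatrix-*ᵥ-triple a b c d (p , q) (r , s) (u , v) 1F = go a b c d p q r s u v
    where
    go : ∀ a b c d p q r s u v → _ ≈ _
    go = solve 10 (λ a b c d p q r s u v →
      (a :* a :* b :+ a :* b :* a :+ b :* a :* a) :* (p :* r :* u)
      :+ ((a :* a :* d :+ a :* b :* c :+ b :* a :* c) :* (p :* r :* v :+ p :* s :* u :+ q :* r :* u)
      :+ ((a :* c :* d :+ a :* d :* c :+ b :* c :* c) :* (p :* s :* v :+ q :* r :* v :+ q :* s :* u)
      :+ ((c :* c :* d :+ c :* d :* c :+ d :* c :* c) :* (q :* s :* v) :+ con (ℤ.+ 0))))
      := (p :* a :+ q :* c) :* (r :* a :+ s :* c) :* (u :* b :+ v :* d)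
         :+ (p :* a :+ q :* c) :* (r :* b :+ s :* d) :* (u :* a :+ v :* c)
         :+ (p :* b :+ q :* d) :* (r :* a :+ s :* c) :* (u :* a :+ v :* c)) refl
  cubicMatrix-*ᵥ-triple a b c d (p , q) (r , s) (u , v) 2F = go a b c d p q r s u v
    where
    go : ∀ a b c d p q r s u v → _ ≈ _
    go = solve 10 (λ a b c d p q r s u v →
      (a :* b :* b :+ b :* a :* b :+ b :* b :* a) :* (p :* r :* u)
      :+ ((a :* b :* d :+ b :* a :* d :+ b :* b :* c) :* (p :* r :* v :+ p :* s :* u :+ q :* r :* u)
      :+ ((a :* d :* d :+ b :* c :* d :+ b :* d :* c) :* (p :* s :* v :+ q :* r :* v :+ q :* s :* u)
      :+ ((c :* d :* d :+ d :* c :* d :+ d :* d :* c) :* (q :* s :* v) :+ con (ℤ.+ 0))))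
      := (p :* a :+ q :* c) :* (r :* b :+ s :* d) :* (u :* b :+ v :* d)
         :+ (p :* b :+ q :* d) :* (r :* a :+ s :* c) :* (u :* b :+ v :* d)
         :+ (p :* b :+ q :* d) :* (r :* b :+ s :* d) :* (u :* a :+ v :* c)) refl
  cubicMatrix-*ᵥ-triple a b c d (p , q) (r , s) (u , v) 3F = triple-eval b d p q r s u v

  -- Each column of the second matrix is a `triple`, to which substitution applies. As matrices act
  -- on rows, the 2 × 2 matrices are multiplied in the opposite order.
  cubicMatrix-∘ : ∀ a b c d a′ b′ c′ d′ i →
    cubicMatrix a b c d i *ᵥ cubicMatrix a′ b′ c′ d′
    ≈ᵥ cubicMatrix (a′ * a + b′ * c) (a′ * b + b′ * d) (c′ * a + d′ * c) (c′ * b + d′ * d) i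
  cubicMatrix-∘ a b c d a′ b′ c′ d′ i 0F = cubicMatrix-*ᵥ-triple a b c d (a′ , b′) (a′ , b′) (a′ , b′) i
  cubicMatrix-∘ a b c d a′ b′ c′ d′ i 1F = cubicMatrix-*ᵥ-triple a b c d (a′ , b′) (a′ , b′) (c′ , d′) i
  cubicMatrix-∘ a b c d a′ b′ c′ d′ i 2F = cubicMatrix-*ᵥ-triple a b c d (a′ , b′) (c′ , d′) (c′ , d′) i
  cubicMatrix-∘ a b c d a′ b′ c′ d′ i 3F = cubicMatrix-*ᵥ-triple a b c d (c′ , d′) (c′ , d′) (c′ , d′) i

  -- Copies of `triple` and `cubicMatrix` in solver syntax; they denote the originals by unfolding,
  -- so that later identities can name matrix entries instead of expanding them.
  :triple : ∀ {n} (p q r s u v : Polynomial n) → Vector (Polynomial n) 4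
  :triple p q r s u v 0F = p :* r :* u
  :triple p q r s u v 1F = p :* r :* v :+ p :* s :* u :+ q :* r :* u
  :triple p q r s u v 2F = p :* s :* v :+ q :* r :* v :+ q :* s :* u
  :triple p q r s u v 3F = q :* s :* v

  :cubicMatrix : ∀ {n} (a b c d : Polynomial n) → Vector (Vector (Polynomial n) 4) 4
  :cubicMatrix a b c d i 0F = :triple a b a b a b i
  :cubicMatrix a b c d i 1F = :triple a b a b c d i
  :cubicMatrix a b c d i 2F = :triple a b c d c d i
  :cubicMatrix a b c d i 3F = :triple c d c d c d i

  private
    *ᵥ-identity : ∀ x → x *ᵥ cubicMatrix 1# 0# 0# 1# ≈ᵥ x
    *ᵥ-identity x = λ where
        0F → solve 4 (λ x₀ x₁ x₂ x₃ → :image 0F x₀ x₁ x₂ x₃ := x₀) refl (x 0F) (x 1F) (x 2F) (x 3F)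
        1F → solve 4 (λ x₀ x₁ x₂ x₃ → :image 1F x₀ x₁ x₂ x₃ := x₁) refl (x 0F) (x 1F) (x 2F) (x 3F)
        2F → solve 4 (λ x₀ x₁ x₂ x₃ → :image 2F x₀ x₁ x₂ x₃ := x₂) refl (x 0F) (x 1F) (x 2F) (x 3F)
        3F → solve 4 (λ x₀ x₁ x₂ x₃ → :image 3F x₀ x₁ x₂ x₃ := x₃) refl (x 0F) (x 1F) (x 2F) (x 3F)
      where
      :column : Vector (Vector (Polynomial 4) 4) 4
      :column j i = :cubicMatrix (con (ℤ.+ 1)) (con (ℤ.+ 0)) (con (ℤ.+ 0)) (con (ℤ.+ 1)) i j

      :image : Fin 4 → (x₀ x₁ x₂ x₃ : Polynomial 4) → Polynomial 4
      :image j x₀ x₁ x₂ x₃ = x₀ :* :column j 0F :+ (x₁ :* :column j 1F :+ (x₂ :* :column j 2F :+ (x₃ :* :column j 3F :+ con (ℤ.+ 0))))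

  cubicMatrix-inverse : ∀ {a b c d a′ b′ c′ d′} →
    a′ * a + b′ * c ≈ 1# → a′ * b + b′ * d ≈ 0# → c′ * a + d′ * c ≈ 0# → c′ * b + d′ * d ≈ 1# →
    ∀ x → x *ᵥ cubicMatrix a b c d *ᵥ cubicMatrix a′ b′ c′ d′ ≈ᵥ x
  cubicMatrix-inverse {a} {b} {c} {d} {a′} {b′} {c′} {d′} e₁ e₂ e₃ e₄ x j =
    trans (*ᵥ-assoc x (cubicMatrix a b c d) (cubicMatrix a′ b′ c′ d′) j)
   (trans (*ᵥ-congˡ x (λ i k → trans (cubicMatrix-∘ a b c d a′ b′ c′ d′ i k) (cubicMatrix-cong e₁ e₂ e₃ e₄ i k)) j)
          (*ᵥ-identity x j))

-- Finite fields

-- A missed value could be punched out of the codomain, leaving an injection from `Fin (suc n)` into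
-- `Fin n`.
injective⇒surjective : ∀ {n} (f : Fin n → Fin n) → (∀ {i j} → f i ≡ f j → i ≡ j) → ∀ j → ∃[ i ] f i ≡ j
injective⇒surjective {suc n} f inj j with Fin.any? (λ i → f i Fin.≟ j)
... | yes hit = hit
... | no miss = contradiction (Fin.injective⇒≤ {f = g} g-injective) (ℕ.<⇒≱ (ℕ.n<1+n n))
  where
  avoids : ∀ i → j ≢ f i
  avoids i eq = miss (i , ≡.sym eq)
  g : Fin (suc n) → Fin n
  g i = punchOut (avoids i)
  g-injective : ∀ {i k} → g i ≡ g k → i ≡ k
  g-injective {i} {k} eq = inj (Fin.punchOut-injective (avoids i) (avoids k) eq)

prime∤! : ∀ {p} → Prime p → ∀ {k} → k ℕ.< p → ¬ p ∣ k !
prime∤! {p} pr {zero} _ p∣1 = ℕ.nonTrivial⇒≢1 {{prime⇒nonTrivial pr}} (∣1⇒≡1 p∣1)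
prime∤! {p} pr {suc k} k<p p∣k! with euclidsLemma (suc k) (k !) pr p∣k!
... | inj₁ p∣1+k = ℕ.<⇒≱ k<p (∣⇒≤ p∣1+k)
... | inj₂ p∣k!′ = prime∤! pr (ℕ.<-trans (ℕ.n<1+n k) k<p) p∣k!′

-- p divides p!, which is the binomial coefficient times k! (p - k)!, but it divides neither of
-- these factorials of smaller numbers.
prime∣C : ∀ {p} → Prime p → ∀ {k} → 0 ℕ.< k → k ℕ.< p → p ∣ p C k
prime∣C {p@(suc p-1)} pr {k} 0<k k<p
  with euclidsLemma (p C k) (k ! ℕ.* (p ℕ.∸ k) !) pr (≡.subst (p ∣_) (≡.sym C*d≡p!) (m∣m*n (p-1 !)))
  where
  instance _ = (k ℕ.!* (p ℕ.∸ k) !≢0)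
  C*d≡p! : (p C k) ℕ.* (k ! ℕ.* (p ℕ.∸ k) !) ≡ p !
  C*d≡p! = ≡.trans (≡.cong (ℕ._* (k ! ℕ.* (p ℕ.∸ k) !)) (nCk≡n!/k![n-k]! (ℕ.<⇒≤ k<p)))
                   (m/n*n≡m (k![n∸k]!∣n! (ℕ.<⇒≤ k<p)))
... | inj₁ p∣C = p∣C
... | inj₂ p∣d with euclidsLemma (k !) ((p ℕ.∸ k) !) pr p∣d
...   | inj₁ p∣k! = contradiction p∣k! (prime∤! pr k<p)
...   | inj₂ p∣l! = contradiction p∣l! (prime∤! pr (ℕ.∸-monoʳ-< 0<k (ℕ.<⇒≤ k<p)))

even-prime-power : ∀ {p} → Prime p → ∀ h → 2 ∣ p ℕ.^ h → p ≡ 2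
even-prime-power pr zero 2∣1 = contradiction (∣1⇒≡1 2∣1) λ ()
even-prime-power {p} pr (suc h) 2∣p^ with euclidsLemma p (p ℕ.^ h) prime[2] 2∣p^
... | inj₂ 2∣p^h = even-prime-power pr h 2∣p^h
... | inj₁ 2∣p with prime⇒irreducible pr 2∣p
...   | inj₁ ()
...   | inj₂ 2≡p = ≡.sym 2≡p

-- The Frobenius map in characteristic p

module Frobenius {c ℓ} (R : CommutativeRing c ℓ) where
  open CommutativeRing R hiding (zero)
  open Algebra.Properties.Semiring.Mult semiring using (×-congʳ; ×-assoc-*; ×-homo-1; ×1-homo-*) renaming (_×_ to _·_)
  open Algebra.Properties.CommutativeSemiring.Exp commutativeSemiring using (_^_; ^-congˡ; ^-assocʳ)
  open Algebra.Properties.Semiring.Sum semiring using (sum; sum-cong-≋; sum-replicate-zero; sum-init-last)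
  open SetoidReasoning setoid

  multiple≈0 : ∀ {m n} → m · 1# ≈ 0# → m ∣ n → ∀ x → n · x ≈ 0#
  multiple≈0 {m} {n} m1≈0 (divides k ≡.refl) x = begin
    (k ℕ.* m) · x           ≈⟨ ×-congʳ (k ℕ.* m) (*-identityˡ x) ⟨
    (k ℕ.* m) · (1# * x)    ≈⟨ ×-assoc-* (k ℕ.* m) 1# x ⟨
    (k ℕ.* m) · 1# * x      ≈⟨ *-congʳ (×1-homo-* k m) ⟩
    k · 1# * (m · 1#) * x   ≈⟨ *-congʳ (trans (*-congˡ m1≈0) (zeroʳ _)) ⟩
    0# * x                  ≈⟨ zeroˡ x ⟩
    0#                      ∎

  module _ {p} (pr : Prime p) (char : p · 1# ≈ 0#) where
    +-^p : ∀ x y → (x + y) ^ p ≈ x ^ p + y ^ p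
    +-^p x y = go p ≡.refl
      where
      open Algebra.Properties.CommutativeSemiring.Binomial commutativeSemiring
        using (binomialTerm) renaming (theorem to binomial-theorem)
      -- The exponent becomes a variable so that matching it as `suc m` exposes the first and the
      -- last term of the binomial sum.
      go : ∀ n → p ≡ n → (x + y) ^ n ≈ x ^ n + y ^ n
      go zero p≡0 = contradiction p≡0 (ℕ.≢-nonZero⁻¹ p {{prime⇒nonZero pr}})
      go (suc m) ≡.refl = begin
        (x + y) ^ suc m
          ≈⟨ binomial-theorem (suc m) x y ⟩
        t zero + sum (t ∘ suc)
          ≈⟨ +-cong first (sum-init-last (t ∘ suc)) ⟩
        y ^ suc m + (sum (t ∘ suc ∘ inject₁) + t (suc (fromℕ m)))
          ≈⟨ +-congˡ (+-cong (trans (sum-cong-≋ middle) (sum-replicate-zero m)) last) ⟩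
        y ^ suc m + (0# + x ^ suc m)
          ≈⟨ trans (+-congˡ (+-identityˡ _)) (+-comm _ _) ⟩
        x ^ suc m + y ^ suc m ∎
        where
        t : Vector Carrier (suc (suc m))
        t = binomialTerm x y (suc m)
        first : t zero ≈ y ^ suc m
        first = trans (×-homo-1 _) (*-identityˡ _)
        last : t (suc (fromℕ m)) ≈ x ^ suc m
        last rewrite Fin.toℕ-fromℕ m | nCn≡1 (suc m) | ℕ.n∸n≡0 m = trans (×-homo-1 _) (*-identityʳ _)
        middle : ∀ i → t (suc (inject₁ i)) ≈ 0#
        middle i = multiple≈0 char (prime∣C pr (ℕ.s≤s ℕ.z≤n) (ℕ.s≤s (≡.subst (ℕ._< m) (≡.sym (Fin.toℕ-inject₁ i)) (Fin.toℕ<n i)))) _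

    +-^p^ : ∀ h x y → (x + y) ^ (p ℕ.^ h) ≈ x ^ (p ℕ.^ h) + y ^ (p ℕ.^ h)
    +-^p^ zero x y = trans (*-identityʳ _) (sym (+-cong (*-identityʳ x) (*-identityʳ y)))
    +-^p^ (suc h) x y = begin
      (x + y) ^ (p ℕ.* p ℕ.^ h)                      ≈⟨ ^-assocʳ (x + y) p (p ℕ.^ h) ⟨
      ((x + y) ^ p) ^ (p ℕ.^ h)                      ≈⟨ ^-congˡ (p ℕ.^ h) (+-^p x y) ⟩
      (x ^ p + y ^ p) ^ (p ℕ.^ h)                    ≈⟨ +-^p^ h (x ^ p) (y ^ p) ⟩
      (x ^ p) ^ (p ℕ.^ h) + (y ^ p) ^ (p ℕ.^ h)      ≈⟨ +-cong (^-assocʳ x p (p ℕ.^ h)) (^-assocʳ y p (p ℕ.^ h)) ⟩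
      x ^ (p ℕ.* p ℕ.^ h) + y ^ (p ℕ.* p ℕ.^ h)      ∎

-- Consequences of having an enumeration of the field

module FiniteFieldProperties {c ℓ q} (F : FiniteField c ℓ q) where
  open FiniteField F hiding (zero)
  open Algebra.Properties.Ring ring using (x∙y⁻¹≈ε⇒x≈y)
  open Algebra.Properties.Group +-group using () renaming (∙-cancelˡ to +-cancelˡ)
  open Algebra.Properties.CommutativeSemiring.Exp commutativeSemiring using (^-congˡ)
  open Algebra.Properties.Semiring.Mult semiring using (×1-homo-*)
  private
    module Π = Algebra.Properties.CommutativeMonoid.Sum *-commutativeMonoid
    module Σ = Algebra.Properties.CommutativeMonoid.Sum +-commutativeMonoid
  open IntegerSolver commutativeRing using (solve; _:=_; _:+_; _:-_; _:*_)
  open SetoidReasoning setoid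

  element : Fin q → Carrier
  element = Bijection.to size

  index : Carrier → Fin q
  index = Bijection.to⁻ size

  element-index : ∀ x → element (index x) ≈ x
  element-index x = proj₂ (Bijection.surjective size x) ≡.refl

  index-cong : ∀ {x y} → x ≈ y → index x ≡ index y
  index-cong x≈y = Bijection.injective size (trans (element-index _) (trans x≈y (sym (element-index _))))

  index-injective : ∀ {x y} → index x ≡ index y → x ≈ y
  index-injective {x} {y} eq = trans (sym (element-index x)) (trans (Bijection.cong size eq) (element-index y))

  index-element : ∀ i → index (element i) ≡ i
  index-element i = Bijection.injective size (element-index (element i))

  infix 4 _≟_
  _≟_ : ∀ x y → Dec (x ≈ y)
  x ≟ y = map′ index-injective index-cong (index x Fin.≟ index y)

  injective⇒surjective′ : ∀ (f : Carrier → Carrier) → (∀ {x y} → f x ≈ f y → x ≈ y) → ∀ y → ∃[ x ] f x ≈ y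
  injective⇒surjective′ f inj y =
    let (i , eq) = injective⇒surjective (index ∘ f ∘ element)
                     (λ e → Bijection.injective size (inj (index-injective e))) (index y)
    in element i , index-injective eq

  infix 8 _⁻¹⟨_⟩
  _⁻¹⟨_⟩ : ∀ x → x ≉ 0# → Carrier
  x ⁻¹⟨ x≉0 ⟩ = proj₁ (invertible x x≉0)

  ⁻¹-inverseˡ : ∀ x x≉0 → x ⁻¹⟨ x≉0 ⟩ * x ≈ 1#
  ⁻¹-inverseˡ x x≉0 = proj₁ (proj₂ (invertible x x≉0))

  *-cancelˡ : ∀ {x y z} → x ≉ 0# → x * y ≈ x * z → y ≈ z
  *-cancelˡ {x} {y} {z} x≉0 xy≈xz = trans (sym (undo y)) (trans (*-congˡ xy≈xz) (undo z))
    where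
    undo : ∀ w → x ⁻¹⟨ x≉0 ⟩ * (x * w) ≈ w
    undo w = trans (sym (*-assoc _ _ _)) (trans (*-congʳ (⁻¹-inverseˡ x x≉0)) (*-identityˡ w))

  *-≈0 : ∀ {x y} → x ≉ 0# → x * y ≈ 0# → y ≈ 0#
  *-≈0 {x} x≉0 xy≈0 = *-cancelˡ x≉0 (trans xy≈0 (sym (zeroʳ x)))

  *-≉0 : ∀ {x y} → x ≉ 0# → y ≉ 0# → x * y ≉ 0#
  *-≉0 x≉0 y≉0 xy≈0 = y≉0 (*-≈0 x≉0 xy≈0)

  zero-product : ∀ x y → x * y ≈ 0# → x ≈ 0# ⊎ y ≈ 0#
  zero-product x y xy≈0 with x ≟ 0#
  ... | yes x≈0 = inj₁ x≈0
  ... | no x≉0 = inj₂ (*-≈0 x≉0 xy≈0)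

  square≈0 : ∀ {x} → x * x ≈ 0# → x ≈ 0#
  square≈0 {x} xx≈0 = [ (λ z → z) , (λ z → z) ]′ (zero-product x x xx≈0)

  factor≉0ˡ : ∀ {x y} → x * y ≉ 0# → x ≉ 0#
  factor≉0ˡ xy≉0 x≈0 = xy≉0 (trans (*-congʳ x≈0) (zeroˡ _))

  factor≉0ʳ : ∀ {x y} → x * y ≉ 0# → y ≉ 0#
  factor≉0ʳ xy≉0 y≈0 = xy≉0 (trans (*-congˡ y≈0) (zeroʳ _))

  ⁻¹≉0 : ∀ x x≉0 → x ⁻¹⟨ x≉0 ⟩ ≉ 0#
  ⁻¹≉0 x x≉0 = factor≉0ˡ λ eq → 1≉0 (trans (sym (⁻¹-inverseˡ x x≉0)) eq)

  square-roots : ∀ {x y} → x * x ≈ y * y → x ≈ y ⊎ x ≈ - y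
  square-roots {x} {y} eq with zero-product (x - y) (x + y) (trans factored (trans (+-congʳ eq) (-‿inverseʳ _)))
    where
    factored : (x - y) * (x + y) ≈ x * x - y * y
    factored = solve 2 (λ x y → (x :- y) :* (x :+ y) := x :* x :- y :* y) refl x y
  ... | inj₁ x-y≈0 = inj₁ (x∙y⁻¹≈ε⇒x≈y x y x-y≈0)
  ... | inj₂ x+y≈0 = inj₂ (uniqueˡ-⁻¹ x y x+y≈0)

  private
    reindex : ∀ (f g : Carrier → Carrier) → (∀ {x y} → x ≈ y → f x ≈ f y) → (∀ {x y} → x ≈ y → g x ≈ g y) →
              (∀ x → f (g x) ≈ x) → (∀ x → g (f x) ≈ x) → Permutation q q
    reindex f g f-cong g-cong fg gf = permutation (index ∘ f ∘ element) (index ∘ g ∘ element)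
      (λ i → ≡.trans (index-cong (trans (f-cong (element-index _)) (fg _))) (index-element i))
      (λ i → ≡.trans (index-cong (trans (g-cong (element-index _)) (gf _))) (index-element i))

    -- The additional factor x makes up for the entry 1 at position i.
    product-except : ∀ {n} i (t : Vector Carrier n) {x} → t i ≈ 1# → (∀ j → j ≢ i → t j ≈ x) → x * Π.sum t ≈ x ^ n
    product-except {suc n} i t {x} tᵢ≈1 tⱼ≈x = *-congˡ (begin
      Π.sum t                          ≈⟨ Π.sum-remove {i = i} t ⟩
      t i * Π.sum (removeAt t i)       ≈⟨ trans (*-congʳ tᵢ≈1) (*-identityˡ _) ⟩
      Π.sum (removeAt t i)             ≈⟨ Π.sum-cong-≋ (λ j → tⱼ≈x (punchIn i j) (Fin.punchInᵢ≢i i j)) ⟩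
      Π.sum (replicate n x)            ≈⟨ Π.sum-replicate n ⟩
      x ^ n                            ∎)

    product≉0 : ∀ {n} (t : Vector Carrier n) → (∀ i → t i ≉ 0#) → Π.sum t ≉ 0#
    product≉0 {zero}  t t≉0 = 1≉0
    product≉0 {suc n} t t≉0 = *-≉0 (t≉0 zero) (product≉0 (t ∘ suc) (t≉0 ∘ suc))

    -- Lets a product over the nonzero elements run over the whole enumeration, with a default at 0.
    unless0 : (z x y : Carrier) → Carrier
    unless0 z x y with z ≟ 0#
    ... | yes _ = y
    ... | no _  = x

    unless0-≈0 : ∀ {z x y} → z ≈ 0# → unless0 z x y ≈ y
    unless0-≈0 {z} z≈0 with z ≟ 0#
    ... | yes _ = refl
    ... | no z≉0 = contradiction z≈0 z≉0

    unless0-≉0 : ∀ {z x y} → z ≉ 0# → unless0 z x y ≈ x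
    unless0-≉0 {z} z≉0 with z ≟ 0#
    ... | yes z≈0 = contradiction z≈0 z≉0
    ... | no _ = refl

  -- Multiplication by x ≉ 0 permutes the nonzero elements, so x ^ (q - 1) is a quotient of equal products.
  x^q≈x : ∀ x → x ^ q ≈ x
  x^q≈x x with x ≟ 0#
  ... | yes x≈0 = trans (^-congˡ q x≈0) (trans (0^ (index 0#)) (sym x≈0))
    where
    0^ : ∀ {n} → Fin n → 0# ^ n ≈ 0#
    0^ {suc n} _ = zeroˡ _
  ... | no x≉0 = begin
    x ^ q              ≈⟨ product-except (index 0#) g (unless0-≈0 (element-index 0#)) (λ j j≢0 → unless0-≉0 (j≢0 ∘ at0)) ⟨
    x * Π.sum g        ≈⟨ *-congˡ ∏g≈1 ⟩
    x * 1#             ≈⟨ *-identityʳ x ⟩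
    x                  ∎
    where
    x⁻¹ = x ⁻¹⟨ x≉0 ⟩
    at0 : ∀ {j} → element j ≈ 0# → j ≡ index 0#
    at0 {j} eq = ≡.trans (≡.sym (index-element j)) (index-cong eq)
    e : Carrier → Carrier
    e y = unless0 y y 1#
    e-cong : ∀ {y z} → y ≈ z → e y ≈ e z
    e-cong {y} {z} y≈z with z ≟ 0#
    ... | yes z≈0 = unless0-≈0 (trans y≈z z≈0)
    ... | no z≉0 = trans (unless0-≉0 (λ y≈0 → z≉0 (trans (sym y≈z) y≈0))) y≈z
    e≉0 : ∀ y → e y ≉ 0#
    e≉0 y with y ≟ 0#
    ... | yes _ = 1≉0
    ... | no y≉0 = y≉0
    -- The factor by which `e` changes when an element is multiplied by x: x at the nonzero
    -- elements, 1# at zero.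
    g : Vector Carrier q
    g i = unless0 (element i) x 1#
    e-* : ∀ i → e (x * element i) ≈ g i * e (element i)
    e-* i with element i ≟ 0#
    ... | yes eq = trans (unless0-≈0 (trans (*-congˡ eq) (zeroʳ x))) (sym (*-identityˡ 1#))
    ... | no neq = unless0-≉0 (*-≉0 x≉0 neq)
    π : Permutation q q
    π = reindex (x *_) (x⁻¹ *_) *-congˡ *-congˡ
          (λ y → trans (sym (*-assoc _ _ _)) (trans (*-congʳ (trans (*-comm _ _) (⁻¹-inverseˡ x x≉0))) (*-identityˡ y)))
          (λ y → trans (sym (*-assoc _ _ _)) (trans (*-congʳ (⁻¹-inverseˡ x x≉0)) (*-identityˡ y)))
    ∏e = Π.sum (e ∘ element)
    ∏g≈1 : Π.sum g ≈ 1#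
    ∏g≈1 = *-cancelˡ (product≉0 (e ∘ element) (e≉0 ∘ element)) (begin
      ∏e * Π.sum g                                  ≈⟨ *-comm _ _ ⟩
      Π.sum g * ∏e                                  ≈⟨ Π.∑-distrib-+ g (e ∘ element) ⟨
      Π.sum (λ i → g i * e (element i))             ≈⟨ Π.sum-cong-≋ (λ i → e-* i) ⟨
      Π.sum (λ i → e (x * element i))               ≈⟨ Π.sum-cong-≋ (λ i → e-cong (element-index (x * element i))) ⟨
      Π.sum (λ i → e (element (index (x * element i)))) ≈⟨ Π.sum-permute (e ∘ element) π ⟨
      ∏e                                            ≈⟨ *-identityʳ _ ⟨
      ∏e * 1#                                       ∎)

  -- Translation by 1# permutes the field, so adding 1# to each of the q summands does not change
  -- the sum of all elements.
  q·1≈0 : q · 1# ≈ 0#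
  q·1≈0 = sym (+-cancelˡ (Σ.sum element) _ _ (begin
    Σ.sum element + 0#                                ≈⟨ +-identityʳ _ ⟩
    Σ.sum element                                     ≈⟨ Σ.sum-permute element π ⟩
    Σ.sum (λ i → element (index (element i + 1#)))    ≈⟨ Σ.sum-cong-≋ (λ i → element-index (element i + 1#)) ⟩
    Σ.sum (λ i → element i + 1#)                      ≈⟨ Σ.∑-distrib-+ element (λ _ → 1#) ⟩
    Σ.sum element + Σ.sum (replicate q 1#)            ≈⟨ +-congˡ (Σ.sum-replicate q) ⟩
    Σ.sum element + q · 1#                            ∎))
    where
    π : Permutation q q
    π = reindex (_+ 1#) (_- 1#) +-congʳ +-congʳ
          (λ y → trans (+-assoc _ _ _) (trans (+-congˡ (-‿inverseˡ 1#)) (+-identityʳ y)))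
          (λ y → trans (+-assoc _ _ _) (trans (+-congˡ (-‿inverseʳ 1#)) (+-identityʳ y)))

  -- p ^ k · 1# is the k-th power of p · 1#, and a field has no zero divisors.
  p·1≈0 : ∀ p k → q ≡ p ℕ.^ k → p · 1# ≈ 0#
  p·1≈0 p k q≡p^k = root k (≡.subst (λ n → n · 1# ≈ 0#) q≡p^k q·1≈0)
    where
    root : ∀ k → (p ℕ.^ k) · 1# ≈ 0# → p · 1# ≈ 0#
    root zero 1·1≈0 = contradiction (trans (sym (+-identityʳ 1#)) 1·1≈0) 1≉0
    root (suc k) eq with zero-product _ _ (trans (sym (×1-homo-* p (p ℕ.^ k))) eq)
    ... | inj₁ p1≈0 = p1≈0
    ... | inj₂ p^k1≈0 = root k p^k1≈0

  -- σ is an involution whose orbits are the fibres of f and of g. Applying f to one point of each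
  -- two-element orbit and g to the other is injective, hence covers the field.
  two-to-one-cover : ∀ (σ f g : Carrier → Carrier) → (∀ {x y} → x ≈ y → σ x ≈ σ y) → (∀ x → σ (σ x) ≈ x) →
    (∀ {x y} → f x ≈ f y → x ≈ y ⊎ x ≈ σ y) → (∀ {x y} → g x ≈ g y → x ≈ y ⊎ x ≈ σ y) →
    (∀ {x y} → f x ≈ g y → y ≈ σ y) → ∀ z → (∃[ x ] f x ≈ z) ⊎ (∃[ x ] g x ≈ z)
  two-to-one-cover σ f g σ-cong σσ f-fibre g-fibre f≉g z with injective⇒surjective′ h h-injective z
    where
    -- Comparing indices selects a point of each orbit. A fixed point of `σ` always goes to `f`, so
    -- a collision f x ≈ g y is excluded as soon as it would make y a fixed point.
    h : Carrier → Carrier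
    h x with index x Fin.≤? index (σ x)
    ... | yes _ = f x
    ... | no _  = g x
    index-σ : ∀ {x y} → x ≈ σ y → index (σ x) ≡ index y
    index-σ x≈σy = index-cong (trans (σ-cong x≈σy) (σσ _))
    h-injective : ∀ {x y} → h x ≈ h y → x ≈ y
    h-injective {x} {y} eq with index x Fin.≤? index (σ x) | index y Fin.≤? index (σ y)
    ... | yes x≤σx | yes y≤σy with f-fibre eq
    ...   | inj₁ x≈y = x≈y
    ...   | inj₂ x≈σy = index-injective (Fin.≤-antisym
              (≡.subst (index x Fin.≤_) (index-σ x≈σy) x≤σx)
              (≡.subst (index y Fin.≤_) (≡.sym (index-cong x≈σy)) y≤σy))
    h-injective {x} {y} eq | no x≰σx | no y≰σy with g-fibre eq
    ...   | inj₁ x≈y = x≈y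
    ...   | inj₂ x≈σy = contradiction
              (≡.subst₂ Fin._≤_ (≡.sym (index-cong x≈σy)) (≡.sym (index-σ x≈σy)) (ℕ.<⇒≤ (ℕ.≰⇒> y≰σy))) x≰σx
    h-injective {x} {y} eq | yes x≤σx | no y≰σy = contradiction (ℕ.≤-reflexive (≡.cong toℕ (index-cong (f≉g eq)))) y≰σy
    h-injective {x} {y} eq | no x≰σx | yes y≤σy = contradiction (ℕ.≤-reflexive (≡.cong toℕ (index-cong (f≉g (sym eq))))) x≰σx
  ... | x , hx≈z with index x Fin.≤? index (σ x)
  ...   | yes _ = inj₁ (x , hx≈z)
  ...   | no _ = inj₂ (x , hx≈z)

-- The quadratic extension and its lines

module QuadraticExtension {c ℓ c′ ℓ′ q} (F : FiniteField c ℓ q) (K : FiniteField c′ ℓ′ (q ℕ.^ 2))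
  (ι : FiniteField.Carrier F → FiniteField.Carrier K) (ι-embedding : Chords.IsEmbedding F K ι) where

  open FiniteField F hiding (zero)
  open FiniteFieldProperties F
  private
    module K where
      open FiniteField K public
      open FiniteFieldProperties K public
      open IntegerSolver (FiniteField.commutativeRing K) public using (solve; _:=_; _:+_; _:-_; _:*_; :-_)
  open RingMorphisms (CommutativeRing.rawRing commutativeRing) (CommutativeRing.rawRing K.commutativeRing)
  open IsRingHomomorphism ι-embedding using (+-homo; *-homo; 0#-homo; 1#-homo; -‿homo) renaming (⟦⟧-cong to ι-cong)
  open SetoidReasoning K.setoid

  Rational : K.Carrier → Set _
  Rational z = ∃[ x ] ι x K.≈ z

  ι≈0⇒≈0 : ∀ {x} → ι x K.≈ K.0# → x ≈ 0#
  ι≈0⇒≈0 {x} ιx≈0 with x ≟ 0#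
  ... | yes x≈0 = x≈0
  ... | no x≉0 = contradiction 1≈0 K.1≉0
    where
    1≈0 : K.1# K.≈ K.0#
    1≈0 = begin
      K.1#                          ≈⟨ 1#-homo ⟨
      ι 1#                          ≈⟨ ι-cong (⁻¹-inverseˡ x x≉0) ⟨
      ι (x ⁻¹⟨ x≉0 ⟩ * x)           ≈⟨ *-homo _ _ ⟩
      ι (x ⁻¹⟨ x≉0 ⟩) K.* ι x       ≈⟨ K.*-congˡ ιx≈0 ⟩
      ι (x ⁻¹⟨ x≉0 ⟩) K.* K.0#      ≈⟨ K.zeroʳ _ ⟩
      K.0#                          ∎

  ι-sub : ∀ x y → ι (x - y) K.≈ ι x K.- ι y
  ι-sub x y = K.trans (+-homo x (- y)) (K.+-congˡ (-‿homo y))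

  rational? : ∀ z → Dec (Rational z)
  rational? z = map′ (λ (i , eq) → element i , eq)
                     (λ (x , eq) → index x , K.trans (ι-cong (element-index x)) eq)
                     (Fin.any? (λ i → ι (element i) K.≟ z))

  private
    1<q : 1 ℕ.< q
    1<q = two (λ eq → 1≉0 (index-injective eq))
      where
      two : ∀ {n} {i j : Fin n} → ¬ i ≡ j → 1 ℕ.< n
      two {1} {0F} {0F} i≢j = contradiction ≡.refl i≢j
      two {suc (suc n)} _ = ℕ.s≤s (ℕ.s≤s ℕ.z≤n)

    q<q² : q ℕ.< q ℕ.^ 2
    q<q² = ℕ.<-≤-trans
      (ℕ.m<m*n q q {{ℕ.>-nonZero (ℕ.<-trans ℕ.z<s 1<q)}} 1<q)
      (ℕ.≤-reflexive (≡.cong (q ℕ.*_) (≡.sym (ℕ.*-identityʳ q))))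

  -- If all elements were rational, choosing preimages would inject the q ^ 2 elements of K into the
  -- q elements of F.
  irrational : ∃[ t ] ¬ Rational t
  irrational with Fin.all? (λ j → rational? (K.element j))
  ... | yes all = contradiction (Fin.injective⇒≤ {f = preimage} preimage-injective) (ℕ.<⇒≱ q<q²)
    where
    preimage : Fin (q ℕ.^ 2) → Fin q
    preimage j = index (proj₁ (all j))
    preimage-injective : ∀ {i j} → preimage i ≡ preimage j → i ≡ j
    preimage-injective {i} {j} eq = Bijection.injective K.size
      (K.trans (K.sym (proj₂ (all i))) (K.trans (ι-cong (index-injective eq)) (proj₂ (all j))))
  ... | no ¬all = let (j , irr) = Fin.¬∀⟶∃¬ _ _ (λ j → rational? (K.element j)) ¬all in K.element j , irr

  module Basis (t : K.Carrier) (t-irrational : ¬ Rational t) where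

    ι≈ι*t⇒≈0 : ∀ {x y} → ι x K.≈ ι y K.* t → y ≈ 0#
    ι≈ι*t⇒≈0 {x} {y} eq with y ≟ 0#
    ... | yes y≈0 = y≈0
    ... | no y≉0 = contradiction (y ⁻¹⟨ y≉0 ⟩ * x , quotient) t-irrational
      where
      quotient : ι (y ⁻¹⟨ y≉0 ⟩ * x) K.≈ t
      quotient = begin
        ι (y ⁻¹⟨ y≉0 ⟩ * x)                  ≈⟨ K.trans (*-homo _ _) (K.*-congˡ eq) ⟩
        ι (y ⁻¹⟨ y≉0 ⟩) K.* (ι y K.* t)      ≈⟨ K.*-assoc _ _ _ ⟨
        ι (y ⁻¹⟨ y≉0 ⟩) K.* ι y K.* t        ≈⟨ K.*-congʳ (*-homo _ _) ⟨
        ι (y ⁻¹⟨ y≉0 ⟩ * y) K.* t            ≈⟨ K.*-congʳ (K.trans (ι-cong (⁻¹-inverseˡ y y≉0)) 1#-homo) ⟩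
        K.1# K.* t                           ≈⟨ K.*-identityˡ t ⟩
        t                                    ∎

    coordinates-unique : ∀ {x y x′ y′} → ι x K.+ ι y K.* t K.≈ ι x′ K.+ ι y′ K.* t → x ≈ x′ × y ≈ y′
    coordinates-unique {x} {y} {x′} {y′} eq = x≈x′ , y≈y′
      where
      open Algebra.Properties.Ring ring using (x∙y⁻¹≈ε⇒x≈y)
      difference : ι (x - x′) K.≈ ι (y′ - y) K.* t
      difference = begin
        ι (x - x′)                                                   ≈⟨ ι-sub x x′ ⟩
        ι x K.- ι x′                                                 ≈⟨ rearrange₁ (ι x) (ι y) (ι x′) t ⟩
        ι x K.+ ι y K.* t K.- (ι x′ K.+ ι y K.* t)                   ≈⟨ K.+-congʳ eq ⟩
        ι x′ K.+ ι y′ K.* t K.- (ι x′ K.+ ι y K.* t)                 ≈⟨ rearrange₂ (ι x′) (ι y) (ι y′) t ⟩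
        (ι y′ K.- ι y) K.* t                                         ≈⟨ K.*-congʳ (ι-sub y′ y) ⟨
        ι (y′ - y) K.* t                                             ∎
        where
        rearrange₁ : ∀ x y z t → x K.- z K.≈ x K.+ y K.* t K.- (z K.+ y K.* t)
        rearrange₁ = K.solve 4 (λ x y z t → x K.:- z K.:= x K.:+ y K.:* t K.:- (z K.:+ y K.:* t)) K.refl
        rearrange₂ : ∀ x y z t → x K.+ z K.* t K.- (x K.+ y K.* t) K.≈ (z K.- y) K.* t
        rearrange₂ = K.solve 4 (λ x y z t → x K.:+ z K.:* t K.:- (x K.:+ y K.:* t) K.:= (z K.:- y) K.:* t) K.refl
      y≈y′ : y ≈ y′
      y≈y′ = sym (x∙y⁻¹≈ε⇒x≈y y′ y (ι≈ι*t⇒≈0 difference))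
      x≈x′ : x ≈ x′
      x≈x′ = x∙y⁻¹≈ε⇒x≈y x x′ (ι≈0⇒≈0 (K.trans difference
        (K.trans (K.*-congʳ (K.trans (ι-cong (ι≈ι*t⇒≈0 difference)) 0#-homo)) (K.zeroˡ t))))

    -- q ^ 2 distinct combinations of 1 and t exhaust K.
    coordinates : ∀ z → ∃[ x ] ∃[ y ] z K.≈ ι x K.+ ι y K.* t
    coordinates z = let (i , eq) = injective⇒surjective (K.index ∘ combination) injective (K.index z)
                    in element (proj₁ (digits i)) , element (proj₂ (digits i)) , K.sym (K.index-injective eq)
      where
      -- q ^ 2 unfolds to q * (q * 1), so the two digits in base q come with a trivial third one in
      -- `Fin 1`.
      digits : Fin (q ℕ.^ 2) → Fin q × Fin q
      digits i = proj₁ (Fin.remQuot (q ℕ.^ 1) i) , proj₁ (Fin.remQuot 1 (proj₂ (Fin.remQuot {q} (q ℕ.^ 1) i)))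
      digits-injective : ∀ {i j} → digits i ≡ digits j → i ≡ j
      digits-injective {i} {j} eq = ≡.trans (≡.sym (undigits i)) (≡.trans (≡.cong₂ (λ a b → Fin.combine a (Fin.combine b 0F)) (≡.cong proj₁ eq) (≡.cong proj₂ eq)) (undigits j))
        where
        undigits : ∀ i → Fin.combine (proj₁ (digits i)) (Fin.combine (proj₂ (digits i)) (zero {0})) ≡ i
        undigits i = ≡.trans (≡.cong (Fin.combine (proj₁ (Fin.remQuot {q} (q ℕ.^ 1) i))) (last-digit (proj₂ (Fin.remQuot {q} (q ℕ.^ 1) i))))
                             (Fin.combine-remQuot {q} (q ℕ.^ 1) i)
          where
          only : (k : Fin 1) → 0F ≡ k
          only 0F = ≡.refl
          last-digit : ∀ (j : Fin (q ℕ.* 1)) → Fin.combine (proj₁ (Fin.remQuot {q} 1 j)) 0F ≡ j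
          last-digit j = ≡.trans (≡.cong (Fin.combine (proj₁ (Fin.remQuot {q} 1 j))) (only (proj₂ (Fin.remQuot {q} 1 j))))
                                 (Fin.combine-remQuot {q} 1 j)
      combination : Fin (q ℕ.^ 2) → K.Carrier
      combination i = ι (element (proj₁ (digits i))) K.+ ι (element (proj₂ (digits i))) K.* t
      injective : ∀ {i j} → K.index (combination i) ≡ K.index (combination j) → i ≡ j
      injective eq = let (x≈ , y≈) = coordinates-unique (K.index-injective eq) in
        digits-injective (≡.cong₂ _,_ (Bijection.injective size x≈) (Bijection.injective size y≈))

-- Spans of two vectors

module SpanProperties {c ℓ q} (F : FiniteField c ℓ q) where
  open FiniteField F
  open PG3 F using (_∈⟨_,_⟩; _≈ᵥ_)
  open IntegerSolver commutativeRing using (solve; _:=_; _:+_; _:*_)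

  ∈-resp-≈ᵥ : ∀ {x y u v} → x ≈ᵥ y → y ∈⟨ u , v ⟩ → x ∈⟨ u , v ⟩
  ∈-resp-≈ᵥ x≈y (a , b , eq) = a , b , λ i → trans (x≈y i) (eq i)

  ∈-trans : ∀ {x w w′ u v} → x ∈⟨ w , w′ ⟩ → w ∈⟨ u , v ⟩ → w′ ∈⟨ u , v ⟩ → x ∈⟨ u , v ⟩
  ∈-trans {u = u} {v} (k , l , x≈) (a , b , w≈) (a′ , b′ , w′≈) = k * a + l * a′ , k * b + l * b′ , λ i →
    trans (x≈ i) (trans (+-cong (*-congˡ (w≈ i)) (*-congˡ (w′≈ i))) (expand k l a b a′ b′ (u i) (v i)))
    where
    expand : ∀ k l a b a′ b′ x y → k * (a * x + b * y) + l * (a′ * x + b′ * y) ≈ (k * a + l * a′) * x + (k * b + l * b′) * y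
    expand = solve 8 (λ k l a b a′ b′ x y → k :* (a :* x :+ b :* y) :+ l :* (a′ :* x :+ b′ :* y)
                                           := (k :* a :+ l :* a′) :* x :+ (k :* b :+ l :* b′) :* y) refl

  ∈-left : ∀ u v → u ∈⟨ u , v ⟩
  ∈-left u v = 1# , 0# , λ i → sym (trans (+-cong (*-identityˡ _) (zeroˡ _)) (+-identityʳ _))

  ∈-right : ∀ u v → v ∈⟨ u , v ⟩
  ∈-right u v = 0# , 1# , λ i → sym (trans (+-cong (zeroˡ _) (*-identityˡ _)) (+-identityˡ _))

  ∈-scale : ∀ {x u v} k → x ∈⟨ u , v ⟩ → (λ i → k * x i) ∈⟨ u , v ⟩
  ∈-scale k (a , b , eq) = k * a , k * b , λ i → trans (*-congˡ (eq i))
    (trans (distribˡ _ _ _) (+-cong (sym (*-assoc _ _ _)) (sym (*-assoc _ _ _))))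

-- Rational lines through an irrational point of the cubic

module ChordGeometry {c ℓ c′ ℓ′ q} (F : FiniteField c ℓ q) (K : FiniteField c′ ℓ′ (q ℕ.^ 2))
  (ι : FiniteField.Carrier F → FiniteField.Carrier K) (ι-embedding : Chords.IsEmbedding F K ι) where

  open FiniteField F hiding (zero)
  open FiniteFieldProperties F
  open PG3 F using (Vec4; _∈⟨_,_⟩)
  open SpanProperties F
  open IntegerSolver commutativeRing using (solve; con; _:=_; _:+_; _:-_; _:*_)
  open QuadraticExtension F K ι ι-embedding
  private
    module K where
      open FiniteField K public
      open FiniteFieldProperties K public
      open PG3 K public using (cubicCoords; _∈⟨_,_⟩)
      open SpanProperties K public
      open IntegerSolver (FiniteField.commutativeRing K) public using (solve; con; _:=_; _:+_; _:-_; _:*_; :-_)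
  open RingMorphisms (CommutativeRing.rawRing commutativeRing) (CommutativeRing.rawRing K.commutativeRing)
  open IsRingHomomorphism ι-embedding using (+-homo; *-homo; 0#-homo; 1#-homo) renaming (⟦⟧-cong to ι-cong)
  open SetoidReasoning K.setoid

  ι-combination : ∀ a b x y → ι (a * x + b * y) K.≈ ι a K.* ι x K.+ ι b K.* ι y
  ι-combination a b x y = K.trans (+-homo _ _) (K.+-cong (*-homo a x) (*-homo b y))

  CubicPointOn : Vec4 → Vec4 → K.Carrier → Set _
  CubicPointOn u v t = K.cubicCoords t K.∈⟨ ι ∘ u , ι ∘ v ⟩

  -- The other root of X² = S X + D is S - t, so for irrational t the trace is S and the norm is -
  -- D.
  IsRoot : Carrier → Carrier → K.Carrier → Set _
  IsRoot S D t = t K.* t K.≈ ι S K.* t K.+ ι D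

  -- The chord through P(t) and its conjugate, when t² = S t + D.
  OnChord : Carrier → Carrier → Vec4 → Set _
  OnChord S D x = x 1F ≈ S * x 2F + D * x 3F × x 0F ≈ S * x 1F + D * x 2F

  -- The coordinate vectors of P(t) with respect to the basis 1, t.
  β₀ β₁ : (S D : Carrier) → Vec4
  β₀ S D = S * D ∷ D ∷ 0# ∷ 1# ∷ []
  β₁ S D = S * S + D ∷ S ∷ 1# ∷ 0# ∷ []

  cubicCoords-decomposition : ∀ {S D t} → IsRoot S D t → ∀ i → K.cubicCoords t i K.≈ ι (β₀ S D i) K.+ ι (β₁ S D i) K.* t
  cubicCoords-decomposition {S} {D} {t} root 0F = begin
    t K.* (t K.* (t K.* K.1#))                                    ≈⟨ K.*-congˡ (K.*-congˡ (K.*-identityʳ t)) ⟩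
    t K.* (t K.* t)                                               ≈⟨ K.*-congˡ root ⟩
    t K.* (ι S K.* t K.+ ι D)                                     ≈⟨ rearrange₁ (ι S) (ι D) t ⟩
    ι S K.* (t K.* t) K.+ ι D K.* t                               ≈⟨ K.+-congʳ (K.*-congˡ root) ⟩
    ι S K.* (ι S K.* t K.+ ι D) K.+ ι D K.* t                     ≈⟨ rearrange₂ (ι S) (ι D) t ⟩
    ι S K.* ι D K.+ (ι S K.* ι S K.+ ι D) K.* t                   ≈⟨ K.+-cong (*-homo S D) (K.*-congʳ (K.trans (+-homo _ _) (K.+-congʳ (*-homo S S)))) ⟨
    ι (S * D) K.+ ι (S * S + D) K.* t                             ∎
    where
    rearrange₁ : ∀ s d t → t K.* (s K.* t K.+ d) K.≈ s K.* (t K.* t) K.+ d K.* t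
    rearrange₁ = K.solve 3 (λ s d t → t K.:* (s K.:* t K.:+ d) K.:= s K.:* (t K.:* t) K.:+ d K.:* t) K.refl
    rearrange₂ : ∀ s d t → s K.* (s K.* t K.+ d) K.+ d K.* t K.≈ s K.* d K.+ (s K.* s K.+ d) K.* t
    rearrange₂ = K.solve 3 (λ s d t → s K.:* (s K.:* t K.:+ d) K.:+ d K.:* t K.:= s K.:* d K.:+ (s K.:* s K.:+ d) K.:* t) K.refl
  cubicCoords-decomposition root 1F = K.trans (K.*-congˡ (K.*-identityʳ _)) (K.trans root (K.+-comm _ _))
  cubicCoords-decomposition {t = t} root 2F = K.sym (K.trans (K.+-cong 0#-homo (K.trans (K.*-congʳ 1#-homo) (K.*-identityˡ t))) (K.+-identityˡ t))
  cubicCoords-decomposition {t = t} root 3F = K.sym (K.trans (K.+-cong 1#-homo (K.trans (K.*-congʳ 0#-homo) (K.zeroˡ t))) (K.+-identityʳ _))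

  -- The equations leave the last two coordinates free, and these are the coefficients of `β₀` and
  -- `β₁`.
  OnChord⇒∈ : ∀ {S D x} → OnChord S D x → x ∈⟨ β₀ S D , β₁ S D ⟩
  OnChord⇒∈ {S} {D} {x} (eq₁ , eq₀) = x 3F , x 2F , λ where
      0F → trans eq₀ (trans (+-congʳ (*-congˡ eq₁)) (rearrange S D (x 2F) (x 3F)))
      1F → trans eq₁ (trans (+-comm _ _) (+-cong (*-comm _ _) (*-comm _ _)))
      2F → sym (trans (+-cong (zeroʳ _) (*-identityʳ _)) (+-identityˡ _))
      3F → sym (trans (+-cong (*-identityʳ _) (zeroʳ _)) (+-identityʳ _))
    where
    rearrange : ∀ s d y z → s * (s * y + d * z) + d * y ≈ z * (s * d) + y * (s * s + d)
    rearrange = solve 4 (λ s d y z → s :* (s :* y :+ d :* z) :+ d :* y := z :* (s :* d) :+ y :* (s :* s :+ d)) refl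

  -- (t′ - t) (t′ - (S - t)) is the difference of the values of X² - S X - D at t′ and at t, both of
  -- which vanish.
  roots : ∀ {S D t t′} → IsRoot S D t → IsRoot S D t′ → t′ K.≈ t ⊎ t′ K.≈ ι S K.- t
  roots {S} {D} {t} {t′} root root′ with K.zero-product (t′ K.- t) (t′ K.- (ι S K.- t)) (begin
      (t′ K.- t) K.* (t′ K.- (ι S K.- t))                                        ≈⟨ rearrange (ι S) (ι D) t t′ ⟩
      t′ K.* t′ K.- (ι S K.* t′ K.+ ι D) K.- (t K.* t K.- (ι S K.* t K.+ ι D))  ≈⟨ K.+-cong (cancel root′) (K.-‿cong (cancel root)) ⟩
      K.0# K.- K.0#                                                              ≈⟨ K.-‿inverseʳ _ ⟩
      K.0#                                                                       ∎)
    where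
    rearrange : ∀ s d t t′ → (t′ K.- t) K.* (t′ K.- (s K.- t)) K.≈ t′ K.* t′ K.- (s K.* t′ K.+ d) K.- (t K.* t K.- (s K.* t K.+ d))
    rearrange = K.solve 4 (λ s d t t′ → (t′ K.:- t) K.:* (t′ K.:- (s K.:- t))
                                        K.:= t′ K.:* t′ K.:- (s K.:* t′ K.:+ d) K.:- (t K.:* t K.:- (s K.:* t K.:+ d))) K.refl
    cancel : ∀ {x y} → x K.≈ y → x K.- y K.≈ K.0#
    cancel x≈y = K.trans (K.+-congʳ x≈y) (K.-‿inverseʳ _)
  ... | inj₁ eq = inj₁ (x∙y⁻¹≈ε⇒x≈y _ _ eq)
    where open Algebra.Properties.Ring K.ring using (x∙y⁻¹≈ε⇒x≈y)
  ... | inj₂ eq = inj₂ (x∙y⁻¹≈ε⇒x≈y _ _ eq)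
    where open Algebra.Properties.Ring K.ring using (x∙y⁻¹≈ε⇒x≈y)

  module _ {t : K.Carrier} (t-irrational : ¬ Rational t) where
    open Basis t t-irrational

    minimal-polynomial : ∃[ S ] ∃[ D ] IsRoot S D t
    minimal-polynomial = let (D , S , eq) = coordinates (t K.* t) in S , D , K.trans eq (K.+-comm _ _)

    -- A rational line contains the coordinate vectors (for the basis 1, t) of each of its K-points.
    descent : ∀ {w₀ w₁ u v : Vec4} A B →
      (∀ i → ι (w₀ i) K.+ ι (w₁ i) K.* t K.≈ A K.* ι (u i) K.+ B K.* ι (v i)) →
      w₀ ∈⟨ u , v ⟩ × w₁ ∈⟨ u , v ⟩
    descent {w₀} {w₁} {u} {v} A B eq =
      (a₀ , b₀ , λ i → proj₁ (components i)) , (a₁ , b₁ , λ i → proj₂ (components i))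
      where
      a₀ a₁ b₀ b₁ : Carrier
      a₀ = proj₁ (coordinates A)
      a₁ = proj₁ (proj₂ (coordinates A))
      b₀ = proj₁ (coordinates B)
      b₁ = proj₁ (proj₂ (coordinates B))
      A≈ : A K.≈ ι a₀ K.+ ι a₁ K.* t
      A≈ = proj₂ (proj₂ (coordinates A))
      B≈ : B K.≈ ι b₀ K.+ ι b₁ K.* t
      B≈ = proj₂ (proj₂ (coordinates B))
      rearrange : ∀ a₀ a₁ b₀ b₁ x y t →
        (a₀ K.+ a₁ K.* t) K.* x K.+ (b₀ K.+ b₁ K.* t) K.* y K.≈ a₀ K.* x K.+ b₀ K.* y K.+ (a₁ K.* x K.+ b₁ K.* y) K.* t
      rearrange = K.solve 7 (λ a₀ a₁ b₀ b₁ x y t →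
        (a₀ K.:+ a₁ K.:* t) K.:* x K.:+ (b₀ K.:+ b₁ K.:* t) K.:* y
        K.:= a₀ K.:* x K.:+ b₀ K.:* y K.:+ (a₁ K.:* x K.:+ b₁ K.:* y) K.:* t) K.refl
      components : ∀ i → w₀ i ≈ a₀ * u i + b₀ * v i × w₁ i ≈ a₁ * u i + b₁ * v i
      components i = coordinates-unique (begin
        ι (w₀ i) K.+ ι (w₁ i) K.* t
          ≈⟨ eq i ⟩
        A K.* ι (u i) K.+ B K.* ι (v i)
          ≈⟨ K.+-cong (K.*-congʳ A≈) (K.*-congʳ B≈) ⟩
        (ι a₀ K.+ ι a₁ K.* t) K.* ι (u i) K.+ (ι b₀ K.+ ι b₁ K.* t) K.* ι (v i)
          ≈⟨ rearrange (ι a₀) (ι a₁) (ι b₀) (ι b₁) (ι (u i)) (ι (v i)) t ⟩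
        ι a₀ K.* ι (u i) K.+ ι b₀ K.* ι (v i) K.+ (ι a₁ K.* ι (u i) K.+ ι b₁ K.* ι (v i)) K.* t
          ≈⟨ K.+-cong (ι-combination a₀ b₀ (u i) (v i)) (K.*-congʳ (ι-combination a₁ b₁ (u i) (v i))) ⟨
        ι (a₀ * u i + b₀ * v i) K.+ ι (a₁ * u i + b₁ * v i) K.* t ∎)

    -- If P(t) = A u + B v, then A and B are linearly independent over F.
    coefficients-independent : ∀ {A B u₂ v₂ u₃ v₃ x y} →
      t K.≈ A K.* ι u₂ K.+ B K.* ι v₂ → K.1# K.≈ A K.* ι u₃ K.+ B K.* ι v₃ →
      A K.* ι x K.+ B K.* ι y K.≈ K.0# → y ≈ 0#
    coefficients-independent {A} {B} {u₂} {v₂} {u₃} {v₃} {x} {y} t≈ 1≈ Ax+By≈0 =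
      [ (λ m≈0 → ι≈0⇒≈0 (K.trans (K.sym (K.*-identityʳ _)) (K.trans (eliminate 1≈)
          (K.trans (K.*-congˡ (K.trans (ι-cong m≈0) 0#-homo)) (K.zeroʳ A))))) , (λ y≈0 → y≈0) ]′
      (zero-product m y (ι≈ι*t⇒≈0 {n * y} (begin
        ι (n * y)                  ≈⟨ *-homo n y ⟩
        ι n K.* ι y                ≈⟨ K.*-congˡ (K.*-identityʳ _) ⟨
        ι n K.* (ι y K.* K.1#)     ≈⟨ K.*-congˡ (eliminate 1≈) ⟩
        ι n K.* (A K.* ι m)        ≈⟨ K.solve 3 (λ n a m → n K.:* (a K.:* m) K.:= m K.:* (a K.:* n)) K.refl (ι n) A (ι m) ⟩
        ι m K.* (A K.* ι n)        ≈⟨ K.*-congˡ (eliminate t≈) ⟨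
        ι m K.* (ι y K.* t)        ≈⟨ K.*-assoc _ _ _ ⟨
        ι m K.* ι y K.* t          ≈⟨ K.*-congʳ (*-homo m y) ⟨
        ι (m * y) K.* t            ∎)))
      where
      -- As B y = - A x, multiplying the two given equations by y yields y = A m and y t = A n.
      -- Hence m y t = n y, and the irrationality of t forces m y = 0.
      m n : Carrier
      m = y * u₃ - x * v₃
      n = y * u₂ - x * v₂
      eliminate : ∀ {z u v} → z K.≈ A K.* ι u K.+ B K.* ι v → ι y K.* z K.≈ A K.* ι (y * u - x * v)
      eliminate {z} {u} {v} z≈ = begin
        ι y K.* z
          ≈⟨ K.*-congˡ z≈ ⟩
        ι y K.* (A K.* ι u K.+ B K.* ι v)
          ≈⟨ rearrange A B (ι u) (ι v) (ι x) (ι y) ⟩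
        A K.* (ι y K.* ι u K.- ι x K.* ι v) K.+ (A K.* ι x K.+ B K.* ι y) K.* ι v
          ≈⟨ K.+-cong (K.*-congˡ (K.sym (K.trans (ι-sub _ _) (K.+-cong (*-homo y u) (K.-‿cong (*-homo x v))))))
                      (K.trans (K.*-congʳ Ax+By≈0) (K.zeroˡ _)) ⟩
        A K.* ι (y * u - x * v) K.+ K.0#
          ≈⟨ K.+-identityʳ _ ⟩
        A K.* ι (y * u - x * v) ∎
        where
        rearrange : ∀ A B u v x y → y K.* (A K.* u K.+ B K.* v) K.≈ A K.* (y K.* u K.- x K.* v) K.+ (A K.* x K.+ B K.* y) K.* v
        rearrange = K.solve 6 (λ A B u v x y → y K.:* (A K.:* u K.:+ B K.:* v)
                      K.:= A K.:* (y K.:* u K.:- x K.:* v) K.:+ (A K.:* x K.:+ B K.:* y) K.:* v) K.refl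

    module ChordLine {S D} (root : IsRoot S D t) {u v : Vec4} (t∈uv : CubicPointOn u v t) where
      private
        A B : K.Carrier
        A = proj₁ t∈uv
        B = proj₁ (proj₂ t∈uv)
        P≈ : ∀ i → K.cubicCoords t i K.≈ A K.* ι (u i) K.+ B K.* ι (v i)
        P≈ = proj₂ (proj₂ t∈uv)

        β∈ : β₀ S D ∈⟨ u , v ⟩ × β₁ S D ∈⟨ u , v ⟩
        β∈ = descent A B (λ i → K.trans (K.sym (cubicCoords-decomposition root i)) (P≈ i))

      β₀∈ : β₀ S D ∈⟨ u , v ⟩
      β₀∈ = proj₁ β∈

      β₁∈ : β₁ S D ∈⟨ u , v ⟩
      β₁∈ = proj₂ β∈

      private
        ι-equation : ∀ x y z → ι (x - (S * y + D * z)) K.≈ ι x K.- (ι S K.* ι y K.+ ι D K.* ι z)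
        ι-equation x y z = K.trans (ι-sub _ _) (K.+-congˡ (K.-‿cong (ι-combination S D y z)))

        relation : ∀ i j k → K.cubicCoords t i K.≈ ι S K.* K.cubicCoords t j K.+ ι D K.* K.cubicCoords t k →
                   A K.* ι (u i - (S * u j + D * u k)) K.+ B K.* ι (v i - (S * v j + D * v k)) K.≈ K.0#
        relation i j k eq = begin
          A K.* ι (u i - (S * u j + D * u k)) K.+ B K.* ι (v i - (S * v j + D * v k))
            ≈⟨ K.+-cong (K.*-congˡ (ι-equation _ _ _)) (K.*-congˡ (ι-equation _ _ _)) ⟩
          A K.* (ι (u i) K.- (ι S K.* ι (u j) K.+ ι D K.* ι (u k))) K.+ B K.* (ι (v i) K.- (ι S K.* ι (v j) K.+ ι D K.* ι (v k)))
            ≈⟨ rearrange A B (ι S) (ι D) (ι (u i)) (ι (u j)) (ι (u k)) (ι (v i)) (ι (v j)) (ι (v k)) ⟩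
          A K.* ι (u i) K.+ B K.* ι (v i)
            K.- (ι S K.* (A K.* ι (u j) K.+ B K.* ι (v j)) K.+ ι D K.* (A K.* ι (u k) K.+ B K.* ι (v k)))
            ≈⟨ K.+-cong (P≈ i) (K.-‿cong (K.+-cong (K.*-congˡ (P≈ j)) (K.*-congˡ (P≈ k)))) ⟨
          K.cubicCoords t i K.- (ι S K.* K.cubicCoords t j K.+ ι D K.* K.cubicCoords t k)
            ≈⟨ K.trans (K.+-congʳ eq) (K.-‿inverseʳ _) ⟩
          K.0# ∎
          where
          rearrange : ∀ a b s d x y z x′ y′ z′ →
            a K.* (x K.- (s K.* y K.+ d K.* z)) K.+ b K.* (x′ K.- (s K.* y′ K.+ d K.* z′))
            K.≈ a K.* x K.+ b K.* x′ K.- (s K.* (a K.* y K.+ b K.* y′) K.+ d K.* (a K.* z K.+ b K.* z′))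
          rearrange = K.solve 10 (λ a b s d x y z x′ y′ z′ →
            a K.:* (x K.:- (s K.:* y K.:+ d K.:* z)) K.:+ b K.:* (x′ K.:- (s K.:* y′ K.:+ d K.:* z′))
            K.:= a K.:* x K.:+ b K.:* x′ K.:- (s K.:* (a K.:* y K.:+ b K.:* y′) K.:+ d K.:* (a K.:* z K.:+ b K.:* z′))) K.refl

        -- An equation over F satisfied by P(t) = A u + B v gives a linear relation between A and B
        -- with coefficients in F. By independence both coefficients vanish; `swap` exchanges the
        -- roles of A and B to reach the one that belongs to u.
        rational-relation : ∀ i j k → K.cubicCoords t i K.≈ ι S K.* K.cubicCoords t j K.+ ι D K.* K.cubicCoords t k →
                            u i ≈ S * u j + D * u k × v i ≈ S * v j + D * v k
        rational-relation i j k eq =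
          x∙y⁻¹≈ε⇒x≈y _ _ (coefficients-independent (swap t≈) (swap 1≈) (K.trans (K.+-comm _ _) (relation i j k eq))) ,
          x∙y⁻¹≈ε⇒x≈y _ _ (coefficients-independent t≈ 1≈ (relation i j k eq))
          where
          open Algebra.Properties.Ring ring using (x∙y⁻¹≈ε⇒x≈y)
          t≈ : t K.≈ A K.* ι (u 2F) K.+ B K.* ι (v 2F)
          t≈ = P≈ 2F
          1≈ : K.1# K.≈ A K.* ι (u 3F) K.+ B K.* ι (v 3F)
          1≈ = P≈ 3F
          swap : ∀ {x y z} → x K.≈ y K.+ z → x K.≈ z K.+ y
          swap eq = K.trans eq (K.+-comm _ _)

        t²-relation : K.cubicCoords t 1F K.≈ ι S K.* K.cubicCoords t 2F K.+ ι D K.* K.cubicCoords t 3F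
        t²-relation = K.trans (K.*-congˡ (K.*-identityʳ t)) (K.trans root (K.+-congˡ (K.sym (K.*-identityʳ _))))

        t³-relation : K.cubicCoords t 0F K.≈ ι S K.* K.cubicCoords t 1F K.+ ι D K.* K.cubicCoords t 2F
        t³-relation = K.trans (K.*-congˡ t²-relation)
          (K.solve 3 (λ s d t → t K.:* (s K.:* t K.:+ d K.:* K.con (ℤ.+ 1)) K.:= s K.:* (t K.:* (t K.:* K.con (ℤ.+ 1))) K.:+ d K.:* t) K.refl (ι S) (ι D) t)

      ∈line⇒OnChord : ∀ {x} → x ∈⟨ u , v ⟩ → OnChord S D x
      ∈line⇒OnChord {x} (a , b , x≈) = linear 1F 2F 3F (rational-relation 1F 2F 3F t²-relation) , linear 0F 1F 2F (rational-relation 0F 1F 2F t³-relation)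
        where
        linear : ∀ i j k → u i ≈ S * u j + D * u k × v i ≈ S * v j + D * v k → x i ≈ S * x j + D * x k
        linear i j k (u≈ , v≈) = trans (x≈ i) (trans (+-cong (*-congˡ u≈) (*-congˡ v≈))
          (trans (rearrange S D a b (u j) (v j) (u k) (v k)) (sym (+-cong (*-congˡ (x≈ j)) (*-congˡ (x≈ k))))))
          where
          rearrange : ∀ s d a b y y′ z z′ → a * (s * y + d * z) + b * (s * y′ + d * z′) ≈ s * (a * y + b * y′) + d * (a * z + b * z′)
          rearrange = solve 8 (λ s d a b y y′ z z′ → a :* (s :* y :+ d :* z) :+ b :* (s :* y′ :+ d :* z′)
                                                   := s :* (a :* y :+ b :* y′) :+ d :* (a :* z :+ b :* z′)) refl

      -- u and v satisfy x₁ = S x₂ + D x₃, hence so do their K-combinations, and at P(t′) this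
      -- equation is the quadratic one for t′.
      CubicPointOn⇒IsRoot : ∀ {t′} → CubicPointOn u v t′ → IsRoot S D t′
      CubicPointOn⇒IsRoot {t′} (A′ , B′ , P′≈) = begin
        t′ K.* t′
          ≈⟨ K.*-congˡ (K.*-identityʳ t′) ⟨
        K.cubicCoords t′ 1F
          ≈⟨ P′≈ 1F ⟩
        A′ K.* ι (u 1F) K.+ B′ K.* ι (v 1F)
          ≈⟨ K.+-cong (K.*-congˡ (equation (proj₁ (∈line⇒OnChord (∈-left u v))))) (K.*-congˡ (equation (proj₁ (∈line⇒OnChord (∈-right u v))))) ⟩
        A′ K.* (ι S K.* ι (u 2F) K.+ ι D K.* ι (u 3F)) K.+ B′ K.* (ι S K.* ι (v 2F) K.+ ι D K.* ι (v 3F))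
          ≈⟨ rearrange (ι S) (ι D) A′ B′ (ι (u 2F)) (ι (v 2F)) (ι (u 3F)) (ι (v 3F)) ⟩
        ι S K.* (A′ K.* ι (u 2F) K.+ B′ K.* ι (v 2F)) K.+ ι D K.* (A′ K.* ι (u 3F) K.+ B′ K.* ι (v 3F))
          ≈⟨ K.+-cong (K.*-congˡ (P′≈ 2F)) (K.*-congˡ (P′≈ 3F)) ⟨
        ι S K.* t′ K.+ ι D K.* K.1#
          ≈⟨ K.+-congˡ (K.*-identityʳ _) ⟩
        ι S K.* t′ K.+ ι D ∎
        where
        equation : ∀ {x y z} → x ≈ S * y + D * z → ι x K.≈ ι S K.* ι y K.+ ι D K.* ι z
        equation eq = K.trans (ι-cong eq) (ι-combination S D _ _)
        rearrange : ∀ s d a b y y′ z z′ → a K.* (s K.* y K.+ d K.* z) K.+ b K.* (s K.* y′ K.+ d K.* z′)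
                                         K.≈ s K.* (a K.* y K.+ b K.* y′) K.+ d K.* (a K.* z K.+ b K.* z′)
        rearrange = K.solve 8 (λ s d a b y y′ z z′ → a K.:* (s K.:* y K.:+ d K.:* z) K.:+ b K.:* (s K.:* y′ K.:+ d K.:* z′)
                                                 K.:= s K.:* (a K.:* y K.:+ b K.:* y′) K.:+ d K.:* (a K.:* z K.:+ b K.:* z′)) K.refl

      -- `β₀` and `β₁` depend on S and D only, so the vectors that decompose P(t), which lie on the
      -- line, decompose P(t′) as well.
      IsRoot⇒CubicPointOn : ∀ {t′} → IsRoot S D t′ → CubicPointOn u v t′
      IsRoot⇒CubicPointOn {t′} root′ = K.∈-trans
        (K.1# , t′ , λ i → K.trans (cubicCoords-decomposition root′ i) (K.+-cong (K.sym (K.*-identityˡ _)) (K.*-comm _ _)))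
        (ι-span β₀∈) (ι-span β₁∈)
        where
        ι-span : ∀ {w} → w ∈⟨ u , v ⟩ → (ι ∘ w) K.∈⟨ ι ∘ u , ι ∘ v ⟩
        ι-span (a , b , w≈) = ι a , ι b , λ i → K.trans (ι-cong (w≈ i)) (ι-combination a b (u i) (v i))

-- The group of the twisted cubic

module TwistedCubicGroup {c ℓ q} (F : FiniteField c ℓ q) where
  open FiniteField F hiding (zero)
  open FiniteFieldProperties F
  open PG3 F using (Projectivity; Point; coords; _∙_; P; twistedCubic; InG; _∼_; matrix; inverse; inverseʳ; inverseˡ; cubicCoords)
  open CubicMatrices commutativeRing
  open IntegerSolver commutativeRing using (solve; con; _:=_; _:+_; _:-_; _:*_; :-_)
  open Algebra.Properties.Ring ring using (x∙y⁻¹≈ε⇒x≈y; -0#≈0#; -‿involutive)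
  open Algebra.Properties.CommutativeMonoid.Sum +-commutativeMonoid using (sum-remove; sum-cong-≋; sum-replicate-zero)
  open SetoidReasoning setoid

  infix 4 _InverseOf_
  -- 2 × 2 matrices ((a , b) , (c , d)).
  _InverseOf_ : (A B : Form × Form) → Set ℓ
  ((a′ , b′) , (c′ , d′)) InverseOf ((a , b) , (c , d)) =
    a′ * a + b′ * c ≈ 1# × a′ * b + b′ * d ≈ 0# × c′ * a + d′ * c ≈ 0# × c′ * b + d′ * d ≈ 1#

  det : (a b c d : Carrier) → Carrier
  det a b c d = a * d - b * c

  module Invertible₂ {a b c d} (det≉0 : det a b c d ≉ 0#) where
    k a′ b′ c′ d′ : Carrier
    k = det a b c d ⁻¹⟨ det≉0 ⟩
    a′ = k * d
    b′ = k * (- b)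
    c′ = k * (- c)
    d′ = k * a

    private
      k·det≈1 : k * det a b c d ≈ 1#
      k·det≈1 = ⁻¹-inverseˡ (det a b c d) det≉0

    leftInverse : ((a′ , b′) , (c′ , d′)) InverseOf ((a , b) , (c , d))
    leftInverse =
      trans (solve 5 (λ k a b c d → k :* d :* a :+ k :* (:- b) :* c := k :* (a :* d :- b :* c)) refl k a b c d) k·det≈1 ,
      solve 5 (λ k a b c d → k :* d :* b :+ k :* (:- b) :* d := con (ℤ.+ 0)) refl k a b c d ,
      solve 5 (λ k a b c d → k :* (:- c) :* a :+ k :* a :* c := con (ℤ.+ 0)) refl k a b c d ,
      trans (solve 5 (λ k a b c d → k :* (:- c) :* b :+ k :* a :* d := k :* (a :* d :- b :* c)) refl k a b c d) k·det≈1

    rightInverse : ((a , b) , (c , d)) InverseOf ((a′ , b′) , (c′ , d′))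
    rightInverse =
      trans (solve 5 (λ k a b c d → a :* (k :* d) :+ b :* (k :* (:- c)) := k :* (a :* d :- b :* c)) refl k a b c d) k·det≈1 ,
      solve 5 (λ k a b c d → a :* (k :* (:- b)) :+ b :* (k :* a) := con (ℤ.+ 0)) refl k a b c d ,
      solve 5 (λ k a b c d → c :* (k :* d) :+ d :* (k :* (:- c)) := con (ℤ.+ 0)) refl k a b c d ,
      trans (solve 5 (λ k a b c d → c :* (k :* (:- b)) :+ d :* (k :* a) := k :* (a :* d :- b :* c)) refl k a b c d) k·det≈1

  cubicProjectivity : ∀ a b c d → det a b c d ≉ 0# → Projectivity
  cubicProjectivity a b c d det≉0 = record
    { matrix   = cubicMatrix a b c d
    ; inverse  = cubicMatrix a′ b′ c′ d′
    -- Products of cubic matrices reverse the order of the 2 × 2 product, so the left inverse is the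
    -- one that belongs here.
    ; inverseʳ = let (e₁ , e₂ , e₃ , e₄) = leftInverse in cubicMatrix-inverse e₁ e₂ e₃ e₄
    ; inverseˡ = let (e₁ , e₂ , e₃ , e₄) = rightInverse in cubicMatrix-inverse e₁ e₂ e₃ e₄
    }
    where open Invertible₂ det≉0

  -- Describes `twistedCubic` by homogeneous parameters, so that images under `cubicMatrix` need no
  -- case distinction at ∞.
  OnCubic : Vec4 → Set _
  OnCubic x = ∃[ k ] ∃[ s ] ∃[ t ] k ≉ 0# × ¬ (s ≈ 0# × t ≈ 0#) × (∀ i → x i ≈ k * veronese s t i)

  OnCubic-resp : ∀ {x y} → x ≈ᵥ y → OnCubic y → OnCubic x
  OnCubic-resp x≈y (k , s , t , k≉0 , st≉0 , y≈) = k , s , t , k≉0 , st≉0 , λ i → trans (x≈y i) (y≈ i)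

  cubicCoords≈veronese : ∀ t → cubicCoords t ≈ᵥ veronese t 1#
  cubicCoords≈veronese t 0F = solve 1 (λ t → t :* (t :* (t :* con (ℤ.+ 1))) := t :* t :* t) refl t
  cubicCoords≈veronese t 1F = solve 1 (λ t → t :* (t :* con (ℤ.+ 1)) := t :* t :* con (ℤ.+ 1)) refl t
  cubicCoords≈veronese t 2F = solve 1 (λ t → t := t :* con (ℤ.+ 1) :* con (ℤ.+ 1)) refl t
  cubicCoords≈veronese t 3F = sym (trans (*-identityʳ _) (*-identityʳ _))

  P∞≈veronese : coords (P nothing) ≈ᵥ veronese 1# 0#
  P∞≈veronese 0F = sym (trans (*-identityʳ _) (*-identityʳ _))
  P∞≈veronese 1F = sym (zeroʳ _)
  P∞≈veronese 2F = sym (zeroʳ _)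
  P∞≈veronese 3F = sym (zeroʳ _)

  twistedCubic⇒OnCubic : ∀ X → twistedCubic X → OnCubic (coords X)
  twistedCubic⇒OnCubic X (just t , k , k≉0 , X≈) =
    k , t , 1# , k≉0 , (λ (_ , 1≈0) → 1≉0 1≈0) , λ i → trans (X≈ i) (*-congˡ (cubicCoords≈veronese t i))
  twistedCubic⇒OnCubic X (nothing , k , k≉0 , X≈) =
    k , 1# , 0# , k≉0 , (λ (1≈0 , _) → 1≉0 1≈0) , λ i → trans (X≈ i) (*-congˡ (P∞≈veronese i))

  OnCubic⇒twistedCubic : ∀ X → OnCubic (coords X) → twistedCubic X
  OnCubic⇒twistedCubic X (k , s , t , k≉0 , st≉0 , X≈) with t ≟ 0#
  ... | no t≉0 = just (t⁻¹ * s) , k * (t * t * t) , *-≉0 k≉0 (*-≉0 (*-≉0 t≉0 t≉0) t≉0) , λ i → begin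
    coords X i                                        ≈⟨ X≈ i ⟩
    k * veronese s t i                                ≈⟨ *-congˡ (veronese-cong ts≈ (*-identityʳ t) i) ⟨
    k * veronese (t * (t⁻¹ * s)) (t * 1#) i           ≈⟨ *-congˡ (veronese-scale t (t⁻¹ * s) 1# i) ⟩
    k * (t * t * t * veronese (t⁻¹ * s) 1# i)         ≈⟨ *-assoc _ _ _ ⟨
    k * (t * t * t) * veronese (t⁻¹ * s) 1# i         ≈⟨ *-congˡ (cubicCoords≈veronese (t⁻¹ * s) i) ⟨
    k * (t * t * t) * cubicCoords (t⁻¹ * s) i         ∎
    where
    t⁻¹ = t ⁻¹⟨ t≉0 ⟩
    ts≈ : t * (t⁻¹ * s) ≈ s
    ts≈ = trans (sym (*-assoc _ _ _)) (trans (*-congʳ (trans (*-comm _ _) (⁻¹-inverseˡ t t≉0))) (*-identityˡ s))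
  ... | yes t≈0 = nothing , k * (s * s * s) , *-≉0 k≉0 (*-≉0 (*-≉0 s≉0 s≉0) s≉0) , λ i → begin
    coords X i                                        ≈⟨ X≈ i ⟩
    k * veronese s t i                                ≈⟨ *-congˡ (veronese-cong (*-identityʳ s) (trans (zeroʳ s) (sym t≈0)) i) ⟨
    k * veronese (s * 1#) (s * 0#) i                  ≈⟨ *-congˡ (veronese-scale s 1# 0# i) ⟩
    k * (s * s * s * veronese 1# 0# i)                ≈⟨ *-assoc _ _ _ ⟨
    k * (s * s * s) * veronese 1# 0# i                ≈⟨ *-congˡ (P∞≈veronese i) ⟨
    k * (s * s * s) * coords (P nothing) i            ∎
    where
    s≉0 : s ≉ 0#
    s≉0 s≈0 = st≉0 (s≈0 , t≈0)

  -- The 2 × 2 inverse recovers s and t from the new parameters, which are therefore not both zero.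
  OnCubic-*ᵥ : ∀ {a b c d A′} → A′ InverseOf ((a , b) , (c , d)) → ∀ {x} → OnCubic x → OnCubic (x *ᵥ cubicMatrix a b c d)
  OnCubic-*ᵥ {a} {b} {c} {d} {(a′ , b′) , (c′ , d′)} (e₁ , e₂ , e₃ , e₄) {x} (k , s , t , k≉0 , st≉0 , x≈) =
    k , a * s + b * t , c * s + d * t , k≉0 ,
    (λ (as+bt≈0 , cs+dt≈0) → st≉0
      ( vanish (trans (solve₂ a′ b′) (trans (+-cong (*-congʳ e₁) (*-congʳ e₂)) (trans (+-cong (*-identityˡ s) (zeroˡ t)) (+-identityʳ s)))) as+bt≈0 cs+dt≈0
      , vanish (trans (solve₂ c′ d′) (trans (+-cong (*-congʳ e₃) (*-congʳ e₄)) (trans (+-cong (zeroˡ s) (*-identityˡ t)) (+-identityˡ t)))) as+bt≈0 cs+dt≈0)) ,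
    λ i → trans (*ᵥ-congʳ (cubicMatrix a b c d) x≈ i)
         (trans (*ᵥ-scale k (veronese s t) (cubicMatrix a b c d) i) (*-congˡ (veronese-*ᵥ s t a b c d i)))
    where
    solve₂ : ∀ y z → y * (a * s + b * t) + z * (c * s + d * t) ≈ (y * a + z * c) * s + (y * b + z * d) * t
    solve₂ y z = solve 8 (λ y z a b c d s t → y :* (a :* s :+ b :* t) :+ z :* (c :* s :+ d :* t)
                                            := (y :* a :+ z :* c) :* s :+ (y :* b :+ z :* d) :* t) refl y z a b c d s t
    vanish : ∀ {y z u v w} → y * u + z * v ≈ w → u ≈ 0# → v ≈ 0# → w ≈ 0#
    vanish eq u≈0 v≈0 = trans (sym eq) (trans (+-cong (trans (*-congˡ u≈0) (zeroʳ _)) (trans (*-congˡ v≈0) (zeroʳ _))) (+-identityˡ _))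

  cubicProjectivity∈G : ∀ a b c d det≉0 → InG (cubicProjectivity a b c d det≉0)
  cubicProjectivity∈G a b c d det≉0 X = mk⇔
    (λ X∈C → OnCubic⇒twistedCubic (X ∙ g) (OnCubic-*ᵥ leftInverse (twistedCubic⇒OnCubic X X∈C)))
    (λ Xg∈C → OnCubic⇒twistedCubic X (OnCubic-resp (λ i → sym (inverseʳ g (coords X) i))
                (OnCubic-*ᵥ rightInverse (twistedCubic⇒OnCubic (X ∙ g) Xg∈C))))
    where
    open Invertible₂ det≉0
    g = cubicProjectivity a b c d det≉0

  quadrics : ∀ {x} → OnCubic x → x 1F * x 1F ≈ x 0F * x 2F × x 2F * x 2F ≈ x 1F * x 3F
  quadrics (k , s , t , _ , _ , x≈) =
    trans (*-cong (x≈ 1F) (x≈ 1F)) (trans (solve 3 (λ k s t → k :* (s :* s :* t) :* (k :* (s :* s :* t)) := k :* (s :* s :* s) :* (k :* (s :* t :* t))) refl k s t) (sym (*-cong (x≈ 0F) (x≈ 2F)))) ,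
    trans (*-cong (x≈ 2F) (x≈ 2F)) (trans (solve 3 (λ k s t → k :* (s :* t :* t) :* (k :* (s :* t :* t)) := k :* (s :* s :* t) :* (k :* (t :* t :* t))) refl k s t) (sym (*-cong (x≈ 1F) (x≈ 3F))))

  module _ where
    private
      difference≉0 : ∀ {x y} → x ≉ y → x - y ≉ 0#
      difference≉0 x≉y eq = x≉y (x∙y⁻¹≈ε⇒x≈y _ _ eq)

      divide : ∀ {x y z u v} → x ≉ y → (x - y) * z ≈ u - v → u ≈ 0# → v ≈ 0# → z ≈ 0#
      divide x≉y eq u≈0 v≈0 = *-≈0 (difference≉0 x≉y)
        (trans eq (trans (+-cong u≈0 (trans (-‿cong v≈0) -0#≈0#)) (+-identityˡ _)))

      absorb : ∀ {x y z} → x ≈ 0# → x * y + z ≈ 0# → z ≈ 0#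
      absorb x≈0 eq = trans (sym (trans (+-congʳ (trans (*-congʳ x≈0) (zeroˡ _))) (+-identityˡ _))) eq

    linear-vanishes : ∀ {a b x y} → x ≉ y → a * x + b ≈ 0# → a * y + b ≈ 0# → a ≈ 0# × b ≈ 0#
    linear-vanishes {a} {b} {x} {y} x≉y px py = a≈0 , absorb a≈0 px
      where
      a≈0 : a ≈ 0#
      a≈0 = divide x≉y (solve 4 (λ a b x y → (x :- y) :* a := a :* x :+ b :- (a :* y :+ b)) refl a b x y) px py

    quadratic-vanishes : ∀ {a b c x y z} → x ≉ y → x ≉ z → y ≉ z →
      (∀ {t} → t ≈ x ⊎ t ≈ y ⊎ t ≈ z → (a * t + b) * t + c ≈ 0#) → a ≈ 0# × b ≈ 0# × c ≈ 0#
    quadratic-vanishes {a} {b} {c} {x} {y} {z} x≉y x≉z y≉z p =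
      a≈0 , b≈0 , absorb (trans (+-congˡ b≈0) (trans (+-identityʳ _) (trans (*-congʳ a≈0) (zeroˡ _)))) (p (inj₁ refl))
      where
      quotient : ∀ {t} → x ≉ t → (a * t + b) * t + c ≈ 0# → a * t + (a * x + b) ≈ 0#
      quotient {t} x≉t pt = divide x≉t
        (solve 5 (λ a b c x t → (x :- t) :* (a :* t :+ (a :* x :+ b)) := (a :* x :+ b) :* x :+ c :- ((a :* t :+ b) :* t :+ c)) refl a b c x t)
        (p (inj₁ refl)) pt
      lin : a ≈ 0# × a * x + b ≈ 0#
      lin = linear-vanishes y≉z (quotient x≉y (p (inj₂ (inj₁ refl)))) (quotient x≉z (p (inj₂ (inj₂ refl))))
      a≈0 : a ≈ 0#
      a≈0 = proj₁ lin
      b≈0 : b ≈ 0#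
      b≈0 = absorb a≈0 (proj₂ lin)

    -- Splitting off the root x leaves the quadratic with Horner coefficients a, a x + b, (a x + b)
    -- x + c, which still vanishes at y, z and w.
    cubic-vanishes : ∀ {a b c d x y z w} → x ≉ y → x ≉ z → x ≉ w → y ≉ z → y ≉ w → z ≉ w →
      (∀ {t} → t ≈ x ⊎ t ≈ y ⊎ t ≈ z ⊎ t ≈ w → ((a * t + b) * t + c) * t + d ≈ 0#) →
      a ≈ 0# × b ≈ 0# × c ≈ 0# × d ≈ 0#
    cubic-vanishes {a} {b} {c} {d} {x} {y} {z} {w} x≉y x≉z x≉w y≉z y≉w z≉w p =
      a≈0 , b≈0 , c≈0 , absorb (trans (+-congˡ c≈0) (trans (+-identityʳ _) (trans (*-congʳ (trans (+-congˡ b≈0) (trans (+-identityʳ _) (trans (*-congʳ a≈0) (zeroˡ _))))) (zeroˡ _)))) (p (inj₁ refl))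
      where
      quotient : ∀ {t} → x ≉ t → ((a * t + b) * t + c) * t + d ≈ 0# → (a * t + (a * x + b)) * t + ((a * x + b) * x + c) ≈ 0#
      quotient {t} x≉t pt = divide x≉t
        (solve 6 (λ a b c d x t → (x :- t) :* ((a :* t :+ (a :* x :+ b)) :* t :+ ((a :* x :+ b) :* x :+ c))
          := ((a :* x :+ b) :* x :+ c) :* x :+ d :- (((a :* t :+ b) :* t :+ c) :* t :+ d)) refl a b c d x t)
        (p (inj₁ refl)) pt
      ≉-resp : ∀ {t u} → x ≉ u → t ≈ u → x ≉ t
      ≉-resp x≉u t≈u x≈t = x≉u (trans x≈t t≈u)
      quad : a ≈ 0# × a * x + b ≈ 0# × (a * x + b) * x + c ≈ 0#
      quad = quadratic-vanishes y≉z y≉w z≉w λ where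
        (inj₁ t≈y) → quotient (≉-resp x≉y t≈y) (p (inj₂ (inj₁ t≈y)))
        (inj₂ (inj₁ t≈z)) → quotient (≉-resp x≉z t≈z) (p (inj₂ (inj₂ (inj₁ t≈z))))
        (inj₂ (inj₂ t≈w)) → quotient (≉-resp x≉w t≈w) (p (inj₂ (inj₂ (inj₂ t≈w))))
      a≈0 : a ≈ 0#
      a≈0 = proj₁ quad
      b≈0 : b ≈ 0#
      b≈0 = absorb a≈0 (proj₁ (proj₂ quad))
      c≈0 : c ≈ 0#
      c≈0 = absorb (proj₁ (proj₂ quad)) (proj₂ (proj₂ quad))

  module _ (5≤q : 5 ℕ.≤ q) where
    private
      avoiding : ∀ {n} (i : Fin n) → 5 ℕ.≤ n → Σ[ f ∈ (Fin 4 → Fin n) ] (∀ {j k : Fin 4} → f j ≡ f k → j ≡ k) × (∀ j → f j ≢ i)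
      avoiding {suc n} i (ℕ.s≤s 4≤n) =
        (λ j → Fin.punchIn i (Fin.inject≤ j 4≤n)) ,
        (λ eq → Fin.inject≤-injective 4≤n 4≤n _ _ (Fin.punchIn-injective i _ _ eq)) ,
        (λ j → Fin.punchInᵢ≢i i (Fin.inject≤ j 4≤n))

    -- The bound q ≥ 5 enters here: it provides four distinct nonzero elements.
    cubic-vanishes-off-0 : ∀ {a b c d} → (∀ t → t ≉ 0# → ((a * t + b) * t + c) * t + d ≈ 0#) →
                           a ≈ 0# × b ≈ 0# × c ≈ 0# × d ≈ 0#
    cubic-vanishes-off-0 p with avoiding (index 0#) 5≤q
    ... | f , f-injective , f≢0 = cubic-vanishes
      (distinct {0F} {1F} λ ()) (distinct {0F} {2F} λ ()) (distinct {0F} {3F} λ ())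
      (distinct {1F} {2F} λ ()) (distinct {1F} {3F} λ ()) (distinct {2F} {3F} λ ())
      λ where
        (inj₁ eq) → p _ (nonzero 0F eq)
        (inj₂ (inj₁ eq)) → p _ (nonzero 1F eq)
        (inj₂ (inj₂ (inj₁ eq))) → p _ (nonzero 2F eq)
        (inj₂ (inj₂ (inj₂ eq))) → p _ (nonzero 3F eq)
      where
      distinct : ∀ {i j} → i ≢ j → element (f i) ≉ element (f j)
      distinct i≢j eq = i≢j (f-injective (Bijection.injective size eq))
      nonzero : ∀ i {t} → t ≈ element (f i) → t ≉ 0#
      nonzero i t≈ t≈0 = f≢0 i (≡.trans (≡.sym (index-element (f i))) (index-cong (trans (sym t≈) t≈0)))

    -- H fixes P(∞) and P(0). For t ≉ 0 the quadrics through the image of P(t) reduce to cubic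
    -- equations in t, and these hold at q - 1 ≥ 4 points, so all their coefficients vanish.
    module Diagonal (H : Matrix) (H-OnCubic : ∀ t → OnCubic (cubicCoords t *ᵥ H))
      (H₀₁≈0 : H 0F 1F ≈ 0#) (H₀₂≈0 : H 0F 2F ≈ 0#) (H₀₃≈0 : H 0F 3F ≈ 0#)
      (H₃₀≈0 : H 3F 0F ≈ 0#) (H₃₁≈0 : H 3F 1F ≈ 0#) (H₃₂≈0 : H 3F 2F ≈ 0#)
      (H₀₀≉0 : H 0F 0F ≉ 0#) (H₃₃≉0 : H 3F 3F ≉ 0#) (column≉0 : ¬ (∀ i → H i 1F ≈ 0#)) where
      private
        -- The rows of H are (l , 0 , 0 , 0), (m , r , u , x), (n , s , v , y) and (0 , 0 , 0 , o).
        l m n r s u v x y o : Carrier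
        l = H 0F 0F
        m = H 1F 0F
        n = H 2F 0F
        r = H 1F 1F
        s = H 2F 1F
        u = H 1F 2F
        v = H 2F 2F
        x = H 1F 3F
        y = H 2F 3F
        o = H 3F 3F

        module _ (t : Carrier) where
          -- The image of P(t) is (t f₀ , t f₁ , t f₂ , f₃): a zero in the last row leaves a factor
          -- t, a zero in the first row lowers the degree.
          f₀ f₁ f₂ f₃ : Carrier
          f₀ = (l * t + m) * t + n
          f₁ = r * t + s
          f₂ = u * t + v
          f₃ = (x * t + y) * t + o

          image : ∀ {a b c d} → (cubicCoords t *ᵥ (λ i _ → (a ∷ b ∷ c ∷ d ∷ []) i)) 0F ≈ ((a * t + b) * t + c) * t + d
          image {a} {b} {c} {d} = solve 5 (λ a b c d t →
            t :* (t :* (t :* con (ℤ.+ 1))) :* a :+ (t :* (t :* con (ℤ.+ 1)) :* b :+ (t :* c :+ (con (ℤ.+ 1) :* d :+ con (ℤ.+ 0))))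
            := ((a :* t :+ b) :* t :+ c) :* t :+ d) refl a b c d t

          drop₀ : ∀ {a b c d} → a ≈ 0# → ((a * t + b) * t + c) * t + d ≈ (b * t + c) * t + d
          drop₀ a≈0 = +-congʳ (*-congʳ (+-congʳ (*-congʳ (trans (+-congʳ (trans (*-congʳ a≈0) (zeroˡ t))) (+-identityˡ _)))))

          drop₃ : ∀ {a b} → b ≈ 0# → a * t + b ≈ a * t
          drop₃ b≈0 = trans (+-congˡ b≈0) (+-identityʳ _)

          g : Vec4
          g = cubicCoords t *ᵥ H

          g₀ : g 0F ≈ f₀ * t
          g₀ = trans image (drop₃ H₃₀≈0)
          g₁ : g 1F ≈ f₁ * t
          g₁ = trans image (trans (drop₀ H₀₁≈0) (drop₃ H₃₁≈0))
          g₂ : g 2F ≈ f₂ * t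
          g₂ = trans image (trans (drop₀ H₀₂≈0) (drop₃ H₃₂≈0))
          g₃ : g 3F ≈ f₃
          g₃ = trans image (drop₀ H₀₃≈0)

          subtract : ∀ {a b c} → a ≈ b → c ≈ a - b → c ≈ 0#
          subtract a≈b c≈ = trans c≈ (trans (+-congʳ a≈b) (-‿inverseʳ _))

          quadric₁ : t ≉ 0# → f₁ * f₁ ≈ f₀ * f₂
          quadric₁ t≉0 = *-cancelˡ (*-≉0 t≉0 t≉0) (begin
            t * t * (f₁ * f₁)      ≈⟨ solve 2 (λ t f → t :* t :* (f :* f) := f :* t :* (f :* t)) refl t f₁ ⟩
            f₁ * t * (f₁ * t)      ≈⟨ *-cong g₁ g₁ ⟨
            g 1F * g 1F            ≈⟨ proj₁ (quadrics (H-OnCubic t)) ⟩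
            g 0F * g 2F            ≈⟨ *-cong g₀ g₂ ⟩
            f₀ * t * (f₂ * t)      ≈⟨ solve 3 (λ t f g → f :* t :* (g :* t) := t :* t :* (f :* g)) refl t f₀ f₂ ⟩
            t * t * (f₀ * f₂)      ∎)

          quadric₂ : t ≉ 0# → t * (f₂ * f₂) ≈ f₁ * f₃
          quadric₂ t≉0 = *-cancelˡ t≉0 (begin
            t * (t * (f₂ * f₂))    ≈⟨ solve 2 (λ t f → t :* (t :* (f :* f)) := f :* t :* (f :* t)) refl t f₂ ⟩
            f₂ * t * (f₂ * t)      ≈⟨ *-cong g₂ g₂ ⟨
            g 2F * g 2F            ≈⟨ proj₂ (quadrics (H-OnCubic t)) ⟩
            g 1F * g 3F            ≈⟨ *-cong g₁ g₃ ⟩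
            f₁ * t * f₃            ≈⟨ solve 3 (λ t f g → f :* t :* g := t :* (f :* g)) refl t f₁ f₃ ⟩
            t * (f₁ * f₃)          ∎)

        -- The leading coefficient for the first quadric forces u = 0, the constant one for the
        -- second forces s = 0. What then remains of the other coefficients says r² = l v and v² = r
        -- o, and makes m, n, x, y vanish once r and v are known to be nonzero.
        coefficients₁ : - (l * u) ≈ 0# × r * r - l * v - m * u ≈ 0# × r * s + r * s - m * v - n * u ≈ 0# × s * s - n * v ≈ 0#
        coefficients₁ = cubic-vanishes-off-0 λ t t≉0 → subtract t (quadric₁ t t≉0)
          (solve 8 (λ l m n r s u v t →
            ((:- (l :* u) :* t :+ (r :* r :- l :* v :- m :* u)) :* t :+ (r :* s :+ r :* s :- m :* v :- n :* u)) :* t :+ (s :* s :- n :* v)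
            := (r :* t :+ s) :* (r :* t :+ s) :- ((l :* t :+ m) :* t :+ n) :* (u :* t :+ v)) refl l m n r s u v t)

        coefficients₂ : u * u - r * x ≈ 0# × u * v + u * v - r * y - s * x ≈ 0# × v * v - r * o - s * y ≈ 0# × - (s * o) ≈ 0#
        coefficients₂ = cubic-vanishes-off-0 λ t t≉0 → subtract t (quadric₂ t t≉0)
          (solve 8 (λ r s u v x y o t →
            (((u :* u :- r :* x) :* t :+ (u :* v :+ u :* v :- r :* y :- s :* x)) :* t :+ (v :* v :- r :* o :- s :* y)) :* t :+ (:- (s :* o))
            := t :* ((u :* t :+ v) :* (u :* t :+ v)) :- (r :* t :+ s) :* ((x :* t :+ y) :* t :+ o)) refl r s u v x y o t)

        neg≈0 : ∀ {z} → - z ≈ 0# → z ≈ 0#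
        neg≈0 -z≈0 = trans (sym (-‿involutive _)) (trans (-‿cong -z≈0) -0#≈0#)

        u≈0 : u ≈ 0#
        u≈0 = *-≈0 H₀₀≉0 (neg≈0 (proj₁ coefficients₁))

        s≈0 : s ≈ 0#
        s≈0 = *-≈0 H₃₃≉0 (trans (*-comm _ _) (neg≈0 (proj₂ (proj₂ (proj₂ coefficients₂)))))

        ≈0ʳ : ∀ {z w} → w ≈ 0# → z * w ≈ 0#
        ≈0ʳ w≈0 = trans (*-congˡ w≈0) (zeroʳ _)

        ≈0ˡ : ∀ {z w} → z ≈ 0# → z * w ≈ 0#
        ≈0ˡ z≈0 = trans (*-congʳ z≈0) (zeroˡ _)

        minus-≈0 : ∀ {z w} → w ≈ 0# → z - w ≈ z
        minus-≈0 w≈0 = trans (+-congˡ (trans (-‿cong w≈0) -0#≈0#)) (+-identityʳ _)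

        ≈0-minus : ∀ {z w} → z ≈ 0# → z - w ≈ 0# → w ≈ 0#
        ≈0-minus z≈0 eq = neg≈0 (trans (sym (trans (+-congʳ z≈0) (+-identityˡ _))) eq)

      r²≈lv : r * r ≈ l * v
      r²≈lv = x∙y⁻¹≈ε⇒x≈y _ _ (trans (sym (minus-≈0 (≈0ʳ u≈0))) (proj₁ (proj₂ coefficients₁)))

      v²≈ro : v * v ≈ r * o
      v²≈ro = x∙y⁻¹≈ε⇒x≈y _ _ (trans (sym (minus-≈0 (≈0ˡ s≈0))) (proj₁ (proj₂ (proj₂ coefficients₂))))

      private
        r≉0 : r ≉ 0#
        r≉0 r≈0 = column≉0 λ where
          0F → H₀₁≈0
          1F → r≈0
          2F → s≈0
          3F → H₃₁≈0

      v≉0 : v ≉ 0#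
      v≉0 v≈0 = r≉0 (square≈0 (trans r²≈lv (≈0ʳ v≈0)))

      private
        m≈0 : m ≈ 0#
        m≈0 = *-≈0 v≉0 (trans (*-comm _ _) (≈0-minus (trans (+-cong (≈0ʳ s≈0) (≈0ʳ s≈0)) (+-identityˡ _)) (trans (sym (minus-≈0 (≈0ʳ u≈0))) (proj₁ (proj₂ (proj₂ coefficients₁))))))

        n≈0 : n ≈ 0#
        n≈0 = *-≈0 v≉0 (trans (*-comm _ _) (≈0-minus (≈0ʳ s≈0) (proj₂ (proj₂ (proj₂ coefficients₁)))))

        x≈0 : x ≈ 0#
        x≈0 = *-≈0 r≉0 (≈0-minus (≈0ʳ u≈0) (proj₁ coefficients₂))

        y≈0 : y ≈ 0#
        y≈0 = *-≈0 r≉0 (≈0-minus (trans (+-cong (≈0ˡ u≈0) (≈0ˡ u≈0)) (+-identityˡ _)) (trans (sym (minus-≈0 (≈0ˡ s≈0))) (proj₁ (proj₂ coefficients₂))))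

      diagonal : ∀ i j → i ≢ j → H i j ≈ 0#
      diagonal 0F 0F i≢j = contradiction ≡.refl i≢j
      diagonal 0F 1F _ = H₀₁≈0
      diagonal 0F 2F _ = H₀₂≈0
      diagonal 0F 3F _ = H₀₃≈0
      diagonal 1F 0F _ = m≈0
      diagonal 1F 1F i≢j = contradiction ≡.refl i≢j
      diagonal 1F 2F _ = u≈0
      diagonal 1F 3F _ = x≈0
      diagonal 2F 0F _ = n≈0
      diagonal 2F 1F _ = s≈0
      diagonal 2F 2F i≢j = contradiction ≡.refl i≢j
      diagonal 2F 3F _ = y≈0
      diagonal 3F 0F _ = H₃₀≈0
      diagonal 3F 1F _ = H₃₁≈0
      diagonal 3F 2F _ = H₃₂≈0
      diagonal 3F 3F i≢j = contradiction ≡.refl i≢j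

  *ᵥ-single : ∀ x M i → (∀ k → i ≢ k → x k ≈ 0#) → ∀ j → (x *ᵥ M) j ≈ x i * M i j
  *ᵥ-single x M i off j = begin
    (x *ᵥ M) j                               ≈⟨ sum-remove {3} {i} t ⟩
    t i + sum (removeAt t i)                 ≈⟨ +-congˡ (sum-cong-≋ {3} (λ k → trans (*-congʳ (off _ (Fin.punchInᵢ≢i i k ∘ ≡.sym))) (zeroˡ (M (Fin.punchIn i k) j)))) ⟩
    t i + sum {3} (λ _ → 0#)                 ≈⟨ +-congˡ (sum-replicate-zero 3) ⟩
    t i + 0#                                 ≈⟨ +-identityʳ _ ⟩
    t i                                      ∎
    where
    t : Vec4
    t k = x k * M k j

  *ᵥ-injective : ∀ g {x y} → x *ᵥ matrix g ≈ᵥ y *ᵥ matrix g → x ≈ᵥ y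
  *ᵥ-injective g {x} {y} eq i = trans (sym (inverseʳ g x i)) (trans (*ᵥ-congʳ (inverse g) eq i) (inverseʳ g y i))

  -- This is precomposition with t ↦ k t, whose matrix is diagonal with entries k³, k², k, 1.
  cubicMatrix-scaleRows : ∀ k a b c d i j →
    cubicMatrix (k * a) b (k * c) d i j ≈ (k * k * k ∷ k * k ∷ k ∷ 1# ∷ []) i * cubicMatrix a b c d i j
  cubicMatrix-scaleRows k a b c d i = λ where
      0F → scale a b a b a b i
      1F → scale a b a b c d i
      2F → scale a b c d c d i
      3F → scale c d c d c d i
    where
    scale : ∀ p q r s u v i → triple (k * p , q) (k * r , s) (k * u , v) i ≈ (k * k * k ∷ k * k ∷ k ∷ 1# ∷ []) i * triple (p , q) (r , s) (u , v) i
    scale p q r s u v 0F = solve 4 (λ k p r u → k :* p :* (k :* r) :* (k :* u) := k :* k :* k :* (p :* r :* u)) refl k p r u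
    scale p q r s u v 1F = solve 7 (λ k p q r s u v →
      k :* p :* (k :* r) :* v :+ k :* p :* s :* (k :* u) :+ q :* (k :* r) :* (k :* u)
      := k :* k :* (p :* r :* v :+ p :* s :* u :+ q :* r :* u)) refl k p q r s u v
    scale p q r s u v 2F = solve 7 (λ k p q r s u v →
      k :* p :* s :* v :+ q :* (k :* r) :* v :+ q :* s :* (k :* u)
      := k :* (p :* s :* v :+ q :* r :* v :+ q :* s :* u)) refl k p q r s u v
    scale p q r s u v 3F = sym (*-identityˡ _)

  InG-OnCubic : ∀ g → InG g → ∀ X → OnCubic (coords X) → OnCubic (coords X *ᵥ matrix g)
  InG-OnCubic g g∈G X X∈C =
    twistedCubic⇒OnCubic (X ∙ g) (Equivalence.to (g∈G X) (OnCubic⇒twistedCubic X X∈C))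

  module _ (5≤q : 5 ℕ.≤ q) where

    -- Rows 0 and 3 are the images of P(∞) and P(0), with parameters (a , c) and (b , d). They
    -- determine the fractional linear map up to precomposition with t ↦ κ t, and κ is read off the
    -- diagonal matrix that is left over.
    InG⇒cubicMatrix : ∀ g → InG g → ∃[ a ] ∃[ b ] ∃[ c ] ∃[ d ] det a b c d ≉ 0# × matrix g ∼ cubicMatrix a b c d
    InG⇒cubicMatrix g g∈G = go (OnCubic-resp (λ j → sym (row₀ j)) (InG-OnCubic g g∈G P∞ (twistedCubic⇒OnCubic P∞ (nothing , 1# , 1≉0 , λ i → sym (*-identityˡ _)))))
                               (OnCubic-resp (λ j → sym (row₃ j)) (InG-OnCubic g g∈G (P (just 0#)) (cubic∋ 0#)))
      where
      G : Matrix
      G = matrix g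
      P∞ : Point
      P∞ = P nothing

      cubic∋ : ∀ t → OnCubic (cubicCoords t)
      cubic∋ t = twistedCubic⇒OnCubic (P (just t)) (just t , 1# , 1≉0 , λ i → sym (*-identityˡ _))

      row₀ : ∀ j → (coords P∞ *ᵥ G) j ≈ G 0F j
      row₀ j = trans (*ᵥ-single (coords P∞) G 0F (λ where
        0F 0≢0 → contradiction ≡.refl 0≢0
        1F _ → refl
        2F _ → refl
        3F _ → refl) j) (*-identityˡ _)

      row₃ : ∀ j → (cubicCoords 0# *ᵥ G) j ≈ G 3F j
      row₃ j = trans (*ᵥ-single (cubicCoords 0#) G 3F (λ where
        0F _ → zeroˡ _
        1F _ → zeroˡ _
        2F _ → refl
        3F 3≢3 → contradiction ≡.refl 3≢3) j) (*-identityˡ _)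

      go : OnCubic (G 0F) → OnCubic (G 3F) → ∃[ a ] ∃[ b ] ∃[ c ] ∃[ d ] det a b c d ≉ 0# × G ∼ cubicMatrix a b c d
      go (k₀ , a , c , k₀≉0 , _ , G₀≈) (k₃ , b , d , k₃≉0 , bd≉0 , G₃≈) =
        κ * a , b , κ * c , d ,
        (λ eq → *-≉0 κ≉0 det≉0 (trans (solve 5 (λ k a b c d → k :* (a :* d :- b :* c) := k :* a :* d :- b :* (k :* c)) refl κ a b c d) eq)) ,
        o , o≉0 , λ i j → begin
          G i j                                          ≈⟨ undo (G i) j ⟨
          (H i *ᵥ M) j                                   ≈⟨ *ᵥ-single (H i) M i (diagonal i) j ⟩
          H i i * M i j                                  ≈⟨ *-congʳ (entries i) ⟩
          o * (κ * κ * κ ∷ κ * κ ∷ κ ∷ 1# ∷ []) i * M i j ≈⟨ *-assoc _ _ _ ⟩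
          o * ((κ * κ * κ ∷ κ * κ ∷ κ ∷ 1# ∷ []) i * M i j) ≈⟨ *-congˡ (cubicMatrix-scaleRows κ a b c d i j) ⟨
          o * cubicMatrix (κ * a) b (κ * c) d i j        ∎
        where
        -- If w (a , c) = z (b , d), then w³ k₃ P(∞) and z³ k₀ P(0) have the same image, although
        -- their first coordinates differ.
        distinct-images : ∀ {w z} → w ≉ 0# → w * a ≈ z * b → ¬ w * c ≈ z * d
        distinct-images {w} {z} w≉0 wa≈zb wc≈zd =
          *-≉0 (*-≉0 (*-≉0 w≉0 w≉0) w≉0) k₃≉0 (trans (sym (*-identityʳ _)) (trans (proportional 0F) (trans (*-congˡ (zeroˡ _)) (zeroʳ _))))
          where
          proportional : (λ i → w * w * w * k₃ * coords P∞ i) ≈ᵥ λ i → z * z * z * k₀ * cubicCoords 0# i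
          proportional = *ᵥ-injective g λ j → begin
            ((λ i → w * w * w * k₃ * coords P∞ i) *ᵥ G) j     ≈⟨ *ᵥ-scale (w * w * w * k₃) (coords P∞) G j ⟩
            w * w * w * k₃ * (coords P∞ *ᵥ G) j               ≈⟨ *-congˡ (trans (row₀ j) (G₀≈ j)) ⟩
            w * w * w * k₃ * (k₀ * veronese a c j)            ≈⟨ shuffle w k₃ k₀ _ ⟩
            k₃ * k₀ * (w * w * w * veronese a c j)            ≈⟨ *-congˡ (veronese-scale w a c j) ⟨
            k₃ * k₀ * veronese (w * a) (w * c) j              ≈⟨ *-congˡ (veronese-cong wa≈zb wc≈zd j) ⟩
            k₃ * k₀ * veronese (z * b) (z * d) j              ≈⟨ *-cong (*-comm _ _) (veronese-scale z b d j) ⟩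
            k₀ * k₃ * (z * z * z * veronese b d j)            ≈⟨ shuffle z k₀ k₃ _ ⟨
            z * z * z * k₀ * (k₃ * veronese b d j)            ≈⟨ *-congˡ (trans (row₃ j) (G₃≈ j)) ⟨
            z * z * z * k₀ * (cubicCoords 0# *ᵥ G) j          ≈⟨ *ᵥ-scale (z * z * z * k₀) (cubicCoords 0#) G j ⟨
            ((λ i → z * z * z * k₀ * cubicCoords 0# i) *ᵥ G) j ∎
            where
            shuffle : ∀ w k l x → w * w * w * k * (l * x) ≈ k * l * (w * w * w * x)
            shuffle = solve 4 (λ w k l x → w :* w :* w :* k :* (l :* x) := k :* l :* (w :* w :* w :* x)) refl

        -- A vanishing determinant gives both d (a , c) = c (b , d) and b (a , c) = a (b , d), and
        -- one of d and b is nonzero.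
        det≉0 : det a b c d ≉ 0#
        det≉0 det≈0 with d ≟ 0# | x∙y⁻¹≈ε⇒x≈y _ _ det≈0
        ... | no d≉0 | ad≈bc = distinct-images d≉0 (trans (*-comm _ _) (trans ad≈bc (*-comm _ _))) (*-comm _ _)
        ... | yes d≈0 | ad≈bc = distinct-images (λ b≈0 → bd≉0 (b≈0 , d≈0)) (*-comm _ _) (sym ad≈bc)

        open Invertible₂ {a} {b} {c} {d} det≉0
        M N H : Matrix
        M = cubicMatrix a b c d
        N = cubicMatrix a′ b′ c′ d′
        H i = G i *ᵥ N

        undo : ∀ x → x *ᵥ N *ᵥ M ≈ᵥ x
        undo = let (e₁ , e₂ , e₃ , e₄) = rightInverse in cubicMatrix-inverse e₁ e₂ e₃ e₄

        H₀≈ : ∀ j → H 0F j ≈ k₀ * veronese 1# 0# j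
        H₀≈ j = trans (*ᵥ-congʳ N G₀≈ j) (trans (*ᵥ-scale k₀ (veronese a c) N j)
          (*-congˡ (trans (veronese-*ᵥ a c a′ b′ c′ d′ j) (veronese-cong (proj₁ leftInverse) (proj₁ (proj₂ (proj₂ leftInverse))) j))))

        H₃≈ : ∀ j → H 3F j ≈ k₃ * veronese 0# 1# j
        H₃≈ j = trans (*ᵥ-congʳ N G₃≈ j) (trans (*ᵥ-scale k₃ (veronese b d) N j)
          (*-congˡ (trans (veronese-*ᵥ b d a′ b′ c′ d′ j) (veronese-cong (proj₁ (proj₂ leftInverse)) (proj₂ (proj₂ (proj₂ leftInverse))) j))))

        k*1 : ∀ {k x} → x ≈ k * (1# * 1# * 1#) → x ≈ k
        k*1 eq = trans eq (trans (*-congˡ (trans (*-identityʳ _) (*-identityʳ _))) (*-identityʳ _))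
        k*0 : ∀ {k x y} → x ≈ k * y → y ≈ 0# → x ≈ 0#
        k*0 eq y≈0 = trans eq (trans (*-congˡ y≈0) (zeroʳ _))
        00x≈0 : ∀ {x} → 0# * 0# * x ≈ 0#
        00x≈0 = trans (*-congʳ (zeroˡ _)) (zeroˡ _)
        0xy≈0 : ∀ {x y} → 0# * x * y ≈ 0#
        0xy≈0 = trans (*-congʳ (zeroˡ _)) (zeroˡ _)

        column≉0 : ¬ (∀ i → H i 1F ≈ 0#)
        column≉0 H≈0 = 1≉0 (begin
          e 1F                                 ≈⟨ (let (e₁ , e₂ , e₃ , e₄) = leftInverse in cubicMatrix-inverse e₁ e₂ e₃ e₄ e 1F) ⟨
          (e *ᵥ M *ᵥ N) 1F                     ≈⟨ *ᵥ-congʳ N (inverseˡ g (e *ᵥ M)) 1F ⟨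
          (y *ᵥ G *ᵥ N) 1F                     ≈⟨ *ᵥ-assoc y G N 1F ⟩
          (y *ᵥ H) 1F                          ≈⟨ sum-cong-≋ {4} (λ i → trans (*-congˡ (H≈0 i)) (zeroʳ (y i))) ⟩
          sum {4} (λ _ → 0#)                   ≈⟨ sum-replicate-zero 4 ⟩
          0#                                   ∎)
          where
          e y : Vec4
          e = 0# ∷ 1# ∷ 0# ∷ 0# ∷ []
          -- The preimage of `e` under H = G N; a zero column of H would make the second coordinate
          -- of its image zero.
          y = e *ᵥ M *ᵥ inverse g

        open Diagonal 5≤q H
          (λ t → OnCubic-resp (λ j → sym (*ᵥ-assoc (cubicCoords t) G N j))
                   (OnCubic-*ᵥ rightInverse (InG-OnCubic g g∈G (P (just t)) (cubic∋ t))))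
          (k*0 (H₀≈ 1F) (zeroʳ _)) (k*0 (H₀≈ 2F) (zeroʳ _)) (k*0 (H₀≈ 3F) (zeroʳ _))
          (k*0 (H₃≈ 0F) 00x≈0) (k*0 (H₃≈ 1F) 00x≈0) (k*0 (H₃≈ 2F) 0xy≈0)
          (λ eq → k₀≉0 (trans (sym (k*1 (H₀≈ 0F))) eq)) (λ eq → k₃≉0 (trans (sym (k*1 (H₃≈ 3F))) eq)) column≉0

        l r v o κ : Carrier
        l = H 0F 0F
        r = H 1F 1F
        v = H 2F 2F
        o = H 3F 3F
        o≉0 : o ≉ 0#
        o≉0 eq = k₃≉0 (trans (sym (k*1 (H₃≈ 3F))) eq)
        -- By r² = l v and v² = r o the entries o, v, r, l form a geometric progression, and κ is
        -- its ratio.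
        κ = v * o ⁻¹⟨ o≉0 ⟩
        κ≉0 : κ ≉ 0#
        κ≉0 = *-≉0 v≉0 (⁻¹≉0 o o≉0)
        v≈oκ : v ≈ o * κ
        v≈oκ = sym (trans (solve 3 (λ o v i → o :* (v :* i) := v :* (i :* o)) refl o v (o ⁻¹⟨ o≉0 ⟩)) (trans (*-congˡ (⁻¹-inverseˡ o o≉0)) (*-identityʳ v)))
        r≈oκ² : r ≈ o * (κ * κ)
        r≈oκ² = *-cancelˡ o≉0 (trans (*-comm o r) (trans (sym v²≈ro) (trans (*-cong v≈oκ v≈oκ)
          (solve 2 (λ o k → o :* k :* (o :* k) := o :* (o :* (k :* k))) refl o κ))))
        l≈oκ³ : l ≈ o * (κ * κ * κ)
        l≈oκ³ = *-cancelˡ v≉0 (trans (*-comm v l) (trans (sym r²≈lv) (trans (*-cong r≈oκ² r≈oκ²)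
          (trans (solve 2 (λ o k → o :* (k :* k) :* (o :* (k :* k)) := o :* k :* (o :* (k :* k :* k))) refl o κ) (*-congʳ (sym v≈oκ))))))
        entries : ∀ i → H i i ≈ o * (κ * κ * κ ∷ κ * κ ∷ κ ∷ 1# ∷ []) i
        entries 0F = l≈oκ³
        entries 1F = r≈oκ²
        entries 2F = v≈oκ
        entries 3F = sym (*-identityʳ o)

-- Imaginary chords

hasSize : ∀ {a ℓ n} (S : Setoid a ℓ) (let open Setoid S) (f : Fin n → Carrier) →
  (∀ {i j} → f i ≈ f j → i ≡ j) → (∀ y → ∃[ i ] f i ≈ y) → HasSize S n
hasSize S f injective surjective = record
  { to = f
  ; cong = λ { ≡.refl → Setoid.refl S }
  ; bijective = injective , λ y → proj₁ (surjective y) , λ { ≡.refl → proj₂ (surjective y) }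
  }

even-or-odd : ∀ n → 2 ∣ n ⊎ (∃[ k ] n ≡ suc (k ℕ.* 2))
even-or-odd zero = inj₁ (divides 0 ≡.refl)
even-or-odd (suc n) with even-or-odd n
... | inj₁ (divides k eq) = inj₂ (k , ≡.cong suc eq)
... | inj₂ (k , eq) = inj₁ (divides (suc k) (≡.cong suc eq))

module ImaginaryChords {c ℓ ck ℓk} (p h q : ℕ) (p-prime : Prime p) (q≡p^h : q ≡ p ℕ.^ h) (5≤q : 5 ℕ.≤ q)
  (F : FiniteField c ℓ q) (K : FiniteField ck ℓk (q ℕ.^ 2))
  (ι : FiniteField.Carrier F → FiniteField.Carrier K) (ι-embedding : Chords.IsEmbedding F K ι) where

  open FiniteField F hiding (zero)
  open FiniteFieldProperties F
  open PG3 F hiding (Vec4; Matrix; _*ᵥ_; _≈ᵥ_)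
  open Chords F K ι using (ImaginaryChord; OnExtension)
  open SpanProperties F
  open CubicMatrices commutativeRing
  open TwistedCubicGroup F
  open QuadraticExtension F K ι ι-embedding
  open ChordGeometry F K ι ι-embedding
  open IntegerSolver commutativeRing using (solve; con; _:=_; _:+_; _:-_; _:*_; :-_; _:^_; _:×_)
  private
    module K where
      open FiniteField K public
      open FiniteFieldProperties K public
      open PG3 K public using (cubicCoords; _∈⟨_,_⟩)
      open SpanProperties K public
      open TwistedCubicGroup K public using (cubicCoords≈veronese)
      open CubicMatrices (FiniteField.commutativeRing K) public
      open IntegerSolver (FiniteField.commutativeRing K) public using (solve; con; _:=_; _:+_; _:-_; _:*_; :-_)
  open RingMorphisms (CommutativeRing.rawRing commutativeRing) (CommutativeRing.rawRing K.commutativeRing)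
  open IsRingHomomorphism ι-embedding using (+-homo; *-homo; 0#-homo; 1#-homo; -‿homo) renaming (⟦⟧-cong to ι-cong)
  open SetoidReasoning K.setoid

  ι-^ : ∀ n x → ι x K.^ n K.≈ ι (x ^ n)
  ι-^ zero x = K.sym 1#-homo
  ι-^ (suc n) x = K.trans (K.*-congˡ (ι-^ n x)) (K.sym (*-homo _ _))

  -- The q-th power map on K is additive and multiplicative and fixes F, so it carries roots of a
  -- polynomial over F to roots.
  conjugate-root : ∀ {S D t} → IsRoot S D t → IsRoot S D (t K.^ q)
  conjugate-root {S} {D} {t} root = begin
    t K.^ q K.* t K.^ q                    ≈⟨ ^-distrib-* t t q ⟨
    (t K.* t) K.^ q                        ≈⟨ ^-congˡ q root ⟩
    (ι S K.* t K.+ ι D) K.^ q              ≈⟨ frobenius (ι S K.* t) (ι D) ⟩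
    (ι S K.* t) K.^ q K.+ ι D K.^ q        ≈⟨ K.+-cong (K.trans (^-distrib-* (ι S) t q) (K.*-congʳ (fixed S))) (fixed D) ⟩
    ι S K.* t K.^ q K.+ ι D                ∎
    where
    open Algebra.Properties.CommutativeSemiring.Exp K.commutativeSemiring using (^-distrib-*; ^-congˡ)
    q²≡ : q ℕ.^ 2 ≡ p ℕ.^ (h ℕ.* 2)
    q²≡ = ≡.trans (≡.cong (ℕ._^ 2) q≡p^h) (ℕ.^-*-assoc p h 2)
    frobenius : ∀ x y → (x K.+ y) K.^ q K.≈ x K.^ q K.+ y K.^ q
    frobenius x y = ≡.subst (λ n → (x K.+ y) K.^ n K.≈ x K.^ n K.+ y K.^ n) (≡.sym q≡p^h)
      (Frobenius.+-^p^ K.commutativeRing p-prime (K.p·1≈0 p (h ℕ.* 2) q²≡) h x y)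
    fixed : ∀ x → ι x K.^ q K.≈ ι x
    fixed x = K.trans (ι-^ q x) (ι-cong (x^q≈x x))

  -- The conjugate comes for free: t ^ q is a root of the minimal polynomial of t, and the line
  -- contains P of every root.
  imaginaryChord : ∀ l t → ¬ Rational t → OnExtension l t → ImaginaryChord l
  imaginaryChord l t irr t∈l = let (S , D , root) = minimal-polynomial irr in
    t , irr , t∈l , ChordLine.IsRoot⇒CubicPointOn irr root {coords (p₁ l)} {coords (p₂ l)} t∈l (conjugate-root root)

  -- t′ = (a t + b) / (c t + d), cleared of the denominator.
  Möbius : (a b c d : Carrier) → K.Carrier → K.Carrier → Set _
  Möbius a b c d t t′ = ι a K.* t K.+ ι b K.≈ t′ K.* (ι c K.* t K.+ ι d)

  ι-triple : ∀ p q r s u v i → ι (triple (p , q) (r , s) (u , v) i) K.≈ K.triple (ι p , ι q) (ι r , ι s) (ι u , ι v) i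
  ι-triple p q r s u v = λ where
      0F → mul p r u
      1F → add (add (mul p r v) (mul p s u)) (mul q r u)
      2F → add (add (mul p s v) (mul q r v)) (mul q s u)
      3F → mul q s v
    where
    mul : ∀ x y z → ι (x * y * z) K.≈ ι x K.* ι y K.* ι z
    mul x y z = K.trans (*-homo _ _) (K.*-congʳ (*-homo x y))
    add : ∀ {x y x′ y′} → ι x K.≈ x′ → ι y K.≈ y′ → ι (x + y) K.≈ x′ K.+ y′
    add x≈ y≈ = K.trans (+-homo _ _) (K.+-cong x≈ y≈)

  ι-cubicMatrix : ∀ a b c d i j → ι (cubicMatrix a b c d i j) K.≈ K.cubicMatrix (ι a) (ι b) (ι c) (ι d) i j
  ι-cubicMatrix a b c d i 0F = ι-triple a b a b a b i
  ι-cubicMatrix a b c d i 1F = ι-triple a b a b c d i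
  ι-cubicMatrix a b c d i 2F = ι-triple a b c d c d i
  ι-cubicMatrix a b c d i 3F = ι-triple c d c d c d i

  ι-sum : ∀ {n} (t : Vector Carrier n) → ι (sum t) K.≈ K.sum (ι ∘ t)
  ι-sum {zero} t = 0#-homo
  ι-sum {suc n} t = K.trans (+-homo _ _) (K.+-congˡ (ι-sum (t ∘ suc)))

  ι-*ᵥ : ∀ x M j → ι ((x *ᵥ M) j) K.≈ ((ι ∘ x) K.*ᵥ (λ i → ι ∘ M i)) j
  ι-*ᵥ x M j = K.trans (ι-sum (λ i → x i * M i j)) (sum-cong-≋ {4} (λ i → *-homo (x i) (M i j)))
    where open import Algebra.Properties.Semiring.Sum K.semiring using (sum-cong-≋)

  module _ {a b c d : Carrier} {t t′ : K.Carrier} (möbius : Möbius a b c d t t′) where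
    denominator : K.Carrier
    denominator = ι c K.* t K.+ ι d

    -- The image has homogeneous parameters (w t′ , w), where w is the denominator; this explains
    -- the factor w³.
    cubicCoords-*ᵥ : ∀ j → (K.cubicCoords t K.*ᵥ (λ i → ι ∘ cubicMatrix a b c d i)) j
                          K.≈ denominator K.* denominator K.* denominator K.* K.cubicCoords t′ j
    cubicCoords-*ᵥ j = begin
      (K.cubicCoords t K.*ᵥ (λ i → ι ∘ cubicMatrix a b c d i)) j
        ≈⟨ K.*ᵥ-congˡ (K.cubicCoords t) (ι-cubicMatrix a b c d) j ⟩
      (K.cubicCoords t K.*ᵥ M) j
        ≈⟨ K.*ᵥ-congʳ M (K.cubicCoords≈veronese t) j ⟩
      (K.veronese t K.1# K.*ᵥ M) j
        ≈⟨ K.veronese-*ᵥ t K.1# (ι a) (ι b) (ι c) (ι d) j ⟩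
      K.veronese (ι a K.* t K.+ ι b K.* K.1#) (ι c K.* t K.+ ι d K.* K.1#) j
        ≈⟨ K.veronese-cong (K.trans (K.+-congˡ (K.*-identityʳ _)) (K.trans möbius (K.*-comm _ _)))
                           (K.trans (K.+-congˡ (K.*-identityʳ _)) (K.sym (K.*-identityʳ _))) j ⟩
      K.veronese (denominator K.* t′) (denominator K.* K.1#) j
        ≈⟨ K.veronese-scale denominator t′ K.1# j ⟩
      denominator K.* denominator K.* denominator K.* K.veronese t′ K.1# j
        ≈⟨ K.*-congˡ (K.cubicCoords≈veronese t′ j) ⟨
      denominator K.* denominator K.* denominator K.* K.cubicCoords t′ j ∎
      where
      M : K.Matrix
      M = K.cubicMatrix (ι a) (ι b) (ι c) (ι d)

  ∈-*ᵥ : ∀ {x u v} M → x ∈⟨ u , v ⟩ → x *ᵥ M ∈⟨ u *ᵥ M , v *ᵥ M ⟩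
  ∈-*ᵥ {x} {u} {v} M (a , b , x≈) = a , b , λ i → trans (*ᵥ-congʳ M x≈ i) (*ᵥ-linear a b u v M i)

  ι-*ᵥ-span : ∀ {x} {w₀ w₁ : Vec4} A B M → (∀ i → x i K.≈ A K.* ι (w₀ i) K.+ B K.* ι (w₁ i)) →
    ∀ j → (x K.*ᵥ (λ i → ι ∘ M i)) j K.≈ A K.* ι ((w₀ *ᵥ M) j) K.+ B K.* ι ((w₁ *ᵥ M) j)
  ι-*ᵥ-span {x} {w₀} {w₁} A B M x≈ j = K.trans (K.*ᵥ-congʳ (λ i → ι ∘ M i) x≈ j)
    (K.trans (K.*ᵥ-linear A B (ι ∘ w₀) (ι ∘ w₁) (λ i → ι ∘ M i) j)
             (K.sym (K.+-cong (K.*-congˡ (ι-*ᵥ w₀ M j)) (K.*-congˡ (ι-*ᵥ w₁ M j)))))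

  -- The chord through P(t) is spanned by the coordinate vectors of P(t), whose images are the
  -- coordinate vectors of the image of P(t), hence lie on the rational line through P(t′).
  ∈-chord-*ᵥ : ∀ {a b c d t t′ u v u′ v′} → ¬ Rational t → CubicPointOn u v t → CubicPointOn u′ v′ t′ →
    Möbius a b c d t t′ → ∀ {x} → x ∈⟨ u , v ⟩ → x *ᵥ cubicMatrix a b c d ∈⟨ u′ , v′ ⟩
  ∈-chord-*ᵥ {a} {b} {c} {d} {t} {t′} {u} {v} {u′} {v′} irr t∈ (A′ , B′ , t′≈) möbius {x} x∈ =
    ∈-trans (∈-*ᵥ {x} M (OnChord⇒∈ {x = x} (ChordLine.∈line⇒OnChord irr root {u} {v} t∈ {x} x∈))) (proj₁ images) (proj₂ images)
    where
    S D : Carrier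
    S = proj₁ (minimal-polynomial irr)
    D = proj₁ (proj₂ (minimal-polynomial irr))
    root : IsRoot S D t
    root = proj₂ (proj₂ (minimal-polynomial irr))
    M : Matrix
    M = cubicMatrix a b c d
    w w³ : K.Carrier
    w = denominator {a} {b} {c} {d} möbius
    w³ = w K.* w K.* w
    images : β₀ S D *ᵥ M ∈⟨ u′ , v′ ⟩ × β₁ S D *ᵥ M ∈⟨ u′ , v′ ⟩
    images = descent irr (w³ K.* A′) (w³ K.* B′) λ i → begin
      ι ((β₀ S D *ᵥ M) i) K.+ ι ((β₁ S D *ᵥ M) i) K.* t
        ≈⟨ K.+-cong (K.*-identityˡ _) (K.*-comm _ _) ⟨
      K.1# K.* ι ((β₀ S D *ᵥ M) i) K.+ t K.* ι ((β₁ S D *ᵥ M) i)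
        ≈⟨ ι-*ᵥ-span {K.cubicCoords t} K.1# t M (λ k → K.trans (cubicCoords-decomposition root k) (K.+-cong (K.sym (K.*-identityˡ _)) (K.*-comm _ _))) i ⟨
      (K.cubicCoords t K.*ᵥ (λ k → ι ∘ M k)) i
        ≈⟨ cubicCoords-*ᵥ möbius i ⟩
      w³ K.* K.cubicCoords t′ i
        ≈⟨ K.*-congˡ (t′≈ i) ⟩
      w³ K.* (A′ K.* ι (u′ i) K.+ B′ K.* ι (v′ i))
        ≈⟨ K.trans (K.distribˡ _ _ _) (K.+-cong (K.sym (K.*-assoc _ _ _)) (K.sym (K.*-assoc _ _ _))) ⟩
      w³ K.* A′ K.* ι (u′ i) K.+ w³ K.* B′ K.* ι (v′ i) ∎

  -- The inverse is again a cubic matrix and its fraction takes t′ back to t, so the converse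
  -- inclusion is another instance of the same argument.
  mapsChord : ∀ {a b c d t t′} det≉0 l l′ → ¬ Rational t → ¬ Rational t′ → OnExtension l t → OnExtension l′ t′ →
    Möbius a b c d t t′ → mapsLine (cubicProjectivity a b c d det≉0) l l′
  mapsChord {a} {b} {c} {d} {t} {t′} det≉0 l l′ irr irr′ t∈l t′∈l′ möbius X = mk⇔
    (∈-chord-*ᵥ {u = coords (p₁ l)} {coords (p₂ l)} irr t∈l t′∈l′ möbius)
    (λ Xg∈l′ → ∈-resp-≈ᵥ (λ i → sym (inverseʳ g (coords X) i))
                 (∈-chord-*ᵥ {a′} {b′} {c′} {d′} {u = coords (p₁ l′)} {coords (p₂ l′)} irr′ t′∈l′ t∈l inverse-möbius Xg∈l′))
    where
    open Invertible₂ {a} {b} {c} {d} det≉0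
    g : Projectivity
    g = cubicProjectivity a b c d det≉0
    inverse-möbius : Möbius a′ b′ c′ d′ t′ t
    inverse-möbius = begin
      ι (k * d) K.* t′ K.+ ι (k * (- b))
        ≈⟨ K.+-cong (K.*-congʳ (*-homo k d)) (K.trans (*-homo k (- b)) (K.*-congˡ (-‿homo b))) ⟩
      ι k K.* ι d K.* t′ K.+ ι k K.* (K.- ι b)
        ≈⟨ K.solve 7 (λ k a b c d t t′ → k K.:* d K.:* t′ K.:+ k K.:* (K.:- b)
              K.:= k K.:* (t′ K.:* (c K.:* t K.:+ d) K.:- (a K.:* t K.:+ b)) K.:+ t K.:* (k K.:* (K.:- c) K.:* t′ K.:+ k K.:* a)) K.refl (ι k) (ι a) (ι b) (ι c) (ι d) t t′ ⟩
      ι k K.* (t′ K.* (ι c K.* t K.+ ι d) K.- (ι a K.* t K.+ ι b)) K.+ t K.* (ι k K.* (K.- ι c) K.* t′ K.+ ι k K.* ι a)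
        ≈⟨ K.+-congʳ (K.trans (K.*-congˡ (K.trans (K.+-congˡ (K.-‿cong möbius)) (K.-‿inverseʳ _))) (K.zeroʳ _)) ⟩
      K.0# K.+ t K.* (ι k K.* (K.- ι c) K.* t′ K.+ ι k K.* ι a)
        ≈⟨ K.+-identityˡ _ ⟩
      t K.* (ι k K.* (K.- ι c) K.* t′ K.+ ι k K.* ι a)
        ≈⟨ K.*-congˡ (K.+-cong (K.*-congʳ (K.trans (*-homo k (- c)) (K.*-congˡ (-‿homo c)))) (*-homo k a)) ⟨
      t K.* (ι (k * (- c)) K.* t′ K.+ ι (k * a)) ∎

  module _ {t : K.Carrier} (irr : ¬ Rational t) where
    open Basis t irr

    combination≈0 : ∀ {x y} → ι x K.* t K.+ ι y K.≈ K.0# → x ≈ 0# × y ≈ 0#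
    combination≈0 eq = let (y≈0 , x≈0) = coordinates-unique
                             (K.trans (K.+-comm _ _) (K.trans eq (K.sym (K.trans (K.+-cong 0#-homo (K.trans (K.*-congʳ 0#-homo) (K.zeroˡ t))) (K.+-identityˡ _)))))
                       in x≈0 , y≈0

    det≈0 : ∀ {a b c d} → c ≈ 0# × d ≈ 0# → det a b c d ≈ 0#
    det≈0 {a} {b} (c≈0 , d≈0) = trans (+-cong (trans (*-congˡ d≈0) (zeroʳ a)) (trans (-‿cong (trans (*-congˡ c≈0) (zeroʳ b))) -0#≈0#)) (+-identityˡ _)
      where open Algebra.Properties.Ring ring using (-0#≈0#)

    denominator≉0 : ∀ {a b c d} → det a b c d ≉ 0# → ι c K.* t K.+ ι d K.≉ K.0#
    denominator≉0 det≉0 eq = det≉0 (det≈0 (combination≈0 eq))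

    -- A rational value x would give a = x c and b = x d on comparing coordinates, hence determinant
    -- 0.
    Möbius-irrational : ∀ {a b c d t′} → det a b c d ≉ 0# → Möbius a b c d t t′ → ¬ Rational t′
    Möbius-irrational {a} {b} {c} {d} {t′} det≉0 möbius (x , ιx≈t′) = det≉0
      (trans (+-cong (*-congʳ (proj₂ eqs)) (-‿cong (*-congʳ (proj₁ eqs))))
             (solve 3 (λ x c d → x :* c :* d :- x :* d :* c := con (ℤ.+ 0)) refl x c d))
      where
      eqs : b ≈ x * d × a ≈ x * c
      eqs = coordinates-unique (begin
        ι b K.+ ι a K.* t                        ≈⟨ K.+-comm _ _ ⟩
        ι a K.* t K.+ ι b                        ≈⟨ möbius ⟩
        t′ K.* (ι c K.* t K.+ ι d)               ≈⟨ K.*-congʳ ιx≈t′ ⟨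
        ι x K.* (ι c K.* t K.+ ι d)              ≈⟨ K.solve 4 (λ x c d t → x K.:* (c K.:* t K.:+ d) K.:= x K.:* d K.:+ x K.:* c K.:* t) K.refl (ι x) (ι c) (ι d) t ⟩
        ι x K.* ι d K.+ ι x K.* ι c K.* t        ≈⟨ K.+-cong (*-homo x d) (K.*-congʳ (*-homo x c)) ⟨
        ι (x * d) K.+ ι (x * c) K.* t            ∎)

    -- With P(t) = A u + B v, the combination of the images of u and v with coefficients A and B
    -- lies on the extension of l′. It equals k w³ P(t′), where w is the denominator, and this
    -- factor can be divided out.
    image-on-line : ∀ {a b c d} → det a b c d ≉ 0# → ∀ g → matrix g ∼ cubicMatrix a b c d →
      ∀ l l′ → mapsLine g l l′ → OnExtension l t → ∃[ t′ ] OnExtension l′ t′ × Möbius a b c d t t′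
    image-on-line {a} {b} {c} {d} det≉0 g (k , k≉0 , g≈) l l′ maps (A , B , t≈) = t′ , t′∈l′ , möbius
      where
      u v : Vec4
      u = coords (p₁ l)
      v = coords (p₂ l)
      w : K.Carrier
      w = ι c K.* t K.+ ι d
      w≉0 : w K.≉ K.0#
      w≉0 = denominator≉0 {a} {b} det≉0
      t′ : K.Carrier
      t′ = (ι a K.* t K.+ ι b) K.* (w K.⁻¹⟨ w≉0 ⟩)
      möbius : Möbius a b c d t t′
      möbius = K.sym (K.trans (K.*-assoc _ _ _) (K.trans (K.*-congˡ (K.⁻¹-inverseˡ w w≉0)) (K.*-identityʳ _)))
      s : K.Carrier
      s = ι k K.* (w K.* w K.* w)
      s≉0 : s K.≉ K.0#
      s≉0 = K.*-≉0 (k≉0 ∘ ι≈0⇒≈0) (K.*-≉0 (K.*-≉0 w≉0 w≉0) w≉0)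
      ι-image : ∀ {x} → x *ᵥ matrix g ∈⟨ coords (p₁ l′) , coords (p₂ l′) ⟩ →
                (ι ∘ (x *ᵥ matrix g)) K.∈⟨ ι ∘ coords (p₁ l′) , ι ∘ coords (p₂ l′) ⟩
      ι-image (x , y , eq) = ι x , ι y , λ i → K.trans (ι-cong (eq i)) (ι-combination x y _ _)
      scaled : ∀ i → s K.* K.cubicCoords t′ i K.≈ A K.* ι ((u *ᵥ matrix g) i) K.+ B K.* ι ((v *ᵥ matrix g) i)
      scaled i = begin
        ι k K.* (w K.* w K.* w) K.* K.cubicCoords t′ i
          ≈⟨ K.*-assoc _ _ _ ⟩
        ι k K.* (w K.* w K.* w K.* K.cubicCoords t′ i)
          ≈⟨ K.*-congˡ (cubicCoords-*ᵥ {a} {b} {c} {d} möbius i) ⟨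
        ι k K.* (K.cubicCoords t K.*ᵥ (λ m → ι ∘ cubicMatrix a b c d m)) i
          ≈⟨ K.*-congˡ (ι-*ᵥ-span {K.cubicCoords t} {u} {v} A B (cubicMatrix a b c d) t≈ i) ⟩
        ι k K.* (A K.* ι ((u *ᵥ cubicMatrix a b c d) i) K.+ B K.* ι ((v *ᵥ cubicMatrix a b c d) i))
          ≈⟨ K.solve 5 (λ k A B x y → k K.:* (A K.:* x K.:+ B K.:* y) K.:= A K.:* (k K.:* x) K.:+ B K.:* (k K.:* y)) K.refl (ι k) A B _ _ ⟩
        A K.* (ι k K.* ι ((u *ᵥ cubicMatrix a b c d) i)) K.+ B K.* (ι k K.* ι ((v *ᵥ cubicMatrix a b c d) i))
          ≈⟨ K.+-cong (K.*-congˡ (rescale u)) (K.*-congˡ (rescale v)) ⟨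
        A K.* ι ((u *ᵥ matrix g) i) K.+ B K.* ι ((v *ᵥ matrix g) i) ∎
        where
        rescale : ∀ x → ι ((x *ᵥ matrix g) i) K.≈ ι k K.* ι ((x *ᵥ cubicMatrix a b c d) i)
        rescale x = K.trans (ι-cong (trans (*ᵥ-congˡ x g≈ i) (*ᵥ-scaleˡ k x (cubicMatrix a b c d) i))) (*-homo _ _)
      t′∈l′ : OnExtension l′ t′
      t′∈l′ = K.∈-resp-≈ᵥ (λ i → K.sym (K.trans (K.sym (K.*-assoc _ _ _)) (K.trans (K.*-congʳ (K.⁻¹-inverseˡ s s≉0)) (K.*-identityˡ _))))
        (K.∈-scale (s K.⁻¹⟨ s≉0 ⟩) (K.∈-resp-≈ᵥ scaled (K.∈-trans {w = ι ∘ (u *ᵥ matrix g)} {w′ = ι ∘ (v *ᵥ matrix g)} (A , B , λ i → K.refl)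
          (ι-image {u} (Equivalence.to (maps (p₁ l)) (∈-left u v)))
          (ι-image {v} (Equivalence.to (maps (p₂ l)) (∈-right u v))))))

  -- Transitivity on the imaginary chords

  chordLine : (S D : Carrier) → Line
  chordLine S D = line
    (point (β₀ S D) λ z → 1≉0 (z 3F))
    (point (β₁ S D) λ z → 1≉0 (z 2F))
    λ (k , _ , e) → 1≉0 (trans (e 3F) (zeroʳ k))

  chordLine-OnExtension : ∀ {S D t} → IsRoot S D t → OnExtension (chordLine S D) t
  chordLine-OnExtension {t = t} root =
    K.1# , t , λ i → K.trans (cubicCoords-decomposition root i) (K.+-cong (K.sym (K.*-identityˡ _)) (K.*-comm _ _))

  imaginaryChords-orbit : IsOrbit ImaginaryChord
  imaginaryChords-orbit = l₀ , λ l → mk⇔ (from-l₀ l) (to-chord l)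
    where
    t : K.Carrier
    t = proj₁ irrational
    irr : ¬ Rational t
    irr = proj₂ irrational
    S D : Carrier
    S = proj₁ (minimal-polynomial irr)
    D = proj₁ (proj₂ (minimal-polynomial irr))
    root : IsRoot S D t
    root = proj₂ (proj₂ (minimal-polynomial irr))
    l₀ : Line
    l₀ = chordLine S D
    t∈l₀ : OnExtension l₀ t
    t∈l₀ = chordLine-OnExtension root

    -- As 1, t is a basis of K over F, an affine map of F moves t to any other irrational t′.
    from-l₀ : ∀ l → ImaginaryChord l → ∃[ g ] InG g × mapsLine g l₀ l
    from-l₀ l (t′ , irr′ , t′∈l , _) =
      cubicProjectivity a b 0# 1# det≉0 , cubicProjectivity∈G a b 0# 1# det≉0 ,
      mapsChord {a} {b} {0#} {1#} det≉0 l₀ l irr irr′ t∈l₀ t′∈l möbius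
      where
      a b : Carrier
      a = proj₁ (proj₂ (Basis.coordinates t irr t′))
      b = proj₁ (Basis.coordinates t irr t′)
      t′≈ : t′ K.≈ ι b K.+ ι a K.* t
      t′≈ = proj₂ (proj₂ (Basis.coordinates t irr t′))
      det≉0 : det a b 0# 1# ≉ 0#
      det≉0 eq = irr′ (b , K.sym (K.trans t′≈ (K.trans (K.+-congˡ (K.trans (K.*-congʳ (K.trans (ι-cong a≈0) 0#-homo)) (K.zeroˡ t))) (K.+-identityʳ _))))
        where
        a≈0 : a ≈ 0#
        a≈0 = trans (solve 2 (λ a b → a := a :* con (ℤ.+ 1) :- b :* con (ℤ.+ 0)) refl a b) eq
      möbius : Möbius a b 0# 1# t t′
      möbius = K.trans (K.+-comm _ _) (K.trans (K.sym t′≈) (K.sym (K.trans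
        (K.*-congˡ (K.trans (K.+-cong (K.trans (K.*-congʳ 0#-homo) (K.zeroˡ t)) 1#-homo) (K.+-identityˡ _))) (K.*-identityʳ t′))))

    to-chord : ∀ l → ∃[ g ] InG g × mapsLine g l₀ l → ImaginaryChord l
    to-chord l (g , g∈G , maps) =
      let (a , b , c , d , det≉0 , g∼) = InG⇒cubicMatrix 5≤q g g∈G
          (t′ , t′∈l , möbius) = image-on-line irr {a} {b} {c} {d} det≉0 g g∼ l₀ l maps t∈l₀
      in imaginaryChord l t′ (Möbius-irrational irr {a} {b} {c} {d} det≉0 möbius) t′∈l

  -- For q = 1 + 2 k the relation q · 1# = 0 would read 1# = 0.
  2·1≈0⇒2∣q : 1# + 1# ≈ 0# → 2 ∣ q
  2·1≈0⇒2∣q 2≈0 with even-or-odd q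
  ... | inj₁ 2∣q = 2∣q
  ... | inj₂ (k , q≡1+2k) = contradiction (trans (sym (trans (+-congˡ 2k≈0) (+-identityʳ 1#))) (≡.subst (λ n → n · 1# ≈ 0#) q≡1+2k q·1≈0)) 1≉0
    where
    2k≈0 : (k ℕ.* 2) · 1# ≈ 0#
    2k≈0 = Frobenius.multiple≈0 commutativeRing {2} (trans (+-congˡ (+-identityʳ 1#)) 2≈0) (divides k ≡.refl) 1#

  -- x = x ^ q is the square of x ^ (q / 2).
  even⇒square : 2 ∣ q → ∀ x → ∃[ y ] x ≈ y * y
  even⇒square (divides k q≡2k) x = x ^ k , (trans (sym (≡.subst (λ n → x ^ n ≈ x) q≡2k (x^q≈x x)))
    (trans (sym (^-assocʳ x k 2)) (*-congˡ (*-identityʳ _))))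
    where open Algebra.Properties.CommutativeSemiring.Exp commutativeSemiring using (^-assocʳ)

  -- The stabilizer of an imaginary chord

  module _ {S D : Carrier} {t : K.Carrier} (irr : ¬ Rational t) (root : IsRoot S D t) where
    open Basis t irr

    -- K is separable over F.
    root≉conjugate : t K.≉ ι S K.- t
    root≉conjugate t≈S-t = [ (λ t≈e → irr (e , K.sym t≈e)) , (λ t≈-e → irr (- e , K.trans (-‿homo e) (K.sym t≈-e))) ]′
      (K.square-roots {t} {ι e} (begin
        t K.* t                        ≈⟨ root ⟩
        ι S K.* t K.+ ι D              ≈⟨ K.+-congʳ (K.trans (K.*-congʳ (K.trans S≈2t (K.trans (K.*-congʳ ι2≈0) (K.zeroˡ t)))) (K.zeroˡ t)) ⟩
        K.0# K.+ ι D                   ≈⟨ K.+-identityˡ _ ⟩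
        ι D                            ≈⟨ K.trans (ι-cong D≈e²) (*-homo e e) ⟩
        ι e K.* ι e                    ∎))
      where
      -- As t is irrational, S = 2 t is possible only if 2 = 0 in F. Then S = 0 as well, and t² = D
      -- is the square of a rational element, which makes t rational.
      S≈2t : ι S K.≈ ι (1# + 1#) K.* t
      S≈2t = begin
        ι S                            ≈⟨ K.solve 2 (λ s t → s K.:= (s K.:- t) K.:+ t) K.refl (ι S) t ⟩
        (ι S K.- t) K.+ t              ≈⟨ K.+-congʳ t≈S-t ⟨
        t K.+ t                        ≈⟨ K.solve 1 (λ t → t K.:+ t K.:= (K.con (ℤ.+ 1) K.:+ K.con (ℤ.+ 1)) K.:* t) K.refl t ⟩
        (K.1# K.+ K.1#) K.* t          ≈⟨ K.*-congʳ (K.trans (+-homo 1# 1#) (K.+-cong 1#-homo 1#-homo)) ⟨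
        ι (1# + 1#) K.* t              ∎
      2≈0 : 1# + 1# ≈ 0#
      2≈0 = ι≈ι*t⇒≈0 S≈2t
      ι2≈0 : ι (1# + 1#) K.≈ K.0#
      ι2≈0 = K.trans (ι-cong 2≈0) 0#-homo
      e : Carrier
      e = proj₁ (even⇒square (2·1≈0⇒2∣q 2≈0) D)
      D≈e² : D ≈ e * e
      D≈e² = proj₂ (even⇒square (2·1≈0⇒2∣q 2≈0) D)

    conjugate : Fin 2 → K.Carrier
    conjugate 0F = t
    conjugate 1F = ι S K.- t

    conjugate-isRoot : ∀ ε → IsRoot S D (conjugate ε)
    conjugate-isRoot 0F = root
    conjugate-isRoot 1F = begin
      (ι S K.- t) K.* (ι S K.- t)
        ≈⟨ K.solve 2 (λ s t → (s K.:- t) K.:* (s K.:- t) K.:= t K.:* t K.:+ (s K.:* s K.:- s K.:* t K.:- s K.:* t)) K.refl (ι S) t ⟩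
      t K.* t K.+ (ι S K.* ι S K.- ι S K.* t K.- ι S K.* t)
        ≈⟨ K.+-congʳ root ⟩
      ι S K.* t K.+ ι D K.+ (ι S K.* ι S K.- ι S K.* t K.- ι S K.* t)
        ≈⟨ K.solve 3 (λ s d t → s K.:* t K.:+ d K.:+ (s K.:* s K.:- s K.:* t K.:- s K.:* t) K.:= s K.:* (s K.:- t) K.:+ d) K.refl (ι S) (ι D) t ⟩
      ι S K.* (ι S K.- t) K.+ ι D ∎

    conjugate-irrational : ∀ ε → ¬ Rational (conjugate ε)
    conjugate-irrational 0F = irr
    conjugate-irrational 1F (x , ιx≈) = irr (S - x , K.trans (ι-sub S x) (K.trans (K.+-congˡ (K.-‿cong ιx≈))
      (K.solve 2 (λ s t → s K.:- (s K.:- t) K.:= t) K.refl (ι S) t)))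

    conjugate-injective : ∀ {ε ε′} → conjugate ε K.≈ conjugate ε′ → ε ≡ ε′
    conjugate-injective {0F} {0F} _ = ≡.refl
    conjugate-injective {0F} {1F} eq = contradiction eq root≉conjugate
    conjugate-injective {1F} {0F} eq = contradiction (K.sym eq) root≉conjugate
    conjugate-injective {1F} {1F} _ = ≡.refl

    -- The a and b for which (a t + b) / (c t + d) is the given conjugate of t.
    numeratorA numeratorB : Fin 2 → (c d : Carrier) → Carrier
    numeratorA 0F c d = c * S + d
    numeratorA 1F c d = - d
    numeratorB 0F c d = c * D
    numeratorB 1F c d = S * d - c * D

    numerator-möbius : ∀ ε c d → Möbius (numeratorA ε c d) (numeratorB ε c d) c d t (conjugate ε)
    numerator-möbius 0F c d = begin
      ι (c * S + d) K.* t K.+ ι (c * D)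
        ≈⟨ K.+-cong (K.*-congʳ (K.trans (+-homo _ _) (K.+-congʳ (*-homo c S)))) (*-homo c D) ⟩
      (ι c K.* ι S K.+ ι d) K.* t K.+ ι c K.* ι D
        ≈⟨ K.solve 5 (λ c d s e t → (c K.:* s K.:+ d) K.:* t K.:+ c K.:* e K.:= c K.:* (s K.:* t K.:+ e) K.:+ d K.:* t) K.refl (ι c) (ι d) (ι S) (ι D) t ⟩
      ι c K.* (ι S K.* t K.+ ι D) K.+ ι d K.* t
        ≈⟨ K.+-congʳ (K.*-congˡ root) ⟨
      ι c K.* (t K.* t) K.+ ι d K.* t
        ≈⟨ K.solve 3 (λ c d t → c K.:* (t K.:* t) K.:+ d K.:* t K.:= t K.:* (c K.:* t K.:+ d)) K.refl (ι c) (ι d) t ⟩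
      t K.* (ι c K.* t K.+ ι d) ∎
    numerator-möbius 1F c d = begin
      ι (- d) K.* t K.+ ι (S * d - c * D)
        ≈⟨ K.+-cong (K.*-congʳ (-‿homo d)) (K.trans (ι-sub _ _) (K.+-cong (*-homo S d) (K.-‿cong (*-homo c D)))) ⟩
      (K.- ι d) K.* t K.+ (ι S K.* ι d K.- ι c K.* ι D)
        ≈⟨ K.solve 5 (λ c d s e t → (K.:- d) K.:* t K.:+ (s K.:* d K.:- c K.:* e)
                        K.:= s K.:* (c K.:* t K.:+ d) K.:- (c K.:* (s K.:* t K.:+ e) K.:+ d K.:* t)) K.refl (ι c) (ι d) (ι S) (ι D) t ⟩
      ι S K.* (ι c K.* t K.+ ι d) K.- (ι c K.* (ι S K.* t K.+ ι D) K.+ ι d K.* t)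
        ≈⟨ K.+-congˡ (K.-‿cong (K.+-congʳ (K.*-congˡ root))) ⟨
      ι S K.* (ι c K.* t K.+ ι d) K.- (ι c K.* (t K.* t) K.+ ι d K.* t)
        ≈⟨ K.solve 4 (λ c d s t → s K.:* (c K.:* t K.:+ d) K.:- (c K.:* (t K.:* t) K.:+ d K.:* t) K.:= (s K.:- t) K.:* (c K.:* t K.:+ d)) K.refl (ι c) (ι d) (ι S) t ⟩
      (ι S K.- t) K.* (ι c K.* t K.+ ι d) ∎

    -- The norm of c t + d, that is (c t + d) (c (S - t) + d). It is the determinant of the
    -- stabilizing 2 × 2 matrix for the conjugate t and its negative for S - t.
    norm : (c d : Carrier) → Carrier
    norm c d = (c * S + d) * d - c * D * c

    norm≉0 : ∀ {c d} → ¬ (c ≈ 0# × d ≈ 0#) → norm c d ≉ 0#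
    norm≉0 {c} {d} cd≉0 N≈0 = cd≉0 ([ combination≈0 irr , second ]′ (K.zero-product _ _ (begin
      (ι c K.* t K.+ ι d) K.* (ι (- c) K.* t K.+ ι (c * S + d))
        ≈⟨ K.*-congˡ (K.+-cong (K.*-congʳ (-‿homo c)) (ι-S c d)) ⟩
      (ι c K.* t K.+ ι d) K.* ((K.- ι c) K.* t K.+ (ι c K.* ι S K.+ ι d))
        ≈⟨ K.solve 4 (λ c d s t → (c K.:* t K.:+ d) K.:* ((K.:- c) K.:* t K.:+ (c K.:* s K.:+ d))
                        K.:= (c K.:* s K.:+ d) K.:* d K.:+ c K.:* c K.:* (s K.:* t K.:- t K.:* t)) K.refl (ι c) (ι d) (ι S) t ⟩
      (ι c K.* ι S K.+ ι d) K.* ι d K.+ ι c K.* ι c K.* (ι S K.* t K.- t K.* t)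
        ≈⟨ K.+-congˡ (K.*-congˡ (K.+-congˡ (K.-‿cong root))) ⟩
      (ι c K.* ι S K.+ ι d) K.* ι d K.+ ι c K.* ι c K.* (ι S K.* t K.- (ι S K.* t K.+ ι D))
        ≈⟨ K.solve 5 (λ c d s e t → (c K.:* s K.:+ d) K.:* d K.:+ c K.:* c K.:* (s K.:* t K.:- (s K.:* t K.:+ e))
                        K.:= (c K.:* s K.:+ d) K.:* d K.:- c K.:* e K.:* c) K.refl (ι c) (ι d) (ι S) (ι D) t ⟩
      (ι c K.* ι S K.+ ι d) K.* ι d K.- ι c K.* ι D K.* ι c
        ≈⟨ K.+-cong (K.*-congʳ (ι-S c d)) (K.-‿cong (K.*-congʳ (*-homo c D))) ⟨
      ι (c * S + d) K.* ι d K.- ι (c * D) K.* ι c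
        ≈⟨ K.+-cong (*-homo _ _) (K.-‿cong (*-homo _ _)) ⟨
      ι ((c * S + d) * d) K.- ι (c * D * c)
        ≈⟨ ι-sub _ _ ⟨
      ι (norm c d)
        ≈⟨ K.trans (ι-cong N≈0) 0#-homo ⟩
      K.0# ∎)))
      where
      ι-S : ∀ c d → ι (c * S + d) K.≈ ι c K.* ι S K.+ ι d
      ι-S c d = K.trans (+-homo _ _) (K.+-congʳ (*-homo c S))
      second : ι (- c) K.* t K.+ ι (c * S + d) K.≈ K.0# → c ≈ 0# × d ≈ 0#
      second eq = c≈0 , trans (sym (trans (+-congʳ (trans (*-congʳ c≈0) (zeroˡ S))) (+-identityˡ d))) (proj₂ (combination≈0 irr eq))
        where
        c≈0 : c ≈ 0#
        c≈0 = trans (solve 1 (λ c → c := :- (:- c)) refl c) (trans (-‿cong (proj₁ (combination≈0 irr eq))) (solve 0 (:- con (ℤ.+ 0) := con (ℤ.+ 0)) refl))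

    numerator-det≉0 : ∀ ε {c d} → ¬ (c ≈ 0# × d ≈ 0#) → det (numeratorA ε c d) (numeratorB ε c d) c d ≉ 0#
    numerator-det≉0 0F cd≉0 = norm≉0 cd≉0
    numerator-det≉0 1F {c} {d} cd≉0 eq = norm≉0 cd≉0 (trans
      (solve 4 (λ c d s e → (c :* s :+ d) :* d :- c :* e :* c := :- ((:- d) :* d :- (s :* d :- c :* e) :* c)) refl c d S D)
      (trans (-‿cong eq) (solve 0 (:- con (ℤ.+ 0) := con (ℤ.+ 0)) refl)))

    stabilizingMatrix : Fin 2 → (c d : Carrier) → Matrix
    stabilizingMatrix ε c d = cubicMatrix (numeratorA ε c d) (numeratorB ε c d) c d

    numerators-scale : ∀ ε {c d c′ d′} m → c ≈ m * c′ → d ≈ m * d′ →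
      numeratorA ε c d ≈ m * numeratorA ε c′ d′ × numeratorB ε c d ≈ m * numeratorB ε c′ d′
    numerators-scale 0F {c} {d} {c′} {d′} m c≈ d≈ =
      trans (+-cong (*-congʳ c≈) d≈) (solve 4 (λ m c d s → m :* c :* s :+ m :* d := m :* (c :* s :+ d)) refl m c′ d′ S) ,
      trans (*-congʳ c≈) (*-assoc m c′ D)
    numerators-scale 1F {c} {d} {c′} {d′} m c≈ d≈ =
      trans (-‿cong d≈) (solve 2 (λ m d → :- (m :* d) := m :* (:- d)) refl m d′) ,
      trans (+-cong (*-congˡ d≈) (-‿cong (*-congʳ c≈)))
        (solve 5 (λ m c d s e → s :* (m :* d) :- m :* c :* e := m :* (s :* d :- c :* e)) refl m c′ d′ S D)

    stabilizingMatrix-scale : ∀ ε {c d c′ d′} m → m ≉ 0# → c ≈ m * c′ → d ≈ m * d′ →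
      stabilizingMatrix ε c d ∼ stabilizingMatrix ε c′ d′
    stabilizingMatrix-scale ε {c′ = c′} {d′} m m≉0 c≈ d≈ = m * m * m , *-≉0 (*-≉0 m≉0 m≉0) m≉0 , λ i j →
      trans (cubicMatrix-cong (proj₁ (numerators-scale ε m c≈ d≈)) (proj₂ (numerators-scale ε m c≈ d≈)) c≈ d≈ i j)
            (cubicMatrix-scale m (numeratorA ε c′ d′) (numeratorB ε c′ d′) c′ d′ i j)

    module _ (l : Line) (t∈l : OnExtension l t) where

      stabilizing : ∀ ε c d → ¬ (c ≈ 0# × d ≈ 0#) → Σ[ g ∈ Projectivity ] InG g × Fixes g l
      stabilizing ε c d cd≉0 =
        cubicProjectivity a b c d (numerator-det≉0 ε cd≉0) ,
        cubicProjectivity∈G a b c d (numerator-det≉0 ε cd≉0) ,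
        mapsChord {a} {b} {c} {d} (numerator-det≉0 ε cd≉0) l l irr (conjugate-irrational ε) t∈l
          (ChordLine.IsRoot⇒CubicPointOn irr root {coords (p₁ l)} {coords (p₂ l)} t∈l (conjugate-isRoot ε))
          (numerator-möbius ε c d)
        where
        a b : Carrier
        a = numeratorA ε c d
        b = numeratorB ε c d

      stabilizer-form : ∀ g → InG g → Fixes g l →
        ∃[ ε ] ∃[ c ] ∃[ d ] ¬ (c ≈ 0# × d ≈ 0#) × matrix g ∼ stabilizingMatrix ε c d
      stabilizer-form g g∈G fixes = form (InG⇒cubicMatrix 5≤q g g∈G)
        where
        form : (∃[ a ] ∃[ b ] ∃[ c ] ∃[ d ] det a b c d ≉ 0# × matrix g ∼ cubicMatrix a b c d) →
               ∃[ ε ] ∃[ c ] ∃[ d ] ¬ (c ≈ 0# × d ≈ 0#) × matrix g ∼ stabilizingMatrix ε c d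
        form (a , b , c , d , det≉0 , k , k≉0 , g≈) =
          ε , c , d , (λ cd≈0 → det≉0 (det≈0 irr {a} {b} cd≈0)) , k , k≉0 ,
          λ i j → trans (g≈ i j) (*-congˡ (cubicMatrix-cong (proj₂ numerators) (proj₁ numerators) refl refl i j))
          where
          image : ∃[ t′ ] OnExtension l t′ × Möbius a b c d t t′
          image = image-on-line irr {a} {b} {c} {d} det≉0 g (k , k≉0 , g≈) l l fixes t∈l
          t′ : K.Carrier
          t′ = proj₁ image
          which : ∃[ ε ] t′ K.≈ conjugate ε
          which = [ (λ eq → 0F , eq) , (λ eq → 1F , eq) ]′
            (roots root (ChordLine.CubicPointOn⇒IsRoot irr root {coords (p₁ l)} {coords (p₂ l)} t∈l (proj₁ (proj₂ image))))
          ε : Fin 2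
          ε = proj₁ which
          numerators : b ≈ numeratorB ε c d × a ≈ numeratorA ε c d
          numerators = coordinates-unique (begin
            ι b K.+ ι a K.* t                                      ≈⟨ K.+-comm _ _ ⟩
            ι a K.* t K.+ ι b                                      ≈⟨ proj₂ (proj₂ image) ⟩
            t′ K.* (ι c K.* t K.+ ι d)                             ≈⟨ K.*-congʳ (proj₂ which) ⟩
            conjugate ε K.* (ι c K.* t K.+ ι d)                    ≈⟨ numerator-möbius ε c d ⟨
            ι (numeratorA ε c d) K.* t K.+ ι (numeratorB ε c d)    ≈⟨ K.+-comm _ _ ⟩
            ι (numeratorB ε c d) K.+ ι (numeratorA ε c d) K.* t    ∎)

    -- Proportional matrices send P(t) to proportional vectors, which are multiples of P at the two
    -- conjugates. The last coordinate identifies the factors, and the third one then the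
    -- conjugates.
    stabilizingMatrix-conjugate : ∀ {ε ε′ c d c′ d′} → ¬ (c ≈ 0# × d ≈ 0#) →
      stabilizingMatrix ε c d ∼ stabilizingMatrix ε′ c′ d′ → ε ≡ ε′
    stabilizingMatrix-conjugate {ε} {ε′} {c} {d} {c′} {d′} cd≉0 (k , k≉0 , M≈kM′) =
      conjugate-injective (K.*-cancelˡ w³≉0 (begin
        w³ K.* conjugate ε                    ≈⟨ images 2F ⟩
        ι k K.* w′³ K.* conjugate ε′          ≈⟨ K.*-congʳ (K.trans (K.sym (K.*-identityʳ _)) (K.trans (K.sym (images 3F)) (K.*-identityʳ _))) ⟩
        w³ K.* conjugate ε′                   ∎))
      where
      w w³ w′ w′³ : K.Carrier
      w = ι c K.* t K.+ ι d
      w³ = w K.* w K.* w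
      w′ = ι c′ K.* t K.+ ι d′
      w′³ = w′ K.* w′ K.* w′
      w≉0 : w K.≉ K.0#
      w≉0 eq = cd≉0 (combination≈0 irr eq)
      w³≉0 : w³ K.≉ K.0#
      w³≉0 = K.*-≉0 (K.*-≉0 w≉0 w≉0) w≉0
      ιM : Fin 2 → (c d : Carrier) → K.Matrix
      ιM ε c d i = ι ∘ stabilizingMatrix ε c d i
      images : ∀ j → w³ K.* K.cubicCoords (conjugate ε) j K.≈ ι k K.* w′³ K.* K.cubicCoords (conjugate ε′) j
      images j = begin
        w³ K.* K.cubicCoords (conjugate ε) j
          ≈⟨ cubicCoords-*ᵥ {numeratorA ε c d} {numeratorB ε c d} {c} {d} (numerator-möbius ε c d) j ⟨
        (K.cubicCoords t K.*ᵥ ιM ε c d) j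
          ≈⟨ K.*ᵥ-congˡ (K.cubicCoords t) (λ i j → K.trans (ι-cong (M≈kM′ i j)) (*-homo _ _)) j ⟩
        (K.cubicCoords t K.*ᵥ (λ i j → ι k K.* ιM ε′ c′ d′ i j)) j
          ≈⟨ K.*ᵥ-scaleˡ (ι k) (K.cubicCoords t) (ιM ε′ c′ d′) j ⟩
        ι k K.* (K.cubicCoords t K.*ᵥ ιM ε′ c′ d′) j
          ≈⟨ K.*-congˡ (cubicCoords-*ᵥ {numeratorA ε′ c′ d′} {numeratorB ε′ c′ d′} {c′} {d′} (numerator-möbius ε′ c′ d′) j) ⟩
        ι k K.* (w′³ K.* K.cubicCoords (conjugate ε′) j)
          ≈⟨ K.*-assoc _ _ _ ⟨
        ι k K.* w′³ K.* K.cubicCoords (conjugate ε′) j ∎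

    -- Row 0 is `veronese a c`, which determines the ratio of a and c. As a is c S + d or - d, this
    -- determines the ratio of c and d.
    stabilizingMatrix-ratio : ∀ ε {c d c′ d′} → stabilizingMatrix ε c d ∼ stabilizingMatrix ε c′ d′ → c * d′ ≈ c′ * d
    stabilizingMatrix-ratio ε {c} {d} {c′} {d′} (k , k≉0 , M≈kM′) = ratio ε row
      where
      a a′ : Carrier
      a = numeratorA ε c d
      a′ = numeratorA ε c′ d′
      row : c * a′ ≈ c′ * a
      row with a ≟ 0#
      ... | no a≉0 = *-cancelˡ (*-≉0 a≉0 a≉0) (trans (trans (sym (*-assoc (a * a) c a′)) (*-congʳ (M≈kM′ 0F 1F)))
              (trans (solve 3 (λ k a c → k :* (a :* a :* c) :* a := c :* (k :* (a :* a :* a))) refl k a′ c′)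
              (trans (*-congˡ (sym (M≈kM′ 0F 0F))) (solve 2 (λ a c → c :* (a :* a :* a) := a :* a :* (c :* a)) refl a c′))))
      ... | yes a≈0 = trans (trans (*-congˡ a′≈0) (zeroʳ c)) (sym (trans (*-congˡ a≈0) (zeroʳ c′)))
        where
        a′≈0 : a′ ≈ 0#
        a′≈0 with a′ ≟ 0#
        ... | yes eq = eq
        ... | no a′≉0 = contradiction (trans (sym (M≈kM′ 0F 0F)) (trans (*-congˡ a≈0) (zeroʳ _))) (*-≉0 k≉0 (*-≉0 (*-≉0 a′≉0 a′≉0) a′≉0))
      ratio : ∀ ε → c * numeratorA ε c′ d′ ≈ c′ * numeratorA ε c d → c * d′ ≈ c′ * d
      ratio 0F eq = trans (solve 4 (λ c c′ d′ s → c :* d′ := c :* (c′ :* s :+ d′) :- c :* c′ :* s) refl c c′ d′ S)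
                   (trans (+-congʳ eq) (solve 4 (λ c c′ d s → c′ :* (c :* s :+ d) :- c :* c′ :* s := c′ :* d) refl c c′ d S))
      ratio 1F eq = trans (solve 2 (λ c d → c :* d := :- (c :* (:- d))) refl c d′) (trans (-‿cong eq) (solve 2 (λ c d → :- (c :* (:- d)) := c :* d) refl c′ d))

    -- Normalised representatives (c , d) of the points of the projective line over F.
    representative : Fin q ⊎ Fin 1 → Carrier × Carrier
    representative (inj₁ i) = 1# , element i
    representative (inj₂ _) = 0# , 1#

    representative≉0 : ∀ s → ¬ (proj₁ (representative s) ≈ 0# × proj₂ (representative s) ≈ 0#)
    representative≉0 (inj₁ i) (1≈0 , _) = 1≉0 1≈0
    representative≉0 (inj₂ _) (_ , 1≈0) = 1≉0 1≈0

    representative-injective : ∀ s s′ →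
      proj₁ (representative s) * proj₂ (representative s′) ≈ proj₁ (representative s′) * proj₂ (representative s) → s ≡ s′
    representative-injective (inj₁ i) (inj₁ j) eq =
      ≡.cong inj₁ (Bijection.injective size (sym (trans (sym (*-identityˡ _)) (trans eq (*-identityˡ _)))))
    representative-injective (inj₁ i) (inj₂ _) eq = contradiction (trans (sym (*-identityˡ 1#)) (trans eq (zeroˡ _))) 1≉0
    representative-injective (inj₂ _) (inj₁ j) eq = contradiction (trans (sym (*-identityˡ 1#)) (trans (sym eq) (zeroˡ _))) 1≉0
    representative-injective (inj₂ 0F) (inj₂ 0F) eq = ≡.refl

    normalise : ∀ c d → ¬ (c ≈ 0# × d ≈ 0#) →
      ∃[ s ] ∃[ m ] m ≉ 0# × c ≈ m * proj₁ (representative s) × d ≈ m * proj₂ (representative s)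
    normalise c d cd≉0 with c ≟ 0#
    ... | no c≉0 = inj₁ (index (c ⁻¹⟨ c≉0 ⟩ * d)) , c , c≉0 , sym (*-identityʳ c) ,
          sym (trans (*-congˡ (element-index _)) (trans (sym (*-assoc _ _ _)) (trans (*-congʳ (trans (*-comm _ _) (⁻¹-inverseˡ c c≉0))) (*-identityˡ d))))
    ... | yes c≈0 = inj₂ 0F , d , (λ d≈0 → cd≉0 (c≈0 , d≈0)) , trans c≈0 (sym (zeroʳ d)) , sym (*-identityʳ d)

    module _ (l : Line) (t∈l : OnExtension l t) where
      private
        decode : Fin (2 ℕ.* (q ℕ.+ 1)) → Fin 2 × (Fin q ⊎ Fin 1)
        decode i = let (ε , j) = Fin.remQuot (q ℕ.+ 1) i in ε , Fin.splitAt q j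

        encode : Fin 2 × (Fin q ⊎ Fin 1) → Fin (2 ℕ.* (q ℕ.+ 1))
        encode (ε , s) = Fin.combine ε (Fin.join q 1 s)

        decode-injective : ∀ {i j} → decode i ≡ decode j → i ≡ j
        decode-injective {i} {j} eq = ≡.trans (≡.sym (encode-decode i)) (≡.trans (≡.cong encode eq) (encode-decode j))
          where
          encode-decode : ∀ i → encode (decode i) ≡ i
          encode-decode i = ≡.trans
            (≡.cong (Fin.combine (proj₁ (Fin.remQuot {2} (q ℕ.+ 1) i))) (Fin.join-splitAt q 1 (proj₂ (Fin.remQuot {2} (q ℕ.+ 1) i))))
            (Fin.combine-remQuot {2} (q ℕ.+ 1) i)

        decode-encode : ∀ x → decode (encode x) ≡ x
        decode-encode (ε , s) = ≡.cong₂ _,_ (≡.cong proj₁ eq) (≡.trans (≡.cong (Fin.splitAt q ∘ proj₂) eq) (Fin.splitAt-join q 1 s))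
          where
          eq : Fin.remQuot (q ℕ.+ 1) (Fin.combine ε (Fin.join q 1 s)) ≡ (ε , Fin.join q 1 s)
          eq = Fin.remQuot-combine ε (Fin.join q 1 s)

        at : Fin 2 × (Fin q ⊎ Fin 1) → Σ[ g ∈ Projectivity ] InG g × Fixes g l
        at (ε , s) = stabilizing l t∈l ε (proj₁ (representative s)) (proj₂ (representative s)) (representative≉0 s)

        at-injective : ∀ x y → matrix (proj₁ (at x)) ∼ matrix (proj₁ (at y)) → x ≡ y
        at-injective (ε , s) (ε′ , s′) eq = same-conjugate (stabilizingMatrix-conjugate {ε} {ε′} (representative≉0 s) eq) eq
          where
          same-conjugate : ε ≡ ε′ → matrix (proj₁ (at (ε , s))) ∼ matrix (proj₁ (at (ε′ , s′))) → (ε , s) ≡ (ε′ , s′)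
          same-conjugate ≡.refl eq = ≡.cong (ε ,_) (representative-injective s s′ (stabilizingMatrix-ratio ε eq))

        at-surjective : ∀ g → InG g → Fixes g l → ∃[ x ] matrix (proj₁ (at x)) ∼ matrix g
        at-surjective g g∈G fixes = preimage (stabilizer-form l t∈l g g∈G fixes)
          where
          preimage : (∃[ ε ] ∃[ c ] ∃[ d ] ¬ (c ≈ 0# × d ≈ 0#) × matrix g ∼ stabilizingMatrix ε c d) →
                     ∃[ x ] matrix (proj₁ (at x)) ∼ matrix g
          preimage (ε , c , d , cd≉0 , g∼) = (ε , s) ,
            Setoid.sym projectivities {g} {proj₁ (at (ε , s))}
              (Setoid.trans projectivities {g} {proj₁ (stabilizing l t∈l ε c d cd≉0)} {proj₁ (at (ε , s))} g∼
                (stabilizingMatrix-scale ε m m≉0 c≈ d≈))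
            where
            s : Fin q ⊎ Fin 1
            s = proj₁ (normalise c d cd≉0)
            m : Carrier
            m = proj₁ (proj₂ (normalise c d cd≉0))
            m≉0 : m ≉ 0#
            m≉0 = proj₁ (proj₂ (proj₂ (normalise c d cd≉0)))
            c≈ : c ≈ m * proj₁ (representative s)
            c≈ = proj₁ (proj₂ (proj₂ (proj₂ (normalise c d cd≉0))))
            d≈ : d ≈ m * proj₂ (representative s)
            d≈ = proj₂ (proj₂ (proj₂ (proj₂ (normalise c d cd≉0))))

      stabilizer-size : HasSize (stabilizer l) (2 ℕ.* (q ℕ.+ 1))
      stabilizer-size = hasSize (stabilizer l) (λ i → at (decode i))
        (λ {i} {j} eq → decode-injective (at-injective (decode i) (decode j) eq))
        (λ (g , g∈G , fixes) → reindex g (at-surjective g g∈G fixes))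
        where
        reindex : ∀ g → (∃[ x ] matrix (proj₁ (at x)) ∼ matrix g) → ∃[ i ] matrix (proj₁ (at (decode i))) ∼ matrix g
        reindex g (x , eq) = encode x , ≡.subst (λ y → matrix (proj₁ (at y)) ∼ matrix g) (≡.sym (decode-encode x)) eq

  -- The matrices Ψ₁ and Ψ₂ as cubic matrices

  -- The row factors are written α, 1, α, 1 instead of α³, α², α, 1: this keeps α² = 1 out of the
  -- polynomial identities, which hold for every α.
  Ψ₁-rows : ∀ ρ α b d i j → Ψ₁ ρ α b d i j ≈ (α ∷ 1# ∷ α ∷ 1# ∷ []) i * cubicMatrix d b (ρ * b) d i j
  Ψ₁-rows ρ α b d 0F 0F = solve 4 (λ ρ α b d → α :* d :^ 3 := α :* :cubicMatrix d b (ρ :* b) d 0F 0F) refl ρ α b d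
  Ψ₁-rows ρ α b d 0F 1F = solve 4 (λ ρ α b d → α :* ρ :* b :* d :^ 2 := α :* :cubicMatrix d b (ρ :* b) d 0F 1F) refl ρ α b d
  Ψ₁-rows ρ α b d 0F 2F = solve 4 (λ ρ α b d → α :* ρ :^ 2 :* b :^ 2 :* d := α :* :cubicMatrix d b (ρ :* b) d 0F 2F) refl ρ α b d
  Ψ₁-rows ρ α b d 0F 3F = solve 4 (λ ρ α b d → α :* ρ :^ 3 :* b :^ 3 := α :* :cubicMatrix d b (ρ :* b) d 0F 3F) refl ρ α b d
  Ψ₁-rows ρ α b d 1F 0F = solve 4 (λ ρ α b d → 3 :× b :* d :^ 2 := con (ℤ.+ 1) :* :cubicMatrix d b (ρ :* b) d 1F 0F) refl ρ α b d
  Ψ₁-rows ρ α b d 1F 1F = solve 4 (λ ρ α b d → d :^ 3 :+ 2 :× ρ :* b :^ 2 :* d := con (ℤ.+ 1) :* :cubicMatrix d b (ρ :* b) d 1F 1F) refl ρ α b d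
  Ψ₁-rows ρ α b d 1F 2F = solve 4 (λ ρ α b d → ρ :^ 2 :* b :^ 3 :+ 2 :× ρ :* b :* d :^ 2 := con (ℤ.+ 1) :* :cubicMatrix d b (ρ :* b) d 1F 2F) refl ρ α b d
  Ψ₁-rows ρ α b d 1F 3F = solve 4 (λ ρ α b d → 3 :× ρ :^ 2 :* b :^ 2 :* d := con (ℤ.+ 1) :* :cubicMatrix d b (ρ :* b) d 1F 3F) refl ρ α b d
  Ψ₁-rows ρ α b d 2F 0F = solve 4 (λ ρ α b d → 3 :× α :* b :^ 2 :* d := α :* :cubicMatrix d b (ρ :* b) d 2F 0F) refl ρ α b d
  Ψ₁-rows ρ α b d 2F 1F = solve 4 (λ ρ α b d → α :* ρ :* b :^ 3 :+ 2 :× α :* b :* d :^ 2 := α :* :cubicMatrix d b (ρ :* b) d 2F 1F) refl ρ α b d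
  Ψ₁-rows ρ α b d 2F 2F = solve 4 (λ ρ α b d → α :* d :^ 3 :+ 2 :× α :* ρ :* b :^ 2 :* d := α :* :cubicMatrix d b (ρ :* b) d 2F 2F) refl ρ α b d
  Ψ₁-rows ρ α b d 2F 3F = solve 4 (λ ρ α b d → 3 :× α :* ρ :* b :* d :^ 2 := α :* :cubicMatrix d b (ρ :* b) d 2F 3F) refl ρ α b d
  Ψ₁-rows ρ α b d 3F 0F = solve 4 (λ ρ α b d → b :^ 3 := con (ℤ.+ 1) :* :cubicMatrix d b (ρ :* b) d 3F 0F) refl ρ α b d
  Ψ₁-rows ρ α b d 3F 1F = solve 4 (λ ρ α b d → b :^ 2 :* d := con (ℤ.+ 1) :* :cubicMatrix d b (ρ :* b) d 3F 1F) refl ρ α b d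
  Ψ₁-rows ρ α b d 3F 2F = solve 4 (λ ρ α b d → b :* d :^ 2 := con (ℤ.+ 1) :* :cubicMatrix d b (ρ :* b) d 3F 2F) refl ρ α b d
  Ψ₁-rows ρ α b d 3F 3F = solve 4 (λ ρ α b d → d :^ 3 := con (ℤ.+ 1) :* :cubicMatrix d b (ρ :* b) d 3F 3F) refl ρ α b d

  private
    -- For use after the solver, which does not know that 2 = 0: the identity is proved with its
    -- even part written out, and that part is then discarded.
    drop-2 : ∀ {x y z} → 1# + 1# ≈ 0# → x ≈ y + (1# + 1#) * z → x ≈ y
    drop-2 2≈0 x≈ = trans x≈ (trans (+-congˡ (trans (*-congʳ 2≈0) (zeroˡ _))) (+-identityʳ _))

  cubicMatrix-char2 : ∀ a b c d → 1# + 1# ≈ 0# → ∀ i j → cubicMatrix a b c d i j ≈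
    ((a ^ 3     ∷ c * a ^ 2 ∷ c ^ 2 * a ∷ c ^ 3     ∷ []) ∷
     (a ^ 2 * b ∷ d * a ^ 2 ∷ c ^ 2 * b ∷ c ^ 2 * d ∷ []) ∷
     (a * b ^ 2 ∷ c * b ^ 2 ∷ a * d ^ 2 ∷ c * d ^ 2 ∷ []) ∷
     (b ^ 3     ∷ d * b ^ 2 ∷ d ^ 2 * b ∷ d ^ 3     ∷ []) ∷ []) i j
  cubicMatrix-char2 a b c d 2≈0 0F 0F = solve 4 (λ a b c d → :cubicMatrix a b c d 0F 0F := a :^ 3) refl a b c d
  cubicMatrix-char2 a b c d 2≈0 0F 1F = solve 4 (λ a b c d → :cubicMatrix a b c d 0F 1F := c :* a :^ 2) refl a b c d
  cubicMatrix-char2 a b c d 2≈0 0F 2F = solve 4 (λ a b c d → :cubicMatrix a b c d 0F 2F := c :^ 2 :* a) refl a b c d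
  cubicMatrix-char2 a b c d 2≈0 0F 3F = solve 4 (λ a b c d → :cubicMatrix a b c d 0F 3F := c :^ 3) refl a b c d
  cubicMatrix-char2 a b c d 2≈0 1F 0F = drop-2 2≈0 (solve 4 (λ a b c d → :cubicMatrix a b c d 1F 0F := a :^ 2 :* b :+ (con (ℤ.+ 1) :+ con (ℤ.+ 1)) :* (a :* a :* b)) refl a b c d)
  cubicMatrix-char2 a b c d 2≈0 1F 1F = drop-2 2≈0 (solve 4 (λ a b c d → :cubicMatrix a b c d 1F 1F := d :* a :^ 2 :+ (con (ℤ.+ 1) :+ con (ℤ.+ 1)) :* (a :* b :* c)) refl a b c d)
  cubicMatrix-char2 a b c d 2≈0 1F 2F = drop-2 2≈0 (solve 4 (λ a b c d → :cubicMatrix a b c d 1F 2F := c :^ 2 :* b :+ (con (ℤ.+ 1) :+ con (ℤ.+ 1)) :* (a :* c :* d)) refl a b c d)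
  cubicMatrix-char2 a b c d 2≈0 1F 3F = drop-2 2≈0 (solve 4 (λ a b c d → :cubicMatrix a b c d 1F 3F := c :^ 2 :* d :+ (con (ℤ.+ 1) :+ con (ℤ.+ 1)) :* (c :* c :* d)) refl a b c d)
  cubicMatrix-char2 a b c d 2≈0 2F 0F = drop-2 2≈0 (solve 4 (λ a b c d → :cubicMatrix a b c d 2F 0F := a :* b :^ 2 :+ (con (ℤ.+ 1) :+ con (ℤ.+ 1)) :* (a :* b :* b)) refl a b c d)
  cubicMatrix-char2 a b c d 2≈0 2F 1F = drop-2 2≈0 (solve 4 (λ a b c d → :cubicMatrix a b c d 2F 1F := c :* b :^ 2 :+ (con (ℤ.+ 1) :+ con (ℤ.+ 1)) :* (a :* b :* d)) refl a b c d)
  cubicMatrix-char2 a b c d 2≈0 2F 2F = drop-2 2≈0 (solve 4 (λ a b c d → :cubicMatrix a b c d 2F 2F := a :* d :^ 2 :+ (con (ℤ.+ 1) :+ con (ℤ.+ 1)) :* (b :* c :* d)) refl a b c d)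
  cubicMatrix-char2 a b c d 2≈0 2F 3F = drop-2 2≈0 (solve 4 (λ a b c d → :cubicMatrix a b c d 2F 3F := c :* d :^ 2 :+ (con (ℤ.+ 1) :+ con (ℤ.+ 1)) :* (c :* d :* d)) refl a b c d)
  cubicMatrix-char2 a b c d 2≈0 3F 0F = solve 4 (λ a b c d → :cubicMatrix a b c d 3F 0F := b :^ 3) refl a b c d
  cubicMatrix-char2 a b c d 2≈0 3F 1F = solve 4 (λ a b c d → :cubicMatrix a b c d 3F 1F := d :* b :^ 2) refl a b c d
  cubicMatrix-char2 a b c d 2≈0 3F 2F = solve 4 (λ a b c d → :cubicMatrix a b c d 3F 2F := d :^ 2 :* b) refl a b c d
  cubicMatrix-char2 a b c d 2≈0 3F 3F = solve 4 (λ a b c d → :cubicMatrix a b c d 3F 3F := d :^ 3) refl a b c d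

  irrational-multiple : ∀ {t s} → ¬ Rational t → s ≉ 0# → ¬ Rational (ι s K.* t)
  irrational-multiple {t} irr s≉0 (x , ιx≈st) = s≉0 (Basis.ι≈ι*t⇒≈0 t irr ιx≈st)

  irrational-translate : ∀ {t x} → ¬ Rational t → ¬ Rational (t K.+ ι x)
  irrational-translate {t} {x} irr (y , ιy≈t+x) = irr (y - x , K.trans (ι-sub y x) (K.trans (K.+-congʳ ιy≈t+x)
    (K.solve 2 (λ t x → t K.:+ x K.:- x K.:= t) K.refl t (ι x))))

  -- Odd q and the line ℓ₁

  module OddOrder (q-odd : ¬ 2 ∣ q) where

    private
      2≉0 : 1# + 1# ≉ 0#
      2≉0 = q-odd ∘ 2·1≈0⇒2∣q

    -- Completing the square.
    irrational-square-root : ∃[ δ ] ∃[ τ ] ¬ Rational τ × τ K.* τ K.≈ ι δ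
    irrational-square-root = D + e * e , t K.+ ι (- e) , irrational-translate irr , (begin
      (t K.+ ι (- e)) K.* (t K.+ ι (- e))
        ≈⟨ K.*-cong (K.+-congˡ (-‿homo e)) (K.+-congˡ (-‿homo e)) ⟩
      (t K.- ι e) K.* (t K.- ι e)
        ≈⟨ K.solve 2 (λ t e → (t K.:- e) K.:* (t K.:- e) K.:= t K.:* t K.:- (e K.:+ e) K.:* t K.:+ e K.:* e) K.refl t (ι e) ⟩
      t K.* t K.- (ι e K.+ ι e) K.* t K.+ ι e K.* ι e
        ≈⟨ K.+-congʳ (K.+-cong root (K.-‿cong (K.*-congʳ (K.trans (K.sym (+-homo e e)) (ι-cong 2e≈S))))) ⟩
      ι S K.* t K.+ ι D K.- ι S K.* t K.+ ι e K.* ι e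
        ≈⟨ K.solve 4 (λ s d t e → s K.:* t K.:+ d K.:- s K.:* t K.:+ e K.:* e K.:= d K.:+ e K.:* e) K.refl (ι S) (ι D) t (ι e) ⟩
      ι D K.+ ι e K.* ι e
        ≈⟨ K.trans (+-homo _ _) (K.+-congˡ (*-homo e e)) ⟨
      ι (D + e * e) ∎)
      where
      t : K.Carrier
      t = proj₁ irrational
      irr : ¬ Rational t
      irr = proj₂ irrational
      S D e : Carrier
      S = proj₁ (minimal-polynomial irr)
      D = proj₁ (proj₂ (minimal-polynomial irr))
      e = (1# + 1#) ⁻¹⟨ 2≉0 ⟩ * S
      root : IsRoot S D t
      root = proj₂ (proj₂ (minimal-polynomial irr))
      2e≈S : e + e ≈ S
      2e≈S = trans (solve 2 (λ h s → h :* s :+ h :* s := h :* (con (ℤ.+ 1) :+ con (ℤ.+ 1)) :* s) refl _ S)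
                   (trans (*-congʳ (⁻¹-inverseˡ (1# + 1#) 2≉0)) (*-identityˡ S))

    nonsquare≉0 : ∀ {ρ} → NonSquare ρ → ρ ≉ 0#
    nonsquare≉0 nonsquare ρ≈0 = nonsquare (0# , trans (zeroˡ _) (sym ρ≈0))

    module _ (ρ : Carrier) (nonsquare : NonSquare ρ) where
      -- The points of `ℓ₁ ρ` are (a , b , a ρ , b ρ). For P(t) this means a = t³, b = t² and t² ρ =
      -- 1, so the parameter has to be a square root of 1 / ρ.
      r : Carrier
      r = ρ ⁻¹⟨ nonsquare≉0 nonsquare ⟩

      r*ρ≈1 : r * ρ ≈ 1#
      r*ρ≈1 = ⁻¹-inverseˡ ρ (nonsquare≉0 nonsquare)

      -- The product of the nonsquares δ and ρ is a square.
      square-root-of-inverse : ∀ {δ τ} → ¬ Rational τ → τ K.* τ K.≈ ι δ → ∃[ t ] ¬ Rational t × IsRoot 0# r t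
      square-root-of-inverse {δ} {τ} τ-irrational τ²≈δ =
        [ (λ (x , x²≈ρ) → contradiction (x , trans (*-congˡ (*-identityʳ x)) x²≈ρ) nonsquare) , scaled ]′
        -- The maps x² and δ x² have the orbits of negation as fibres and share only the value 0, so
        -- together they cover F; since ρ is not a square, it is δ x² for some x.
        (two-to-one-cover -_ (λ x → x * x) (λ x → δ * (x * x)) -‿cong -‿involutive square-roots
          (λ eq → square-roots (*-cancelˡ δ≉0 eq)) disjoint ρ)
        where
        open Algebra.Properties.Ring ring using (-‿involutive; -0#≈0#)
        δ-nonsquare : ∀ e → δ ≉ e * e
        δ-nonsquare e δ≈e² =
          [ (λ τ≈e → τ-irrational (e , K.sym τ≈e)) , (λ τ≈-e → τ-irrational (- e , K.trans (-‿homo e) (K.sym τ≈-e))) ]′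
          (K.square-roots {τ} {ι e} (K.trans τ²≈δ (K.trans (ι-cong δ≈e²) (*-homo e e))))
        δ≉0 : δ ≉ 0#
        δ≉0 δ≈0 = δ-nonsquare 0# (trans δ≈0 (sym (zeroˡ 0#)))
        -- A common value with y nonzero would make δ the square of x / y.
        disjoint : ∀ {x y} → x * x ≈ δ * (y * y) → y ≈ - y
        disjoint {x} {y} eq = [ (λ y≈0 → trans y≈0 (sym (trans (-‿cong y≈0) -0#≈0#))) , (λ y≉0 → contradiction (quotient y≉0) (δ-nonsquare _)) ]′ (toSum (y ≟ 0#))
          where
          quotient : (y≉0 : y ≉ 0#) → δ ≈ y ⁻¹⟨ y≉0 ⟩ * x * (y ⁻¹⟨ y≉0 ⟩ * x)
          quotient y≉0 = *-cancelˡ (*-≉0 y≉0 y≉0) (trans (*-comm _ δ) (trans (sym eq) (sym (trans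
                (solve 3 (λ x y i → y :* y :* (i :* x :* (i :* x)) := i :* y :* x :* (i :* y :* x)) refl x y (y ⁻¹⟨ y≉0 ⟩))
                (*-cong cancel cancel)))))
            where
            cancel : y ⁻¹⟨ y≉0 ⟩ * y * x ≈ x
            cancel = trans (*-congʳ (⁻¹-inverseˡ y y≉0)) (*-identityˡ x)
        scaled : (∃[ x ] δ * (x * x) ≈ ρ) → ∃[ t ] ¬ Rational t × IsRoot 0# r t
        -- The square of r x τ is r² x² δ = r² ρ = r.
        scaled (x , δx²≈ρ) = ι (r * x) K.* τ , irrational-multiple τ-irrational rx≉0 , (begin
          ι (r * x) K.* τ K.* (ι (r * x) K.* τ)
            ≈⟨ K.solve 2 (λ s t → s K.:* t K.:* (s K.:* t) K.:= s K.:* s K.:* (t K.:* t)) K.refl (ι (r * x)) τ ⟩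
          ι (r * x) K.* ι (r * x) K.* (τ K.* τ)
            ≈⟨ K.*-cong (K.sym (*-homo _ _)) τ²≈δ ⟩
          ι (r * x * (r * x)) K.* ι δ
            ≈⟨ *-homo _ _ ⟨
          ι (r * x * (r * x) * δ)
            ≈⟨ ι-cong (trans (solve 3 (λ r x d → r :* x :* (r :* x) :* d := r :* (r :* (d :* (x :* x)))) refl r x δ)
                             (trans (*-congˡ (trans (*-congˡ δx²≈ρ) r*ρ≈1)) (*-identityʳ r))) ⟩
          ι r
            ≈⟨ K.+-identityˡ _ ⟨
          K.0# K.+ ι r
            ≈⟨ K.+-congʳ (K.trans (K.*-congʳ 0#-homo) (K.zeroˡ _)) ⟨
          ι 0# K.* (ι (r * x) K.* τ) K.+ ι r ∎)
          where
          rx≉0 : r * x ≉ 0#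
          rx≉0 = *-≉0 (⁻¹≉0 ρ (nonsquare≉0 nonsquare)) (factor≉0ʳ (factor≉0ʳ (λ eq → nonsquare≉0 nonsquare (trans (sym δx²≈ρ) eq))))

      private
        choice : ∃[ t ] ¬ Rational t × IsRoot 0# r t
        choice = let (_ , _ , irr , τ²≈δ) = irrational-square-root in square-root-of-inverse irr τ²≈δ
        t : K.Carrier
        t = proj₁ choice
        irr : ¬ Rational t
        irr = proj₁ (proj₂ choice)
        root : IsRoot 0# r t
        root = proj₂ (proj₂ choice)

      ℓ₁-OnExtension : OnExtension (ℓ₁ ρ) t
      ℓ₁-OnExtension = t³ , t² , λ where
          0F → left 1#-homo 0#-homo
          1F → right 0#-homo 1#-homo
          2F → K.sym (K.trans (K.+-cong t³ρ≈t (K.trans (K.*-congˡ 0#-homo) (K.zeroʳ _))) (K.+-identityʳ _))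
          3F → K.sym (K.trans (K.+-cong (K.trans (K.*-congˡ 0#-homo) (K.zeroʳ _)) t²ρ≈1) (K.+-identityˡ _))
        where
        t² t³ : K.Carrier
        t² = K.cubicCoords t 1F
        t³ = K.cubicCoords t 0F
        left : ∀ {a b x y} → x K.≈ K.1# → y K.≈ K.0# → a K.≈ a K.* x K.+ b K.* y
        left x≈1 y≈0 = K.sym (K.trans (K.+-cong (K.trans (K.*-congˡ x≈1) (K.*-identityʳ _)) (K.trans (K.*-congˡ y≈0) (K.zeroʳ _))) (K.+-identityʳ _))
        right : ∀ {a b x y} → x K.≈ K.0# → y K.≈ K.1# → b K.≈ a K.* x K.+ b K.* y
        right x≈0 y≈1 = K.trans (left y≈1 x≈0) (K.+-comm _ _)
        t²ρ≈1 : t² K.* ι ρ K.≈ K.1#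
        t²ρ≈1 = K.trans (K.*-congʳ (K.trans (K.*-congˡ (K.*-identityʳ t)) (K.trans root (K.trans (K.+-congʳ (K.trans (K.*-congʳ 0#-homo) (K.zeroˡ t))) (K.+-identityˡ _)))))
          (K.trans (K.sym (*-homo r ρ)) (K.trans (ι-cong r*ρ≈1) 1#-homo))
        t³ρ≈t : t³ K.* ι ρ K.≈ t
        t³ρ≈t = K.trans (K.*-assoc t _ _) (K.trans (K.*-congˡ t²ρ≈1) (K.*-identityʳ t))

      ℓ₁-imaginaryChord : ImaginaryChord (ℓ₁ ρ)
      ℓ₁-imaginaryChord = imaginaryChord (ℓ₁ ρ) t irr ℓ₁-OnExtension

      ℓ₁-stabilizer : ∀ g → InG g → Fixes g (ℓ₁ ρ) →
        ∃[ α ] ∃[ b ] ∃[ d ] (α ≈ - 1# ⊎ α ≈ 1#) × ¬ (b ≈ 0# × d ≈ 0#) × matrix g ∼ Ψ₁ ρ α b d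
      ℓ₁-stabilizer g g∈G fixes = form (stabilizer-form irr root (ℓ₁ ρ) ℓ₁-OnExtension g g∈G fixes)
        where
        compare : ∀ {a b c d} α → α * α ≈ 1# → a ≈ α * d → c ≈ α * (ρ * b) → ¬ (c ≈ 0# × d ≈ 0#) →
          matrix g ∼ cubicMatrix a b c d → ¬ (b ≈ 0# × d ≈ 0#) × matrix g ∼ Ψ₁ ρ α b d
        compare {a} {b} {c} {d} α α²≈1 a≈ c≈ cd≉0 (k , k≉0 , g≈) =
          (λ (b≈0 , d≈0) → cd≉0 (trans c≈ (trans (*-congˡ (trans (*-congˡ b≈0) (zeroʳ ρ))) (zeroʳ α)) , d≈0)) ,
          k , k≉0 , λ i j → trans (g≈ i j) (*-congˡ (trans (cubicMatrix-cong a≈ refl c≈ refl i j)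
            (trans (cubicMatrix-scaleRows α d b (ρ * b) d i j) (trans (*-congʳ (powers i)) (sym (Ψ₁-rows ρ α b d i j))))))
          where
          powers : ∀ i → (α * α * α ∷ α * α ∷ α ∷ 1# ∷ []) i ≈ (α ∷ 1# ∷ α ∷ 1# ∷ []) i
          powers 0F = trans (*-congʳ α²≈1) (*-identityˡ α)
          powers 1F = α²≈1
          powers 2F = refl
          powers 3F = refl
        r*c*ρ : ∀ c → ρ * (c * r) ≈ c
        r*c*ρ c = trans (solve 3 (λ r c ρ → ρ :* (c :* r) := r :* ρ :* c) refl r c ρ) (trans (*-congʳ r*ρ≈1) (*-identityˡ c))
        form : (∃[ ε ] ∃[ c ] ∃[ d ] ¬ (c ≈ 0# × d ≈ 0#) × matrix g ∼ stabilizingMatrix irr root ε c d) →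
          ∃[ α ] ∃[ b ] ∃[ d ] (α ≈ - 1# ⊎ α ≈ 1#) × ¬ (b ≈ 0# × d ≈ 0#) × matrix g ∼ Ψ₁ ρ α b d
        -- With S = 0 and D = 1 / ρ, fixing t means a = d and c = ρ b, which is α = 1; exchanging
        -- the conjugates means a = - d and c = - ρ b, which is α = - 1.
        form (0F , c , d , cd≉0 , g∼) = 1# , c * r , d , inj₂ refl ,
          compare 1# (*-identityˡ 1#) (solve 2 (λ c d → c :* con (ℤ.+ 0) :+ d := con (ℤ.+ 1) :* d) refl c d)
            (sym (trans (*-identityˡ _) (r*c*ρ c))) cd≉0 g∼
        form (1F , c , d , cd≉0 , g∼) = - 1# , 0# * d - c * r , d , inj₁ refl ,
          compare (- 1#) (solve 0 (:- con (ℤ.+ 1) :* (:- con (ℤ.+ 1)) := con (ℤ.+ 1)) refl)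
            (solve 1 (λ d → :- d := :- con (ℤ.+ 1) :* d) refl d)
            (sym (trans (solve 4 (λ c d r ρ → :- con (ℤ.+ 1) :* (ρ :* (con (ℤ.+ 0) :* d :- c :* r)) := ρ :* (c :* r)) refl c d r ρ) (r*c*ρ c))) cd≉0 g∼

  -- Even q and the line ℓ₂

  module EvenOrder (2∣q : 2 ∣ q) where

    private
      p≡2 : p ≡ 2
      p≡2 = even-prime-power p-prime h (≡.subst (2 ∣_) q≡p^h 2∣q)

      2·1≈0 : 2 · 1# ≈ 0#
      2·1≈0 = ≡.subst (λ n → n · 1# ≈ 0#) p≡2 (p·1≈0 p h q≡p^h)

      2≈0 : 1# + 1# ≈ 0#
      2≈0 = trans (+-congˡ (sym (+-identityʳ 1#))) 2·1≈0

      x+x≈0 : ∀ x → x + x ≈ 0#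
      x+x≈0 x = trans (sym (+-cong (*-identityˡ x) (*-identityˡ x))) (trans (sym (distribʳ x 1# 1#)) (trans (*-congʳ 2≈0) (zeroˡ x)))

      -x≈x : ∀ x → - x ≈ x
      -x≈x x = sym (uniqueˡ-⁻¹ x x (x+x≈0 x))

      ι2≈0 : K.1# K.+ K.1# K.≈ K.0#
      ι2≈0 = K.trans (K.sym (K.trans (+-homo 1# 1#) (K.+-cong 1#-homo 1#-homo))) (K.trans (ι-cong 2≈0) 0#-homo)

      K-drop-2 : ∀ {x y z} → x K.≈ y K.+ (K.1# K.+ K.1#) K.* z → x K.≈ y
      K-drop-2 x≈ = K.trans x≈ (K.trans (K.+-congˡ (K.trans (K.*-congʳ ι2≈0) (K.zeroˡ _))) (K.+-identityʳ _))

      sum-telescopes : ∀ n (a : ℕ → Carrier) → sum {n} (λ i → a (suc (toℕ i)) + a (toℕ i)) ≈ a n + a 0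
      sum-telescopes zero a = sym (x+x≈0 (a 0))
      sum-telescopes (suc n) a = trans (+-congˡ (sum-telescopes n (a ∘ suc)))
        (drop-2 2≈0 (solve 3 (λ x y z → x :+ y :+ (z :+ x) := z :+ y :+ (con (ℤ.+ 1) :+ con (ℤ.+ 1)) :* x) refl (a 1) (a 0) (a (suc n))))

    -- Additivity of squaring turns the i-th summand into x ^ (2 ^ (i + 1)) + x ^ (2 ^ i), so in
    -- characteristic two the trace telescopes to x ^ q + x = x + x = 0.
    trace-x²+x : ∀ x {y} → y ≈ x * x + x → absoluteTrace F p h y ≈ 0#
    trace-x²+x x {y} y≈ = ≡.subst (λ n → absoluteTrace F n h y ≈ 0#) (≡.sym p≡2)
      (trans (sum-cong-≋ {h} power) (trans (sum-telescopes h (λ i → x ^ (2 ℕ.^ i)))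
        (trans (+-cong x^2^h≈x (*-identityʳ x)) (x+x≈0 x))))
      where
      open Algebra.Properties.CommutativeMonoid.Sum +-commutativeMonoid using (sum-cong-≋)
      open Algebra.Properties.CommutativeSemiring.Exp commutativeSemiring using (^-congˡ; ^-assocʳ)
      x^2^h≈x : x ^ (2 ℕ.^ h) ≈ x
      x^2^h≈x = ≡.subst (λ n → x ^ n ≈ x) (≡.trans q≡p^h (≡.cong (ℕ._^ h) p≡2)) (x^q≈x x)
      power : ∀ (i : Fin h) → y ^ (2 ℕ.^ toℕ i) ≈ x ^ (2 ℕ.^ suc (toℕ i)) + x ^ (2 ℕ.^ toℕ i)
      power i = trans (^-congˡ n (trans y≈ (+-congʳ (*-congˡ (sym (*-identityʳ x))))))
        (trans (Frobenius.+-^p^ commutativeRing prime[2] 2·1≈0 (toℕ i) (x ^ 2) x) (+-congʳ (^-assocʳ x 2 n)))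
        where
        n : ℕ
        n = 2 ℕ.^ toℕ i

    -- Dividing an irrational t by its trace S turns its polynomial into X² = X + D / S². Here S is
    -- nonzero, since otherwise t would equal its conjugate S - t in characteristic two.
    artin-schreier-root : ∃[ δ ] ∃[ τ ] ¬ Rational τ × IsRoot 1# δ τ
    artin-schreier-root = s * s * D , ι s K.* t , irrational-multiple irr (⁻¹≉0 S S≉0) , (begin
      ι s K.* t K.* (ι s K.* t)
        ≈⟨ K.solve 2 (λ s t → s K.:* t K.:* (s K.:* t) K.:= s K.:* s K.:* (t K.:* t)) K.refl (ι s) t ⟩
      ι s K.* ι s K.* (t K.* t)
        ≈⟨ K.*-congˡ root ⟩
      ι s K.* ι s K.* (ι S K.* t K.+ ι D)
        ≈⟨ K.solve 4 (λ z s d t → z K.:* z K.:* (s K.:* t K.:+ d) K.:= z K.:* s K.:* (z K.:* t) K.:+ z K.:* z K.:* d) K.refl (ι s) (ι S) (ι D) t ⟩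
      ι s K.* ι S K.* (ι s K.* t) K.+ ι s K.* ι s K.* ι D
        ≈⟨ K.+-cong (K.*-congʳ (K.trans (K.sym (*-homo s S)) (ι-cong (⁻¹-inverseˡ S S≉0))))
                    (K.sym (K.trans (*-homo _ _) (K.*-congʳ (*-homo s s)))) ⟩
      ι 1# K.* (ι s K.* t) K.+ ι (s * s * D) ∎)
      where
      t : K.Carrier
      t = proj₁ irrational
      irr : ¬ Rational t
      irr = proj₂ irrational
      S D : Carrier
      S = proj₁ (minimal-polynomial irr)
      D = proj₁ (proj₂ (minimal-polynomial irr))
      root : IsRoot S D t
      root = proj₂ (proj₂ (minimal-polynomial irr))
      S≉0 : S ≉ 0#
      S≉0 S≈0 = root≉conjugate irr root (K.sym (K-drop-2 {z = K.- t} (K.trans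
        (K.+-congʳ (K.trans (ι-cong S≈0) 0#-homo))
        (K.solve 1 (λ t → K.con (ℤ.+ 0) K.:- t K.:= t K.:+ (K.con (ℤ.+ 1) K.:+ K.con (ℤ.+ 1)) K.:* (K.:- t)) K.refl t))))
      s : Carrier
      s = S ⁻¹⟨ S≉0 ⟩

    module _ (η : Carrier) (trace≈1 : absoluteTrace F p h η ≈ 1#) where

      -- Modulo the index-two subgroup { x² + x }, the elements δ and η are equal.
      artin-schreier-root-of : ∀ {δ τ} → ¬ Rational τ → IsRoot 1# δ τ → ∃[ t ] ¬ Rational t × IsRoot 1# η t
      artin-schreier-root-of {δ} {τ} τ-irrational τ-root =
        -- η has trace 1 and is therefore not of the form x² + x, so it is x² + x + δ for some x,
        -- and τ + x is then a root of X² = X + η.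
        [ (λ (x , x²+x≈η) → contradiction (trans (sym trace≈1) (trace-x²+x x (sym x²+x≈η))) 1≉0) , translated ]′
        (two-to-one-cover (_+ 1#) (λ x → x * x + x) (λ x → x * x + x + δ) +-congʳ
          (λ x → trans (+-assoc x 1# 1#) (trans (+-congˡ 2≈0) (+-identityʳ x))) fibre (λ eq → fibre (+-cancelʳ _ _ _ eq)) disjoint η)
        where
        open Algebra.Properties.Group +-group using () renaming (∙-cancelʳ to +-cancelʳ)
        open Algebra.Properties.Ring ring using (x∙y⁻¹≈ε⇒x≈y)
        fibre : ∀ {x y} → x * x + x ≈ y * y + y → x ≈ y ⊎ x ≈ y + 1#
        fibre {x} {y} eq = [ (λ x-y≈0 → inj₁ (x∙y⁻¹≈ε⇒x≈y x y x-y≈0)) , (λ x+y+1≈0 → inj₂ (trans (uniqueˡ-⁻¹ x (y + 1#) x+y+1≈0) (-x≈x _))) ]′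
          (zero-product (x - y) (x + (y + 1#)) (trans
            (solve 2 (λ x y → (x :- y) :* (x :+ (y :+ con (ℤ.+ 1))) := x :* x :+ x :- (y :* y :+ y)) refl x y)
            (trans (+-congʳ eq) (-‿inverseʳ _))))
        -- Translation by 1# has no fixed points, so no common value is allowed: it would make x + y
        -- a root in F of X² = X + δ, whose roots τ and 1 - τ are irrational.
        disjoint : ∀ {x y} → x * x + x ≈ y * y + y + δ → y ≈ y + 1#
        disjoint {x} {y} eq = contradiction z-root no-root
          where
          z : Carrier
          z = x + y
          z-root : z * z ≈ z + δ
          z-root = drop-2 2≈0 (trans
            (solve 3 (λ x y d → (x :+ y) :* (x :+ y)
              := x :* x :+ x :- (y :* y :+ y :+ d) :+ (x :+ y :+ d :+ (con (ℤ.+ 1) :+ con (ℤ.+ 1)) :* (y :* y :+ x :* y :- x))) refl x y δ)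
            (trans (+-congʳ (trans (+-congʳ eq) (-‿inverseʳ _))) (+-identityˡ _)))
          no-root : ¬ (z * z ≈ z + δ)
          no-root z²≈z+δ =
            [ (λ z≈τ → τ-irrational (z , z≈τ)) , (λ z≈1-τ → conjugate-irrational τ-irrational τ-root 1F (z , z≈1-τ)) ]′
            (roots τ-root (K.trans (K.sym (*-homo z z)) (K.trans (ι-cong z²≈z+δ) (K.trans (+-homo z δ)
              (K.+-congʳ (K.sym (K.trans (K.*-congʳ 1#-homo) (K.*-identityˡ (ι z)))))))))
        translated : (∃[ x ] x * x + x + δ ≈ η) → ∃[ t ] ¬ Rational t × IsRoot 1# η t
        translated (x , x²+x+δ≈η) = τ K.+ ι x , irrational-translate τ-irrational , K-drop-2 (begin
          (τ K.+ ι x) K.* (τ K.+ ι x)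
            ≈⟨ K.solve 2 (λ t x → (t K.:+ x) K.:* (t K.:+ x) K.:= t K.:* t K.:+ (x K.:* x K.:+ t K.:* x K.:+ t K.:* x)) K.refl τ (ι x) ⟩
          τ K.* τ K.+ (ι x K.* ι x K.+ τ K.* ι x K.+ τ K.* ι x)
            ≈⟨ K.+-congʳ (K.trans τ-root (K.+-congʳ (K.*-congʳ 1#-homo))) ⟩
          K.1# K.* τ K.+ ι δ K.+ (ι x K.* ι x K.+ τ K.* ι x K.+ τ K.* ι x)
            ≈⟨ K.solve 3 (λ t x d → K.con (ℤ.+ 1) K.:* t K.:+ d K.:+ (x K.:* x K.:+ t K.:* x K.:+ t K.:* x)
                 K.:= K.con (ℤ.+ 1) K.:* (t K.:+ x) K.:+ (x K.:* x K.:+ x K.:+ d) K.:+ (K.con (ℤ.+ 1) K.:+ K.con (ℤ.+ 1)) K.:* (t K.:* x K.:- x)) K.refl τ (ι x) (ι δ) ⟩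
          K.1# K.* (τ K.+ ι x) K.+ (ι x K.* ι x K.+ ι x K.+ ι δ) K.+ (K.1# K.+ K.1#) K.* (τ K.* ι x K.- ι x)
            ≈⟨ K.+-congʳ (K.+-cong (K.*-congʳ 1#-homo) (K.trans (ι-cong (sym x²+x+δ≈η)) (K.trans (+-homo _ _) (K.+-congʳ (K.trans (+-homo _ _) (K.+-congʳ (*-homo x x))))))) ⟨
          ι 1# K.* (τ K.+ ι x) K.+ ι η K.+ (K.1# K.+ K.1#) K.* (τ K.* ι x K.- ι x) ∎)

      private
        choice : ∃[ t ] ¬ Rational t × IsRoot 1# η t
        choice = let (_ , _ , irr , root) = artin-schreier-root in artin-schreier-root-of irr root
        t : K.Carrier
        t = proj₁ choice
        irr : ¬ Rational t
        irr = proj₁ (proj₂ choice)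
        root : IsRoot 1# η t
        root = proj₂ (proj₂ choice)

      -- The points defining `ℓ₂ η` are `β₁` and `β₀` for S = 1 and D = η, so P(t) is t times the
      -- first plus the second.
      ℓ₂-OnExtension : OnExtension (ℓ₂ η) t
      ℓ₂-OnExtension = t , K.1# , λ i → K.trans (cubicCoords-decomposition root i)
        (K.trans (K.+-comm _ _) (K.+-cong (K.trans (K.*-comm _ _) (K.*-congˡ (ι-cong (β₁≈ i)))) (K.trans (ι-cong (β₀≈ i)) (K.sym (K.*-identityˡ _)))))
        where
        β₁≈ : ∀ i → β₁ 1# η i ≈ coords (p₁ (ℓ₂ η)) i
        β₁≈ 0F = trans (+-congʳ (*-identityˡ 1#)) (+-comm 1# η)
        β₁≈ 1F = refl
        β₁≈ 2F = refl
        β₁≈ 3F = refl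
        β₀≈ : ∀ i → β₀ 1# η i ≈ coords (p₂ (ℓ₂ η)) i
        β₀≈ 0F = *-identityˡ η
        β₀≈ 1F = refl
        β₀≈ 2F = refl
        β₀≈ 3F = refl

      ℓ₂-imaginaryChord : ImaginaryChord (ℓ₂ η)
      ℓ₂-imaginaryChord = imaginaryChord (ℓ₂ η) t irr ℓ₂-OnExtension

      ℓ₂-stabilizer : ∀ g → InG g → Fixes g (ℓ₂ η) →
        ∃[ α ] ∃[ c ] ∃[ d ] (α ≈ 0# ⊎ α ≈ 1#) × ¬ (c ≈ 0# × d ≈ 0#) × matrix g ∼ Ψ₂ η α c d
      ℓ₂-stabilizer g g∈G fixes = form (stabilizer-form irr root (ℓ₂ η) ℓ₂-OnExtension g g∈G fixes)
        where
        compare : ∀ {a b c d} α → a ≈ α * c + d → b ≈ η * c + (α + 1#) * d →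
          matrix g ∼ cubicMatrix a b c d → matrix g ∼ Ψ₂ η α c d
        compare {a} {b} {c} {d} α a≈ b≈ (k , k≉0 , g≈) = k , k≉0 , λ i j →
          trans (g≈ i j) (*-congˡ (trans (cubicMatrix-cong a≈ b≈ refl refl i j)
            (cubicMatrix-char2 (α * c + d) (η * c + (α + 1#) * d) c d 2≈0 i j)))
        form : (∃[ ε ] ∃[ c ] ∃[ d ] ¬ (c ≈ 0# × d ≈ 0#) × matrix g ∼ stabilizingMatrix irr root ε c d) →
          ∃[ α ] ∃[ c ] ∃[ d ] (α ≈ 0# ⊎ α ≈ 1#) × ¬ (c ≈ 0# × d ≈ 0#) × matrix g ∼ Ψ₂ η α c d
        -- With S = 1 and D = η, fixing t means a = c + d and b = η c, which is α = 1, the term (α +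
        -- 1) d vanishing as 2 = 0. Exchanging the conjugates means a = d and b = η c + d up to
        -- signs, which is α = 0.
        form (0F , c , d , cd≉0 , g∼) = 1# , c , d , inj₂ refl , cd≉0 ,
          compare 1# (+-congʳ (*-comm c 1#))
            (trans (*-comm c η) (sym (trans (+-congˡ (trans (*-congʳ 2≈0) (zeroˡ d))) (+-identityʳ _)))) g∼
        form (1F , c , d , cd≉0 , g∼) = 0# , c , d , inj₁ refl , cd≉0 ,
          compare 0# (trans (-x≈x d) (sym (trans (+-congʳ (zeroˡ c)) (+-identityˡ d))))
            (trans (+-congˡ (-x≈x _)) (solve 3 (λ c d e → con (ℤ.+ 1) :* d :+ c :* e := e :* c :+ (con (ℤ.+ 0) :+ con (ℤ.+ 1)) :* d) refl c d η)) g∼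

theorem5p4 : ∀ {c ℓ c′ ℓ′} (p h q : ℕ) → Prime p → q ≡ p ℕ.^ h → 5 ℕ.≤ q →
  (F : FiniteField c ℓ q) (K : FiniteField c′ ℓ′ (q ℕ.^ 2)) →
  (ι : FiniteField.Carrier F → FiniteField.Carrier K) → Chords.IsEmbedding F K ι →
  let open FiniteField F
      open PG3 F
      open Chords F K ι
  in IsOrbit ImaginaryChord
   × (∀ l → ImaginaryChord l → HasSize (stabilizer l) (2 ℕ.* (q ℕ.+ 1)))
   × (¬ (2 ∣ q) → ∀ ρ → NonSquare ρ →
        ImaginaryChord (ℓ₁ ρ)
      × (∀ g → InG g → Fixes g (ℓ₁ ρ) →
           ∃[ α ] ∃[ b ] ∃[ d ] (α ≈ - 1# ⊎ α ≈ 1#) × ¬ (b ≈ 0# × d ≈ 0#)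
             × matrix g ∼ Ψ₁ ρ α b d))
   × (2 ∣ q → ∀ η → absoluteTrace F p h η ≈ 1# →
        ImaginaryChord (ℓ₂ η)
      × (∀ g → InG g → Fixes g (ℓ₂ η) →
           ∃[ α ] ∃[ c ] ∃[ d ] (α ≈ 0# ⊎ α ≈ 1#) × ¬ (c ≈ 0# × d ≈ 0#)
             × matrix g ∼ Ψ₂ η α c d))
theorem5p4 p h q p-prime q≡p^h 5≤q F K ι ι-embedding =
  imaginaryChords-orbit ,
  (λ l (t , irr , t∈l , _) → stabilizer-size irr (proj₂ (proj₂ (minimal-polynomial irr))) l t∈l) ,
  (λ q-odd ρ nonsquare → OddOrder.ℓ₁-imaginaryChord q-odd ρ nonsquare , OddOrder.ℓ₁-stabilizer q-odd ρ nonsquare) ,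
  (λ 2∣q η trace≈1 → EvenOrder.ℓ₂-imaginaryChord 2∣q η trace≈1 , EvenOrder.ℓ₂-stabilizer 2∣q η trace≈1)
  where
  open ImaginaryChords p h q p-prime q≡p^h 5≤q F K ι ι-embedding
  open ChordGeometry F K ι ι-embedding using (minimal-polynomial)
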